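{- Let $G$ be an $n$-unexceptional $2$-connected graph of order $n \ge 10$. Then $\eta(G) \ge 2n$.
   Context: All graphs are finite, simple and connected; the order of a graph is its number of vertices. Let $d_G(u,v)$ be the usual shortest-path distance. The Wiener index is $W(G)=\sum_{\{u,v\}\subseteq V(G)} d_G(u,v)$, the sum being over unordered pairs of distinct vertices. For an edge $ab\in E(G)$ let $n_{ab}(a)=|\{c\in V(G): d_G(c,a)<d_G(c,b)\}|$ and $n_{ab}(b)=|\{c\in V(G): d_G(c,b)<d_G(c,a)\}|$. The Szeged index is $Sz(G)=\sum_{ab\in E(G)} n_{ab}(a)\,n_{ab}(b)$. The Szeged--Wiener gap is $\eta(G)=Sz(G)-W(G)$. For integers $n,t$ with $1\le t\le n-1$, $K_n^t$ denotes the graph of order $n$ obtained from the complete graph $K_{n-1}$ by adding one new vertex adjacent to exactly $t$ vertices of $K_{n-1}$. A graph $G$ is $n$-exceptional if it is isomorphic to one of $K_n$, $K_n^2$, $K_n^{n-2}$, and $n$-unexceptional otherwise. -}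

module Defs where

open import Data.Empty using (⊥)
open import Data.Fin.Base using (Fin; zero; suc; toℕ; punchIn)
import Data.Fin.Properties as Fin
open import Data.Integer.Base using (ℤ; +_; _-_)
open import Data.List.Base using (List; allFin; cartesianProduct; filter; length; map)
open import Data.Nat.Base using (ℕ; zero; suc; pred; _*_; _∸_; _≤_; z≤n; s≤s)
open import Data.Nat.ListAction using (sum)
import Data.Nat.Properties as ℕ
open import Data.Product.Base using (∃; _×_; _,_; proj₁; uncurry)
open import Data.Sum.Base using (_⊎_)
open import Function.Base using (_∘_)
open import Function.Bundles using (_↔_; _⇔_; Inverse)
open import Level using (0ℓ)
open import Relation.Binary.Core using (Rel)
open import Relation.Binary.Definitions using (Decidable; Symmetric; Irreflexive)
open import Relation.Binary.PropositionalEquality using (_≡_; _≢_; refl; ≢-sym)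
open import Relation.Nullary.Decidable using (Dec; yes; no; map′; ¬?; _×-dec_)
open import Relation.Nullary.Negation using (contradiction)
import Relation.Unary as U

private
  variable
    m n : ℕ

-- Finite simple graphs of order n.  Connectedness is kept separate, because
-- vertex-deleted subgraphs need not be connected.

record Graph (n : ℕ) : Set₁ where
  field
    Adj    : Rel (Fin n) 0ℓ
    adj?   : Decidable Adj
    sym    : Symmetric Adj
    irrefl : Irreflexive _≡_ Adj

open Graph public using (Adj; adj?)

record _≅_ (G : Graph m) (H : Graph n) : Set where
  field
    bijection : Fin m ↔ Fin n
    adjacency : ∀ u v → Adj G u v ⇔ Adj H (Inverse.to bijection u) (Inverse.to bijection v)

data Walk (G : Graph n) : ℕ → Fin n → Fin n → Set where
  []  : ∀ {u} → Walk G 0 u u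
  _∷_ : ∀ {u v w k} → Adj G u v → Walk G k v w → Walk G (suc k) u w

Connected : Graph n → Set
Connected G = ∀ u v → ∃ λ k → Walk G k u v

-- The subgraph induced on all vertices other than w, relabelled by punchIn w.

_∖_ : Graph n → Fin n → Graph (pred n)
_∖_ {suc n} G w = record
  { Adj    = λ u v → Adj G (punchIn w u) (punchIn w v)
  ; adj?   = λ u v → adj? G (punchIn w u) (punchIn w v)
  ; sym    = Graph.sym G
  ; irrefl = λ { refl → Graph.irrefl G refl }
  }

record TwoConnected (G : Graph n) : Set where
  field
    order≥3     : 3 ≤ n
    connected   : Connected G
    noCutVertex : ∀ w → Connected (G ∖ w)

walk? : (G : Graph n) → ∀ k u v → Dec (Walk G k u v)
walk? G zero    u v = map′ (λ { refl → [] }) (λ { [] → refl }) (u Fin.≟ v)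
walk? G (suc k) u v = map′ (λ { (_ , e , p) → e ∷ p }) (λ { (e ∷ p) → _ , e , p })
  (Fin.any? λ w → adj? G u w ×-dec walk? G k w v)

least : {P : U.Pred ℕ 0ℓ} → U.Decidable P → ∀ k → P k → ∃ λ l → P l × (∀ j → P j → l ≤ j)
least P? k p with P? 0
... | yes p₀ = 0 , p₀ , λ _ _ → z≤n
least P? zero    p | no ¬p₀ = contradiction p ¬p₀
least P? (suc k) p | no ¬p₀ with least (P? ∘ suc) k p
... | l , pl , min = suc l , pl , λ { zero    q → contradiction q ¬p₀
                                    ; (suc j) q → s≤s (min j q) }

-- The unordered pairs {u , v} of distinct vertices, each listed once, with u < v.

pairs : ∀ n → List (Fin n × Fin n)
pairs n = filter (uncurry Fin._<?_) (cartesianProduct (allFin n) (allFin n))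

edges : Graph n → List (Fin n × Fin n)
edges {n} G = filter (uncurry (adj? G)) (pairs n)

module _ (G : Graph n) (conn : Connected G) where

  -- A shortest walk repeats no vertex, so this is the length of a shortest path.

  dist : Fin n → Fin n → ℕ
  dist u v = proj₁ (uncurry (least λ k → walk? G k u v) (conn u v))

  wiener : ℕ
  wiener = sum (map (uncurry dist) (pairs n))

  -- closer a b is n_ab(a), the number of vertices strictly closer to a than to b.

  closer : Fin n → Fin n → ℕ
  closer a b = length (filter (λ c → dist c a ℕ.<? dist c b) (allFin n))

  szeged : ℕ
  szeged = sum (map (λ (a , b) → closer a b * closer b a) (edges G))

  η : ℤ
  η = + szeged - + wiener

complete : ∀ n → Graph n
complete n = record
  { Adj    = _≢_
  ; adj?   = λ u v → ¬? (u Fin.≟ v)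
  ; sym    = ≢-sym
  ; irrefl = λ u≡v u≢v → u≢v u≡v
  }

-- G together with a new vertex zero whose neighbours are the old vertices satisfying P.

addVertex : Graph n → {P : U.Pred (Fin n) 0ℓ} → U.Decidable P → Graph (suc n)
addVertex {n} G {P} P? = record
  { Adj    = _~_
  ; adj?   = _~?_
  ; sym    = λ {u} {v} → ~-sym u v
  ; irrefl = λ { {u} refl → ~-irrefl u }
  }
  where
  _~_ : Rel (Fin (suc n)) 0ℓ
  zero  ~ zero  = ⊥
  zero  ~ suc v = P v
  suc u ~ zero  = P u
  suc u ~ suc v = Adj G u v

  _~?_ : Decidable _~_
  zero  ~? zero  = no λ ()
  zero  ~? suc v = P? v
  suc u ~? zero  = P? u
  suc u ~? suc v = adj? G u v

  ~-sym : ∀ u v → u ~ v → v ~ u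
  ~-sym zero    (suc v) p = p
  ~-sym (suc u) zero    p = p
  ~-sym (suc u) (suc v) e = Graph.sym G e

  ~-irrefl : ∀ u → u ~ u → ⊥
  ~-irrefl (suc u) e = Graph.irrefl G refl e

-- K_n^t.  For 1 ≤ t ≤ n - 1 the new vertex has exactly t neighbours;
-- values of n and t outside this range are not meaningful.

completePlus : ∀ n → ℕ → Graph n
completePlus zero    t = complete zero
completePlus (suc m) t = addVertex (complete m) (λ i → toℕ i ℕ.<? t)

Exceptional : Graph n → Set
Exceptional {n} G = G ≅ complete n ⊎ G ≅ completePlus n 2 ⊎ G ≅ completePlus n (n ∸ 2)

{-# OPTIONS --safe #-}

-- For vertices u and v let g u v be the number of edges pq such that u is
-- nearer to p and v is nearer to q.  The edges of a shortest walk from u to v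
-- qualify, so c u v = g u v - d u v is not negative, and counting by edges
-- shows that c sums to 2 η over ordered pairs.
--
-- Let cost u be the sum of c u v over all v.  Consider the vertices which u
-- reaches only through a vertex y; since y is no cut vertex, an edge avoiding y
-- leaves this set, and its ends have positive excess with u.  Hence cost u ≥ 2
-- unless u is adjacent to all other vertices, and cost u ≥ 4 if some vertex is
-- at distance three from u.  If every cost is at least four, then η ≥ 2 n.
--
-- Otherwise some u is adjacent to all other vertices or has cost at most three,
-- and in both cases there is a vertex x with N[x] ⊆ N[a] for a neighbour a of x
-- that is not a cut vertex of G ∖ a.  Then G ∖ x is 2-connected and has the
-- distances of G, and passing from G ∖ x to G raises η by cost x, or by at least
-- cost x + 2 if N(x) is no clique.  If this is only 2, the structure around x is
-- known completely, and G is exceptional or η ≥ 2 n.  So η grows by at least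
-- three, and induction on n gives η ≥ 3 n - 10 for 5 ≤ n ≤ 10 and η ≥ 2 n
-- afterwards; the case of exceptional G ∖ x is a direct count.

module Submission where

open import Defs
import Algebra.Properties.Semiring.Sum
open import Data.Bool.Base using (if_then_else_)
open import Data.Empty using (⊥; ⊥-elim)
open import Data.Fin.Base using (Fin; zero; suc; punchIn; punchOut; toℕ; fromℕ)
import Data.Fin.Properties as Fin
open import Data.Fin.Permutation as Perm using (Permutation)
open import Data.Fin.Properties using (_≟_; any?; pigeonhole; all?; ¬∀⟶∃¬; punchInᵢ≢i; punchIn-punchOut; punchIn-injective)
open import Data.List.Base as List using (List; []; _∷_; length; _++_)
open import Data.List.Membership.Propositional using (_∈_)
open import Data.List.Properties using (length-++; map-++; map-∘)
open import Data.List.Relation.Unary.All as All using (All; []; _∷_)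
import Data.List.Relation.Unary.All.Properties as All
open import Data.List.Relation.Unary.AllPairs using ([]; _∷_)
open import Data.List.Relation.Unary.Any as Any using (here; there)
import Data.List.Relation.Unary.Any.Properties as Any
open import Data.List.Relation.Unary.Unique.Propositional using (Unique)
import Data.List.Relation.Unary.Unique.Propositional.Properties as Unique
open import Data.Nat.Base
open import Data.Nat.ListAction using () renaming (sum to sumᴸ)
open import Data.Nat.ListAction.Properties using (sum-++)
open import Data.Nat.Properties hiding (_≟_)
import Data.Nat.Properties as ℕ
open import Data.Nat.Tactic.RingSolver using (solve-∀)
open import Data.Product.Base using (_×_; _,_; proj₁; proj₂; ∃; ∃₂; uncurry)
open import Data.Product.Properties using (≡-dec)
open import Data.Sum.Base using (_⊎_; inj₁; inj₂; [_,_]′)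
open import Function.Base using (_∘_; case_of_)
open import Function.Bundles using (_⇔_; mk⇔; Equivalence)
open import Level using (Level)
open import Relation.Binary.Definitions using (DecidableEquality; tri<; tri≈; tri>)
open import Relation.Binary.PropositionalEquality
open import Relation.Nullary.Decidable using (Dec; yes; no; does; map′; _×-dec_; _⊎-dec_; _→-dec_; ¬?; decidable-stable)
open import Relation.Nullary.Negation using (¬_; contradiction)
open import Relation.Unary using (Decidable)

-- The bound 2 n fails for small orders: joining a new vertex to three vertices of K_5 gives a graph
-- of order six with gap 8. The graphs K_n^2 and K_n^{n-2} have gap only 2 n - 6. This is why they
-- are excluded, and also the obstacle in the induction: when `G ∖ x` is one of them, a step of
-- three does not suffice, and `cost x` itself has to be about n - 2. All lower bounds for the
-- excess have one source. The edges of a single shortest walk already account for `d u v`, so it is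
-- enough to exhibit a few good edges that do not lie on it.

private
  module Sum = Algebra.Properties.Semiring.Sum ℕ.+-*-semiring

  variable
    ℓ ℓ′ : Level
    X : Set ℓ
    Y : Set ℓ′
    m n k l : ℕ

-- Indicators and finite sums

⟦_⟧ : Dec X → ℕ
⟦ p ⟧ = if does p then 1 else 0

⟦⟧-yes : (p : Dec X) → X → ⟦ p ⟧ ≡ 1
⟦⟧-yes (yes _) _ = refl
⟦⟧-yes (no ¬x) x = contradiction x ¬x

⟦⟧-no : (p : Dec X) → ¬ X → ⟦ p ⟧ ≡ 0
⟦⟧-no (yes x) ¬x = contradiction x ¬x
⟦⟧-no (no _) _ = refl

⟦⟧-mono : (p : Dec X) (q : Dec Y) → (X → Y) → ⟦ p ⟧ ≤ ⟦ q ⟧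
⟦⟧-mono (yes x) q f = ≤-reflexive (sym (⟦⟧-yes q (f x)))
⟦⟧-mono (no _) q f = z≤n

⟦⟧-cong : (p : Dec X) (q : Dec Y) → (X → Y) → (Y → X) → ⟦ p ⟧ ≡ ⟦ q ⟧
⟦⟧-cong p q f g = ≤-antisym (⟦⟧-mono p q f) (⟦⟧-mono q p g)

⟦⟧-× : (p : Dec X) (q : Dec Y) → ⟦ p ×-dec q ⟧ ≡ ⟦ p ⟧ * ⟦ q ⟧
⟦⟧-× (yes _) (yes _) = refl
⟦⟧-× (yes _) (no _) = refl
⟦⟧-× (no _) _ = refl

opaque
  ∑ : (Fin n → ℕ) → ℕ
  ∑ = Sum.sum

  ∑-cong : {f h : Fin n → ℕ} → (∀ i → f i ≡ h i) → ∑ f ≡ ∑ h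
  ∑-cong = Sum.sum-cong-≗

  ∑-+ : (f h : Fin n → ℕ) → ∑ (λ i → f i + h i) ≡ ∑ f + ∑ h
  ∑-+ = Sum.∑-distrib-+

  ∑-comm : (f : Fin m → Fin n → ℕ) → ∑ (λ i → ∑ (f i)) ≡ ∑ λ j → ∑ λ i → f i j
  ∑-comm = Sum.∑-comm

  ∑-*ʳ : (f : Fin n → ℕ) (k : ℕ) → ∑ (λ i → f i * k) ≡ ∑ f * k
  ∑-*ʳ f k = sym (Sum.*-distribʳ-sum k f)

  ∑-punch : (x : Fin (suc n)) (f : Fin (suc n) → ℕ) → ∑ f ≡ f x + ∑ (f ∘ punchIn x)
  ∑-punch x f = Sum.sum-remove f

  ∑-const : ∀ n k → ∑ {n} (λ _ → k) ≡ n * k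
  ∑-const zero k = refl
  ∑-const (suc n) k = cong (k +_) (∑-const n k)

  ∑-mono : {f h : Fin n → ℕ} → (∀ i → f i ≤ h i) → ∑ f ≤ ∑ h
  ∑-mono {zero} p = z≤n
  ∑-mono {suc n} p = +-mono-≤ (p zero) (∑-mono (p ∘ suc))

  ∑-pick : {f h : Fin n → ℕ} {k : ℕ} (x : Fin n) → (∀ i → h i ≤ f i) → h x + k ≤ f x → ∑ h + k ≤ ∑ f
  ∑-pick {suc n} {f} {h} {k} zero p q = begin
    h zero + ∑ (h ∘ suc) + k  ≡⟨ +-assoc (h zero) _ k ⟩
    h zero + (∑ (h ∘ suc) + k) ≡⟨ cong (h zero +_) (+-comm _ k) ⟩
    h zero + (k + ∑ (h ∘ suc)) ≡⟨ +-assoc (h zero) k _ ⟨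
    h zero + k + ∑ (h ∘ suc)  ≤⟨ +-mono-≤ q (∑-mono (p ∘ suc)) ⟩
    ∑ f                       ∎
    where open ≤-Reasoning
  ∑-pick {suc n} {f} {h} {k} (suc x) p q = begin
    h zero + ∑ (h ∘ suc) + k   ≡⟨ +-assoc (h zero) _ k ⟩
    h zero + (∑ (h ∘ suc) + k) ≤⟨ +-mono-≤ (p zero) (∑-pick x (p ∘ suc) q) ⟩
    ∑ f                        ∎
    where open ≤-Reasoning

∑∑ : (Fin n × Fin n → ℕ) → ℕ
∑∑ f = ∑ λ i → ∑ λ j → f (i , j)

∑∑-mono : {f h : Fin n × Fin n → ℕ} → (∀ e → f e ≤ h e) → ∑∑ f ≤ ∑∑ h
∑∑-mono p = ∑-mono λ i → ∑-mono λ j → p (i , j)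

∑∑-pick : {f h : Fin n × Fin n → ℕ} {k : ℕ} (e : Fin n × Fin n) → (∀ e′ → h e′ ≤ f e′) → h e + k ≤ f e → ∑∑ h + k ≤ ∑∑ f
∑∑-pick (x , y) p q = ∑-pick x (λ i → ∑-mono λ j → p (i , j)) (∑-pick y (λ j → p (x , j)) q)

module _ {A : Set} (_≟ᴬ_ : DecidableEquality A) (S : (A → ℕ) → ℕ)
         (pick : ∀ {f h k} x → (∀ y → h y ≤ f y) → h x + k ≤ f x → S h + k ≤ S f) where

  private
    erase : A → (A → ℕ) → A → ℕ
    erase x f y = if does (x ≟ᴬ y) then 0 else f y

    erase-≤ : ∀ x f y → erase x f y ≤ f y
    erase-≤ x f y with x ≟ᴬ y
    ... | yes _ = z≤n
    ... | no _  = ≤-refl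

    erase-self : ∀ x f → erase x f x ≡ 0
    erase-self x f with x ≟ᴬ x
    ... | yes _ = refl
    ... | no x≢x = contradiction refl x≢x

    erase-other : ∀ {x y} f → x ≢ y → erase x f y ≡ f y
    erase-other {x} {y} f x≢y with x ≟ᴬ y
    ... | yes x≡y = contradiction x≡y x≢y
    ... | no _ = refl

    map-erase : ∀ {x} f {xs} → All (x ≢_) xs → List.map (erase x f) xs ≡ List.map f xs
    map-erase f [] = refl
    map-erase f (p ∷ ps) = cong₂ _∷_ (erase-other f p) (map-erase f ps)

  -- Induction on the list: setting the value at the head to zero does not change the values on the
  -- tail, where the head does not recur, and `pick` gives the head's value back. It serves for sums
  -- over vertices and over edges alike.
  sumᴸ≤S : ∀ f {xs} → Unique xs → sumᴸ (List.map f xs) ≤ S f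
  sumᴸ≤S f [] = z≤n
  sumᴸ≤S f {x ∷ xs} (x∉ ∷ u) = begin
    f x + sumᴸ (List.map f xs)            ≡⟨ cong (λ l → f x + sumᴸ l) (map-erase f x∉) ⟨
    f x + sumᴸ (List.map (erase x f) xs)  ≤⟨ +-monoʳ-≤ (f x) (sumᴸ≤S (erase x f) u) ⟩
    f x + S (erase x f)                  ≡⟨ +-comm (f x) _ ⟩
    S (erase x f) + f x                  ≤⟨ pick x (erase-≤ x f) (≤-reflexive (cong (_+ f x) (erase-self x f))) ⟩
    S f                                  ∎
    where open ≤-Reasoning

sumᴸ≤∑ : (f : Fin n → ℕ) {xs : List (Fin n)} → Unique xs → sumᴸ (List.map f xs) ≤ ∑ f
sumᴸ≤∑ = sumᴸ≤S _≟_ ∑ ∑-pick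

sumᴸ≤∑∑ : (f : Fin n × Fin n → ℕ) {es : List (Fin n × Fin n)} → Unique es → sumᴸ (List.map f es) ≤ ∑∑ f
sumᴸ≤∑∑ = sumᴸ≤S (≡-dec _≟_ _≟_) ∑∑ ∑∑-pick

-- Distances and good edges

-- An abstract metric in place of `dist`, so that `G ∖ x` can later simply inherit the distances of
-- `G`. Shortest walks enter through `step` alone.
record Distances (G : Graph n) : Set where
  field
    d     : Fin n → Fin n → ℕ
    d0    : ∀ u → d u u ≡ 0
    d0⇒≡  : ∀ {u v} → d u v ≡ 0 → u ≡ v
    d-sym : ∀ u v → d u v ≡ d v u
    d-tri : ∀ u v w → d u w ≤ d u v + d v w
    adj⇒1 : ∀ {u v} → Adj G u v → d u v ≡ 1
    1⇒adj : ∀ {u v} → d u v ≡ 1 → Adj G u v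
    step  : ∀ {u v k} → d u v ≡ suc k → ∃ λ w → Adj G u w × d w v ≡ k

walk-of-length-d : {G : Graph n} (D : Distances G) (let open Distances D) → ∀ k {u v} → d u v ≡ k → Walk G k u v
walk-of-length-d {G = G} D zero {u} eq = subst (Walk G 0 u) (Distances.d0⇒≡ D eq) []
walk-of-length-d D (suc k) eq with Distances.step D eq
... | w , e , eq′ = e ∷ walk-of-length-d D k eq′

_++ʷ_ : {G : Graph n} → ∀ {u v w} → Walk G k u v → Walk G l v w → Walk G (k + l) u w
[]      ++ʷ q = q
(e ∷ p) ++ʷ q = e ∷ (p ++ʷ q)

reverseʷ : {G : Graph n} → ∀ {u v} → Walk G k u v → Walk G k v u
reverseʷ [] = []
reverseʷ {k = suc k} {G} {u} {v} (e ∷ p) = subst (λ j → Walk G j v u) (+-comm k 1) (reverseʷ p ++ʷ (Graph.sym G e ∷ []))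

module FromWalks (G : Graph n) (conn : Connected G) where

  private
    d : Fin n → Fin n → ℕ
    d = dist G conn

    shortest : ∀ u v → Walk G (d u v) u v
    shortest u v = proj₁ (proj₂ (uncurry (least λ k → walk? G k u v) (conn u v)))

    d≤ : ∀ {u v k} → Walk G k u v → d u v ≤ k
    d≤ {u} {v} p = proj₂ (proj₂ (uncurry (least λ k → walk? G k u v) (conn u v))) _ p

    walk₀ : ∀ {u v} → Walk G 0 u v → u ≡ v
    walk₀ [] = refl

    walk₁ : ∀ {u v} → Walk G 1 u v → Adj G u v
    walk₁ (e ∷ []) = e

    d-sym≤ : ∀ u v → d u v ≤ d v u
    d-sym≤ u v = d≤ (reverseʷ (shortest v u))

    d0⇒≡ : ∀ {u v} → d u v ≡ 0 → u ≡ v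
    d0⇒≡ {u} {v} eq = walk₀ (subst (λ j → Walk G j u v) eq (shortest u v))

    adj⇒1 : ∀ {u v} → Adj G u v → d u v ≡ 1
    adj⇒1 {u} {v} e with d u v in eq | d≤ (e ∷ [])
    ... | zero  | _ = contradiction e (Graph.irrefl G (d0⇒≡ eq))
    ... | suc zero | _ = refl
    ... | suc (suc _) | s≤s ()

    split : ∀ {u v} → Walk G (suc k) u v → ∃ λ w → Adj G u w × Walk G k w v
    split (e ∷ p) = _ , e , p

    step : ∀ {u v k} → d u v ≡ suc k → ∃ λ w → Adj G u w × d w v ≡ k
    step {u} {v} {k} eq with split (subst (λ j → Walk G j u v) eq (shortest u v))
    ... | w , e , p = w , e , ≤-antisym (d≤ p) (s≤s⁻¹ (subst (_≤ suc (d w v)) eq (d≤ (e ∷ shortest w v))))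

  distances : Distances G
  distances = record
    { d = d
    ; d0 = λ u → n≤0⇒n≡0 (d≤ {u} {u} [])
    ; d0⇒≡ = d0⇒≡
    ; d-sym = λ u v → ≤-antisym (d-sym≤ u v) (d-sym≤ v u)
    ; d-tri = λ u v w → d≤ (shortest u v ++ʷ shortest v w)
    ; adj⇒1 = adj⇒1
    ; 1⇒adj = λ {u} {v} eq → walk₁ (subst (λ j → Walk G j u v) eq (shortest u v))
    ; step = step
    }

module Metric {n : ℕ} {G : Graph n} (D : Distances G) where
  open Distances D public

  infix 4 _~_
  _~_ : Fin n → Fin n → Set
  _~_ = Adj G

  ~-sym : ∀ {u v} → u ~ v → v ~ u
  ~-sym = Graph.sym G

  ~⇒≢ : ∀ {u v} → u ~ v → u ≢ v
  ~⇒≢ e refl = Graph.irrefl G refl e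

  Edge : Set
  Edge = Fin n × Fin n

  -- Edges are oriented from the end nearer to `u` to the end nearer to `v`. At most one orientation
  -- is good, so `g` counts every undirected edge at most once.
  Good : Fin n → Fin n → Edge → Set
  Good u v (p , q) = p ~ q × d u p < d u q × d v q < d v p

  good? : ∀ u v e → Dec (Good u v e)
  good? u v (p , q) = adj? G p q ×-dec d u p <? d u q ×-dec d v q <? d v p

  g : Fin n → Fin n → ℕ
  g u v = ∑∑ λ e → ⟦ good? u v e ⟧

  c : Fin n → Fin n → ℕ
  c u v = g u v ∸ d u v

  cost : Fin n → ℕ
  cost u = ∑ (c u)

  total : ℕ
  total = ∑ cost

  edges≤g : ∀ {u v es} → Unique es → All (Good u v) es → length es ≤ g u v
  edges≤g {u} {v} {es} un gd = begin
    length es                                   ≡⟨ len gd ⟩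
    sumᴸ (List.map (λ e → ⟦ good? u v e ⟧) es)  ≤⟨ sumᴸ≤∑∑ _ un ⟩
    g u v                                       ∎
    where
    open ≤-Reasoning
    len : ∀ {es} → All (Good u v) es → length es ≡ sumᴸ (List.map (λ e → ⟦ good? u v e ⟧) es)
    len [] = refl
    len (x ∷ xs) = cong₂ _+_ (sym (⟦⟧-yes (good? u v _) x)) (len xs)

  vertices≤cost : ∀ u {vs} → Unique vs → sumᴸ (List.map (c u) vs) ≤ cost u
  vertices≤cost u = sumᴸ≤∑ (c u)

  Between : Fin n → Fin n → Fin n → Set
  Between u v y = d u y + d y v ≡ d u v

  between? : ∀ u v y → Dec (Between u v y)
  between? u v y = d u y + d y v ℕ.≟ d u v

  record Geodesic (u v : Fin n) : Set where
    field
      es      : List Edge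
      len     : length es ≡ d u v
      unique  : Unique es
      down    : All (λ (p , q) → p ~ q × d p v ≡ suc (d q v)) es
      between : All (λ (p , q) → Between u v p × Between u v q) es

  geodesic : ∀ {k} u v → d u v ≡ k → Geodesic u v
  geodesic {zero} u v eq = record { es = [] ; len = sym eq ; unique = [] ; down = [] ; between = [] }
  geodesic {suc k} u v eq with step eq
  ... | w , e , eq′ = record
    { es = (u , w) ∷ es
    ; len = trans (cong suc (trans len eq′)) (sym eq)
    ; unique = All.map (λ {e′} → fresh {e′}) between ∷ unique
    ; down = (e , trans eq (cong suc (sym eq′))) ∷ down
    ; between = (cong (_+ d u v) (d0 u) , bw) ∷ All.map (λ (x , y) → lift x , lift y) between
    }
    where
    open Geodesic (geodesic w v eq′)
    duv : d u v ≡ suc (d w v)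
    duv = trans eq (cong suc (sym eq′))
    bw : Between u v w
    bw = trans (cong (_+ d w v) (adj⇒1 e)) (sym duv)
    lift : ∀ {x} → Between w v x → Between u v x
    lift {x} p = ≤-antisym
      (≤-trans (+-monoˡ-≤ (d x v) (d-tri u w x)) (≤-reflexive
        (trans (+-assoc (d u w) _ _) (trans (cong₂ _+_ (adj⇒1 e) p) (sym duv)))))
      (d-tri u x v)
    fresh : ∀ {e′ : Edge} → Between w v (proj₁ e′) × Between w v (proj₂ e′) → (u , w) ≢ e′
    fresh (x , _) refl = 1+n≰n (≤-trans (≤-reflexive (sym duv)) (≤-trans (m≤n+m (d u v) (d w u)) (≤-reflexive x)))

-- A linear inequality a ≤ b follows from l ≤ r once a + r + s ≡ b + l is an identity.

farkas : ∀ {a b l r} s → l ≤ r → a + r + s ≡ b + l → a ≤ b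
farkas {a} {b} {l} {r} s l≤r eq = +-cancelʳ-≤ l a b (begin
  a + l      ≤⟨ +-monoʳ-≤ a l≤r ⟩
  a + r      ≤⟨ m≤m+n (a + r) s ⟩
  a + r + s  ≡⟨ eq ⟩
  b + l      ∎)
  where open ≤-Reasoning

-- Good edges off a shortest walk

module Detours {n : ℕ} {G : Graph n} (D : Distances G) where
  open Metric D

  d-pos : ∀ {u v} → u ≢ v → 1 ≤ d u v
  d-pos {u} {v} u≢v with d u v in eq
  ... | zero  = contradiction (d0⇒≡ eq) u≢v
  ... | suc _ = s≤s z≤n

  d≥2 : ∀ {u v} → u ≢ v → ¬ u ~ v → 2 ≤ d u v
  d≥2 u≢v u≁v = ≤∧≢⇒< (d-pos u≢v) (u≁v ∘ 1⇒adj ∘ sym)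

  d-adjˡ : ∀ {u v} w → u ~ v → d u w ≤ suc (d v w)
  d-adjˡ {u} {v} w e = subst (λ j → d u w ≤ j + d v w) (adj⇒1 e) (d-tri u v w)

  d-adjʳ : ∀ {u v} w → u ~ v → d w u ≤ suc (d w v)
  d-adjʳ {u} {v} w e = subst₂ (λ i j → i ≤ suc j) (d-sym u w) (d-sym v w) (d-adjˡ w e)

  d≡2 : ∀ {u v w} → u ≢ v → ¬ u ~ v → u ~ w → w ~ v → d u v ≡ 2
  d≡2 {u} {v} {w} u≢v u≁v e f = ≤-antisym (≤-trans (d-adjˡ v e) (s≤s (≤-reflexive (adj⇒1 f)))) (d≥2 u≢v u≁v)

  between-trans : ∀ {u v y x} → Between u v y → Between u y x → Between u v x × d x v ≡ d x y + d y v
  between-trans {u} {v} {y} {x} p q =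
      ≤-antisym (≤-trans (+-monoʳ-≤ (d u x) (d-tri x y v)) (≤-reflexive whole)) (d-tri u x v)
    , ≤-antisym (d-tri x y v) (+-cancelˡ-≤ (d u x) _ _ (≤-trans (≤-reflexive whole) (d-tri u x v)))
    where
    whole : d u x + (d x y + d y v) ≡ d u v
    whole = trans (sym (+-assoc (d u x) _ _)) (trans (cong (_+ d y v) q) p)

  between-flip : ∀ {u v y} → Between u v y → Between v u y
  between-flip {u} {v} {y} p = trans (+-comm (d v y) _) (trans (cong₂ _+_ (d-sym y u) (d-sym v y)) (trans p (d-sym u v)))

  between-trans′ : ∀ {u v y x} → Between u v y → Between y v x → Between u v x × d u x ≡ d u y + d y x
  between-trans′ {u} {v} {y} {x} p q with between-trans (between-flip p) (between-flip q)
  ... | r , eq = between-flip r , trans (d-sym u x) (trans eq (trans (+-comm (d x y) _) (cong₂ _+_ (d-sym y u) (d-sym x y))))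

  -- If `y` is between `u` and `v`, these are the vertices on shortest walks from `u` to `v` through
  -- the waypoint `y`.
  On : (u v y x : Fin n) → Set
  On u v y x = Between u y x ⊎ Between y v x

  On⇒Between : ∀ {u v y x} → Between u v y → On u v y x → Between u v x
  On⇒Between p (inj₁ q) = proj₁ (between-trans p q)
  On⇒Between p (inj₂ q) = proj₁ (between-trans′ p q)

  off-level : ∀ {u v y x} → Between u v y → d u x ≡ d u y → x ≢ y → ¬ On u v y x
  off-level {u} {y = y} {x} p eq x≢y (inj₁ q) = x≢y (d0⇒≡ (m+n≡m⇒n≡0 (trans q (sym eq))))
    where
    m+n≡m⇒n≡0 : ∀ {i j} → i + j ≡ i → j ≡ 0
    m+n≡m⇒n≡0 {i} {j} r = +-cancelˡ-≡ i j 0 (trans r (sym (+-identityʳ i)))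
  off-level {u} {y = y} {x} p eq x≢y (inj₂ q) =
    x≢y (sym (d0⇒≡ (+-cancelˡ-≡ (d u y) _ 0 (trans (sym (proj₂ (between-trans′ p q))) (trans eq (sym (+-identityʳ _)))))))

  OffEdge : (u v y : Fin n) → Edge → Set
  OffEdge u v y (p , q) = ¬ On u v y p ⊎ ¬ On u v y q

  -- The edges of a shortest walk from u to v through y are good for u and v, and the edges es come on top of them.

  detour : ∀ {u v y es} → Between u v y → Unique es → All (Good u v) es → All (OffEdge u v y) es →
           d u v + length es ≤ g u v
  detour {u} {v} {y} {es} bt un gd off = begin
    d u v + length es                            ≡⟨ cong (_+ length es) bt ⟨
    d u y + d y v + length es                    ≡⟨ cong₂ (λ i j → i + j + length es) (Geodesic.len γ) (Geodesic.len δ) ⟨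
    length γ.es + length δ.es + length es        ≡⟨ cong (_+ length es) (length-++ γ.es) ⟨
    length (γ.es ++ δ.es) + length es            ≡⟨ length-++ (γ.es ++ δ.es) ⟨
    length ((γ.es ++ δ.es) ++ es)                ≤⟨ edges≤g unique (All.++⁺ (All.++⁺ goodγ goodδ) gd) ⟩
    g u v                                        ∎
    where
    open ≤-Reasoning
    γ = geodesic u y refl
    δ = geodesic y v refl
    module γ = Geodesic γ
    module δ = Geodesic δ

    goodγ : All (Good u v) γ.es
    goodγ = All.zipWith (λ { {p , q} ((e , eq) , (bp , bq)) →
      let dp = proj₂ (between-trans bt bp)
          dq = proj₂ (between-trans bt bq)
      in e
       , ≤-reflexive (+-cancelʳ-≡ (d q y) _ _ (trans (sym (+-suc (d u p) (d q y))) (trans (cong (λ t → d u p + t) (sym eq)) (trans bp (sym bq)))))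
       , ≤-reflexive (trans (cong suc (trans (d-sym v q) dq)) (trans (cong (_+ d y v) (sym eq)) (trans (sym dp) (d-sym p v)))) }) (γ.down , γ.between)

    goodδ : All (Good u v) δ.es
    goodδ = All.zipWith (λ { {p , q} ((e , eq) , (bp , bq)) →
      let dp = proj₂ (between-trans′ bt bp)
          dq = proj₂ (between-trans′ bt bq)
      in e
       , ≤-reflexive (sym (trans dq (trans (cong (λ t → d u y + t)
           (+-cancelʳ-≡ (d q v) _ _ (trans bq (trans (sym bp) (trans (cong (λ t → d y p + t) eq) (+-suc _ _)))))) (trans (+-suc _ _) (cong suc (sym dp))))))
       , ≤-reflexive (trans (cong suc (d-sym v q)) (trans (sym eq) (d-sym p v))) }) (δ.down , δ.between)

    onγ : All (λ (p , q) → On u v y p × On u v y q) γ.es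
    onγ = All.map (λ (x , z) → inj₁ x , inj₁ z) γ.between

    onδ : All (λ (p , q) → On u v y p × On u v y q) δ.es
    onδ = All.map (λ (x , z) → inj₂ x , inj₂ z) δ.between

    apart : ∀ {e} → ¬ (e ∈ γ.es × e ∈ δ.es)
    apart {p , q} (i , j) = 1+n≰n (begin
      suc (d u p)            ≤⟨ m<m+n (d u p) (subst (0 <_) (sym (proj₂ (All.lookup γ.down i))) (s≤s z≤n)) ⟩
      d u p + d p y          ≡⟨ proj₁ (All.lookup γ.between i) ⟩
      d u y                  ≤⟨ m≤m+n _ _ ⟩
      d u y + d y p          ≡⟨ proj₂ (between-trans′ bt (proj₁ (All.lookup δ.between j))) ⟨
      d u p                  ∎)

    apart′ : ∀ {e} → ¬ (e ∈ (γ.es ++ δ.es) × e ∈ es)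
    apart′ (i , j) = case (All.lookup (All.++⁺ onγ onδ) i , All.lookup off j) of λ where
      ((op , _) , inj₁ ¬op) → ¬op op
      ((_ , oq) , inj₂ ¬oq) → ¬oq oq

    unique : Unique ((γ.es ++ δ.es) ++ es)
    unique = Unique.++⁺ (Unique.++⁺ γ.unique δ.unique apart) un apart′

  between-start : ∀ u v → Between u v u
  between-start u v = cong (_+ d u v) (d0 u)

  d≤g : ∀ u v → d u v ≤ g u v
  d≤g u v = ≤-trans (m≤m+n _ 0) (detour (between-start u v) [] [] [])

  excess : ∀ {u v j} → d u v + j ≤ g u v → j ≤ c u v
  excess {u} {v} {j} p = m+n≤o⇒m≤o∸n j (≤-trans (≤-reflexive (+-comm j _)) p)

  d+c≡g : ∀ u v → d u v + c u v ≡ g u v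
  d+c≡g u v = m+[n∸m]≡n (d≤g u v)

  good-flip : ∀ {u v p q} → Good u v (p , q) → Good v u (q , p)
  good-flip (e , x , y) = ~-sym e , y , x

  g-sym : ∀ u v → g u v ≡ g v u
  g-sym u v = trans (∑-comm (λ p q → ⟦ good? u v (p , q) ⟧))
    (∑-cong λ q → ∑-cong λ p → ⟦⟧-cong (good? u v (p , q)) (good? v u (q , p)) good-flip good-flip)

  c-sym : ∀ u v → c u v ≡ c v u
  c-sym u v = cong₂ _∸_ (g-sym u v) (d-sym u v)

  -- With `u` itself as the waypoint, `On` is the whole interval from `u` to `v`, and a good edge
  -- with an end outside it is not on the geodesic.
  extra : ∀ {u v p q} → Good u v (p , q) → ¬ Between u v p ⊎ ¬ Between u v q → 1 ≤ c u v
  extra {u} {v} {p} {q} gd off = excess (detour (between-start u v) ([] ∷ []) (gd ∷ []) (off′ off ∷ []))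
    where
    off′ : ¬ Between u v p ⊎ ¬ Between u v q → OffEdge u v u (p , q)
    off′ (inj₁ x) = inj₁ (x ∘ On⇒Between (between-start u v))
    off′ (inj₂ x) = inj₂ (x ∘ On⇒Between (between-start u v))

  level : ∀ {j} u v → j ≤ d u v → ∃ λ s → d u s ≡ j × Between u v s
  level {j} u v j≤ = go (d u v) v refl j≤
    where
    go : ∀ k v → d u v ≡ k → j ≤ k → ∃ λ s → d u s ≡ j × Between u v s
    go k v eq j≤k with j ℕ.≟ k
    ... | yes refl = v , eq , trans (cong (λ t → d u v + t) (d0 v)) (+-identityʳ _)
    go zero v eq j≤0 | no j≢0 = contradiction (n≤0⇒n≡0 j≤0) j≢0
    go (suc k) v eq j≤ | no j≢ with step (trans (d-sym v u) eq)
    ... | w , e , eq′ with go k w (trans (d-sym u w) eq′) (s≤s⁻¹ (≤∧≢⇒< j≤ j≢))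
    ... | s , ds , bs = s , ds , proj₁ (between-trans bw bs)
      where
      bw : Between u v w
      bw = trans (cong₂ _+_ (trans (d-sym u w) eq′) (adj⇒1 (~-sym e))) (trans (+-comm k 1) (sym eq))

  before : ∀ {u s k} → d u s ≡ suc k → ∃ λ p → p ~ s × d u p ≡ k
  before {u} {s} eq with step (trans (d-sym s u) eq)
  ... | p , e , eq′ = p , ~-sym e , trans (d-sym u p) eq′

  good-into : ∀ {u v s p k} → Between u v s → p ~ s → d u s ≡ suc k → d u p ≡ k → Good u v (p , s)
  good-into {u} {v} {s} {p} {k} bs e ds dp = e , ≤-reflexive (trans (cong suc dp) (sym ds))
    , +-cancelˡ-≤ k _ _ (begin
        k + suc (d v s)  ≡⟨ +-suc k _ ⟩
        suc k + d v s    ≡⟨ cong₂ _+_ (sym ds) (d-sym v s) ⟩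
        d u s + d s v    ≡⟨ bs ⟩
        d u v            ≤⟨ d-tri u p v ⟩
        d u p + d p v    ≡⟨ cong₂ _+_ dp (d-sym p v) ⟩
        k + d v p        ∎)
    where open ≤-Reasoning

  good-out : ∀ {u v s q k} → Between u v s → s ~ q → d s v ≡ suc k → d q v ≡ k → Good u v (s , q)
  good-out bs e ds dq = good-flip (good-into (between-flip bs) (~-sym e) (trans (d-sym _ _) ds) (trans (d-sym _ _) dq))

  -- A shortest walk through `s` enters and leaves `s` by two good edges. Neither is on a walk
  -- through `y`, because `s` is another vertex on the level of `y`.
  fork : ∀ {u v y s k} → d u y ≡ suc k → d u s ≡ suc k → y ≢ s → Between u v y → Between u v s → suc k < d u v → 2 ≤ c u v
  fork {u} {v} {y} {s} {k} dy ds y≢s by bs k< = go (d s v) refl (before ds)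
    where
    go : ∀ j → d s v ≡ j → (∃ λ p → p ~ s × d u p ≡ k) → 2 ≤ c u v
    go zero dsv _ = contradiction (subst (suc k <_) (trans (sym bs) (trans (cong₂ _+_ ds dsv) (+-identityʳ _))) k<) 1+n≰n
    go (suc j) dsv (p , e , dp) with step dsv
    ... | q , f , dq = excess (detour by ((distinct ∷ []) ∷ [] ∷ []) (gp ∷ gq ∷ []) (inj₂ off ∷ inj₁ off ∷ []))
      where
      gp = good-into bs e ds dp
      gq = good-out bs f dsv dq
      off = off-level by (trans ds (sym dy)) (y≢s ∘ sym)
      distinct : (p , s) ≢ (s , q)
      distinct refl = ~⇒≢ e refl

-- Edges that leave the vertices reached only through `y`

walk-crosses : {H : Graph n} {P : Fin n → Set} (P? : Decidable P) → ∀ {s t} → Walk H k s t → P s → ¬ P t →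
               ∃₂ λ v v′ → Adj H v v′ × P v × ¬ P v′
walk-crosses P? [] ps ¬pt = contradiction ps ¬pt
walk-crosses P? (_∷_ {v = v} e w) ps ¬pt with P? v
... | yes pv = walk-crosses P? w pv ¬pt
... | no ¬pv = _ , v , e , ps , ¬pv

-- A walk in `G ∖ y` joins `s` to `t` and has to leave `P` somewhere. This turns the absence of a
-- cut vertex into a concrete edge.
exit : {G : Graph n} → TwoConnected G → ∀ y {P : Fin n → Set} (P? : Decidable P) {s t} → s ≢ y → t ≢ y → P s → ¬ P t →
       ∃₂ λ v v′ → Adj G v v′ × P v × ¬ P v′ × v ≢ y × v′ ≢ y
exit {suc n} {G} tc y {P} P? {s} {t} s≢y t≢y ps ¬pt
  with walk-crosses (P? ∘ punchIn y) (proj₂ (TwoConnected.noCutVertex tc y (punchOut (s≢y ∘ sym)) (punchOut (t≢y ∘ sym))))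
         (subst P (sym (punchIn-punchOut (s≢y ∘ sym))) ps) (¬pt ∘ subst P (punchIn-punchOut (t≢y ∘ sym)))
... | v , v′ , e , pv , ¬pv′ = punchIn y v , punchIn y v′ , e , pv , ¬pv′ , punchInᵢ≢i y v , punchInᵢ≢i y v′

exceeds : ∀ {i j k} → i ≢ k → k ≤ i → i ≤ j → j ≤ suc k → i ≡ suc k
exceeds i≢k k≤i i≤j j≤ = ≤-antisym (≤-trans i≤j j≤) (≤∧≢⇒< k≤i (i≢k ∘ sym))

module Exits {n : ℕ} {G : Graph n} (D : Distances G) (tc : TwoConnected G) where
  open Metric D
  open Detours D

  -- Every shortest walk from u to v passes through y.

  Dom : (u y v : Fin n) → Set
  Dom u y v = d u y < d u v × (∀ s → d u s ≡ d u y → Between u v s → s ≡ y)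

  dom? : ∀ u y → Decidable (Dom u y)
  dom? u y v = d u y <? d u v ×-dec all? λ s → d u s ℕ.≟ d u y →-dec between? u v s →-dec s ≟ y

  dom⇒between : ∀ {u y v} → Dom u y v → Between u v y
  dom⇒between {u} {y} {v} (lt , uniq) with level u v (<⇒≤ lt)
  ... | s , ds , bs = subst (Between u v) (uniq s ds bs) bs

  ¬dom : ∀ {u y v} → d u y < d u v → ¬ Dom u y v → ∃ λ s → d u s ≡ d u y × Between u v s × s ≢ y
  ¬dom {u} {y} {v} lt ¬D with ¬∀⟶∃¬ n _ (λ s → d u s ℕ.≟ d u y →-dec between? u v s →-dec s ≟ y) (λ f → ¬D (lt , f))
  ... | s , ¬imp = s
    , decidable-stable (d u s ℕ.≟ d u y) (λ x → ¬imp λ y → contradiction y x)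
    , decidable-stable (between? u v s) (λ x → ¬imp λ _ y → contradiction y x)
    , λ eq → ¬imp λ _ _ → eq

  -- Across a horizontal edge v v′, the shortest walk from s to v′ consists of edges good for u and v.

  slide : ∀ {u v v′ s} → v ~ v′ → d u v ≡ d u v′ → Between u v′ s → ¬ Between u v s → d s v′ ≤ c u v
  slide {u} {v} {v′} {s} e eq bs ¬bs = subst (_≤ c u v) len (excess (detour (between-start u v) unique good off))
    where
    open Geodesic (geodesic s v′ refl)
    open ≤-Reasoning
    -- If `x` were as near to `v` as to `v′`, then a shortest walk from `u` over `s` and `x` would
    -- end at `v`, and `s` would be between `u` and `v`.
    farther : ∀ {x} → Between s v′ x → Between u v′ x × d u x ≡ d u s + d s x × d x v ≡ suc (d x v′)
    farther {x} bx = bux , dux , exceeds (λ dxv → ¬bs (≤-antisym (begin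
        d u s + d s v            ≤⟨ +-monoʳ-≤ (d u s) (d-tri s x v) ⟩
        d u s + (d s x + d x v)  ≡⟨ cong (λ t → d u s + (d s x + t)) dxv ⟩
        d u s + (d s x + d x v′) ≡⟨ cong (λ t → d u s + t) bx ⟩
        d u s + d s v′           ≡⟨ bs ⟩
        d u v′                   ≡⟨ eq ⟨
        d u v                    ∎) (d-tri u s v)))
      (+-cancelˡ-≤ (d u x) _ _ (begin
        d u x + d x v′   ≡⟨ bux ⟩
        d u v′           ≡⟨ eq ⟨
        d u v            ≤⟨ d-tri u x v ⟩
        d u x + d x v    ∎))
      ≤-refl (d-adjʳ x e)
      where
      bux = proj₁ (between-trans′ bs bx)
      dux = proj₂ (between-trans′ bs bx)
    good : All (Good u v) es
    good = All.zipWith (λ { {p , q} ((e′ , dn) , (bp , bq)) →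
      let (bup , dup , fp) = farther bp
          (buq , duq , fq) = farther bq
      in e′
       , ≤-reflexive (+-cancelʳ-≡ (d q v′) _ _ (trans (sym (+-suc (d u p) (d q v′))) (trans (cong (λ t → d u p + t) (sym dn)) (trans bup (sym buq)))))
       , ≤-reflexive (trans (cong suc (trans (d-sym v q) fq)) (trans (cong suc (sym dn)) (trans (sym fp) (d-sym p v)))) }) (down , between)
    off : All (OffEdge u v u) es
    off = All.map (λ { {p , q} (bp , _) →
      let (bup , dup , fp) = farther bp
      in inj₁ (λ on → 1+n≰n (begin
        suc (d u v)             ≡⟨ cong suc eq ⟩
        suc (d u v′)            ≡⟨ cong suc bup ⟨
        suc (d u p + d p v′)    ≡⟨ +-suc _ _ ⟨
        d u p + suc (d p v′)    ≡⟨ cong (λ t → d u p + t) fp ⟨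
        d u p + d p v           ≡⟨ On⇒Between (between-start u v) on ⟩
        d u v                   ∎)) }) between

  -- The two ways in which vertices behind `y` are charged. A horizontal exit charges both its ends,
  -- each with two once `d s v′` reaches two; a descending one charges `v` and, one level further,
  -- `b`.
  data Exit (u y : Fin n) : Set where
    horizontal : ∀ v v′ s → v ~ v′ → d u v ≡ d u v′ → Dom u y v → v′ ≢ y → d u s ≡ d u y → Between u v′ s → s ≢ y →
                 d s v′ ≤ c u v → 1 ≤ c u v′ → (2 ≤ d s v′ → 2 ≤ c u v′) → Exit u y
    descending : ∀ v b → d u b ≡ suc (d u v) → d u y < d u v → 1 ≤ c u v → 3 ≤ c u b → Exit u y

  private
    module Leaving {u y v v′ s k} (uy : d u y ≡ suc k) (e : v ~ v′) (Dv : Dom u y v) (v′≢y : v′ ≢ y)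
                   (ds : d u s ≡ d u y) (bs : Between u v′ s) (s≢y : s ≢ y) (lt′ : d u y < d u v′) where
      open ≤-Reasoning

      lt : d u y < d u v
      lt = proj₁ Dv

      v≢y : v ≢ y
      v≢y eq = <-irrefl (cong (d u) (sym eq)) lt

      ¬bsv : ¬ Between u v s
      ¬bsv = s≢y ∘ proj₂ Dv s ds

      -- Otherwise the shortest walk through `s` to `v′` could be prolonged to `v`, although all
      -- shortest walks to `v` pass through `y`.
      not-up : d u v ≢ suc (d u v′)
      not-up eq = ¬bsv (≤-antisym (begin
        d u s + d s v         ≤⟨ +-monoʳ-≤ (d u s) (d-adjʳ s e) ⟩
        d u s + suc (d s v′)  ≡⟨ +-suc _ _ ⟩
        suc (d u s + d s v′)  ≡⟨ cong suc bs ⟩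
        suc (d u v′)          ≡⟨ eq ⟨
        d u v                 ∎) (d-tri u s v))

      flat : d u v ≡ d u v′ → Exit u y
      flat eq = horizontal v v′ s e eq Dv v′≢y ds bs s≢y (slide e eq bs ¬bsv) (proj₁ both) (proj₂ both)
        where
        dsv′ : d s v′ ≡ d y v
        dsv′ = +-cancelˡ-≡ (d u y) _ _ (trans (cong (_+ d s v′) (sym ds)) (trans bs (trans (sym eq) (sym (dom⇒between Dv)))))
        -- Either `v′` is reached through `y` as well, and `y` and `s` form a fork, or the ends
        -- exchange roles and `slide` follows the walk from `y` to `v`.
        both : 1 ≤ c u v′ × (2 ≤ d s v′ → 2 ≤ c u v′)
        both with between? u v′ y
        ... | yes by′ = ≤-trans (s≤s z≤n) two , λ _ → two
          where
          two : 2 ≤ c u v′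
          two = fork uy (trans ds uy) (s≢y ∘ sym) by′ bs (subst (_< d u v′) uy lt′)
        ... | no ¬by′ = ≤-trans (d-pos (v≢y ∘ sym)) all , λ p → ≤-trans p (≤-trans (≤-reflexive dsv′) all)
          where
          all : d y v ≤ c u v′
          all = slide (~-sym e) (sym eq) (dom⇒between Dv) ¬by′

      module Down {r b₂ b₃ p} (eq : d u v′ ≡ suc (d u v)) (dsv′ : d s v′ ≡ suc (suc r)) (b₂~ : b₂ ~ v′) (ds₂ : d s b₂ ≡ suc r)
                  (b₃~ : b₃ ~ b₂) (ds₃ : d s b₃ ≡ r) (p~ : p ~ s) (dp : d u p ≡ k) where
        bw₂ : Between s v′ b₂
        bw₂ = trans (cong₂ _+_ ds₂ (adj⇒1 b₂~)) (trans (+-comm _ 1) (sym dsv′))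
        bw₃ : Between s b₂ b₃
        bw₃ = trans (cong₂ _+_ ds₃ (adj⇒1 b₃~)) (trans (+-comm _ 1) (sym ds₂))
        du₂ : d u b₂ ≡ d u v
        du₂ = suc-injective (trans (+-comm 1 _) (trans (cong (λ t → d u b₂ + t) (sym (adj⇒1 b₂~))) (trans (proj₁ (between-trans′ bs bw₂)) eq)))
        du₂′ : d u b₂ ≡ suc (d u y + r)
        du₂′ = trans (proj₂ (between-trans′ bs bw₂)) (trans (cong₂ _+_ ds ds₂) (+-suc _ _))
        bsb₂ : Between u b₂ s
        bsb₂ = trans (cong₂ _+_ ds ds₂) (trans (+-suc _ _) (sym du₂′))
        du₃ : d u b₃ ≡ d u y + r
        du₃ = trans (proj₂ (between-trans′ bsb₂ bw₃)) (cong₂ _+_ ds ds₃)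
        dsv≢ : d s v ≢ suc r
        dsv≢ x = ¬bsv (trans (cong₂ _+_ ds x) (trans (+-suc _ _) (trans (sym du₂′) du₂)))
        b₂≢v : b₂ ≢ v
        b₂≢v x = dsv≢ (trans (cong (d s) (sym x)) ds₂)
        bv : Between u v′ v
        bv = trans (cong (λ t → d u v + t) (adj⇒1 e)) (trans (+-comm _ 1) (sym eq))
        -- The edge entering `s` and the last two edges before `v′`, on one shortest walk through
        -- `s`. They stay distinct for `r` = 0, when `b₃` is `s`, and each has an end `s` or `b₂`
        -- off the walks through `v`.
        es : List Edge
        es = (p , s) ∷ (b₃ , b₂) ∷ (b₂ , v′) ∷ []
        es-good : All (Good u v′) es
        es-good = good-into bs p~ (trans ds uy) dp
                ∷ good-into (proj₁ (between-trans′ bs bw₂)) b₃~ du₂′ du₃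
                ∷ good-into (trans (cong (λ t → d u v′ + t) (d0 v′)) (+-identityʳ _)) b₂~ eq du₂
                ∷ []
        ltv : d u s < d u b₂
        ltv = subst₂ _<_ (sym ds) (sym du₂) lt
        es-unique : Unique es
        es-unique = ((λ x → <-irrefl (cong (d u ∘ proj₂) x) ltv)
                    ∷ (λ x → <-irrefl (cong (d u ∘ proj₂) x) (≤-trans ltv (≤-trans (≤-reflexive du₂) (≤-trans (n≤1+n _) (≤-reflexive (sym eq)))))) ∷ [])
                  ∷ ((λ x → ~⇒≢ b₂~ (cong proj₂ x)) ∷ [])
                  ∷ [] ∷ []
        off₂ : ¬ On u v′ v b₂
        off₂ = off-level bv du₂ b₂≢v
        offₛ : ¬ On u v′ v s
        offₛ (inj₁ x) = ¬bsv x
        offₛ (inj₂ x) = 1+n≰n (begin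
          2               ≤⟨ s≤s (s≤s z≤n) ⟩
          suc (suc r)     ≡⟨ dsv′ ⟨
          d s v′          ≤⟨ m≤n+m _ (d v s) ⟩
          d v s + d s v′  ≡⟨ x ⟩
          d v v′          ≡⟨ adj⇒1 e ⟩
          1               ∎)
        -- If `v` and `b₂` are adjacent, their edge is horizontal and `slide` applies; if not, `v`
        -- is nearer to `v′` than to `b₂`, and the edge from `b₂` to `v′` is good.
        one : 1 ≤ c u v
        one with adj? G v b₂
        ... | yes e₂ = ≤-trans (s≤s z≤n) (≤-trans (≤-reflexive (sym ds₂)) (slide e₂ (sym du₂) bsb₂ ¬bsv))
        ... | no ¬e₂ = extra {p = b₂} {q = v′} (b₂~ , ≤-reflexive (trans (cong suc du₂) (sym eq))
                      , subst (_< d v b₂) (sym (adj⇒1 e)) (d≥2 (b₂≢v ∘ sym) ¬e₂))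
                    (inj₂ λ x → 1+n≰n (≤-trans (≤-reflexive (sym eq)) (≤-trans (m≤m+n _ (d v′ v)) (≤-reflexive x))))
        found : Exit u y
        found = descending v v′ eq lt one (excess (detour bv es-unique es-good (inj₂ offₛ ∷ inj₂ off₂ ∷ inj₁ off₂ ∷ [])))

      descend : d u v′ ≡ suc (d u v) → Exit u y
      descend eq = go (d s v′) refl (+-cancelˡ-≤ (d u y) 2 _ (begin
          d u y + 2         ≡⟨ +-comm _ 2 ⟩
          suc (suc (d u y)) ≤⟨ s≤s lt ⟩
          suc (d u v)       ≡⟨ eq ⟨
          d u v′            ≡⟨ bs ⟨
          d u s + d s v′    ≡⟨ cong (_+ d s v′) ds ⟩
          d u y + d s v′    ∎))
        where
        go : ∀ r → d s v′ ≡ r → 2 ≤ r → Exit u y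
        go (suc zero) _ (s≤s ())
        go (suc (suc r)) dsv′ _ with before dsv′
        ... | b₂ , b₂~ , ds₂ with before ds₂ | before (trans ds uy)
        ... | b₃ , b₃~ , ds₃ | p , p~ , dp = Down.found eq dsv′ b₂~ ds₂ b₃~ ds₃ p~ dp

      found : Exit u y
      found with <-cmp (d u v) (d u v′)
      ... | tri< x _ _ = descend (≤-antisym (d-adjʳ u (~-sym e)) x)
      ... | tri≈ _ x _ = flat x
      ... | tri> _ _ x = contradiction (≤-antisym (d-adjʳ u e) x) not-up

  leave : ∀ {u y w} → u ≢ y → Dom u y w → Exit u y
  leave {u} {y} {w} u≢y Dw with exit tc y (dom? u y) (λ { refl → <-irrefl refl (proj₁ Dw) }) u≢y Dw
                          (λ { (lt , _) → contradiction (subst (d u y <_) (d0 u) lt) λ () })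
  ... | v , v′ , e , Dv , ¬Dv′ , v≢y , v′≢y = outward lt′
    where
    lt = proj₁ Dv
    -- Otherwise `v′` would be on the level of `y` and between `u` and `v`, hence equal to `y`.
    lt′ : d u y < d u v′
    lt′ with d u y <? d u v′
    ... | yes p = p
    ... | no ¬p = contradiction (proj₂ Dv v′ deq (trans (cong₂ _+_ deq (adj⇒1 (~-sym e))) (trans (+-comm _ 1) (sym dv)))) v′≢y
      where
      le : d u v′ ≤ d u y
      le = ≮⇒≥ ¬p
      dv : d u v ≡ suc (d u y)
      dv = ≤-antisym (≤-trans (d-adjʳ u e) (s≤s le)) lt
      deq : d u v′ ≡ d u y
      deq = ≤-antisym le (s≤s⁻¹ (≤-trans lt (d-adjʳ u e)))
    pos : ∀ j → d u y ≡ j → ∃ λ k → d u y ≡ suc k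
    pos zero eq = contradiction (d0⇒≡ eq) u≢y
    pos (suc k) eq = k , eq
    outward : d u y < d u v′ → Exit u y
    outward lt″ with ¬dom lt″ ¬Dv′
    ... | s , ds , bs , s≢y = Leaving.found (proj₂ (pos (d u y) refl)) e Dv v′≢y ds bs s≢y lt″

-- Lower bounds for the cost of a vertex

module Costs {n : ℕ} {G : Graph n} (D : Distances G) (tc : TwoConnected G) where
  open Metric D
  open Detours D
  open Exits D tc

  cost-two : ∀ {u v v′ i j} → v ≢ v′ → i ≤ c u v → j ≤ c u v′ → i + j ≤ cost u
  cost-two {u} {v} {v′} {i} {j} v≢v′ p q = begin
    i + j                  ≤⟨ +-mono-≤ p (≤-trans q (m≤m+n _ 0)) ⟩
    c u v + (c u v′ + 0)   ≤⟨ vertices≤cost u ((v≢v′ ∷ []) ∷ [] ∷ []) ⟩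
    cost u                 ∎
    where open ≤-Reasoning

  cost-one : ∀ {u v i} → i ≤ c u v → i ≤ cost u
  cost-one {u} {v} p = ≤-trans p (≤-trans (m≤m+n _ 0) (vertices≤cost u {v ∷ []} ([] ∷ [])))

  dom-or-fork : ∀ {u y w k} → d u y ≡ suc k → Between u w y → suc k < d u w → Dom u y w ⊎ 2 ≤ c u w
  dom-or-fork {u} {y} {w} dy by lt with dom? u y w
  ... | yes dom = inj₁ dom
  ... | no ¬dm with ¬dom (subst (_< d u w) (sym dy) lt) ¬dm
  ... | s , ds , bs , s≢y = inj₂ (fork dy (trans ds dy) (s≢y ∘ sym) by bs lt)

  positive≢ : ∀ {u y k} → d u y ≡ suc k → u ≢ y
  positive≢ {u} eq refl = contradiction (trans (sym (d0 u)) eq) λ ()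

  -- The charged vertices are returned with their levels, so that charges on different levels can be
  -- added without overlap.
  two-beyond : ∀ {u y w k} → d u y ≡ suc k → Between u w y → suc k < d u w →
               ∃ λ vs → Unique vs × All (λ v → suc k < d u v) vs × 2 ≤ sumᴸ (List.map (c u) vs)
  two-beyond {u} {y} {w} {k} dy by lt with dom-or-fork dy by lt
  ... | inj₂ two = w ∷ [] , [] ∷ [] , lt ∷ [] , ≤-trans two (m≤m+n _ 0)
  ... | inj₁ dom with leave (positive≢ dy) dom
  ...   | horizontal v v′ s e eq Dv _ ds bs _ p q _ = v ∷ v′ ∷ [] , (~⇒≢ e ∷ []) ∷ [] ∷ [] , lv ∷ subst (suc k <_) eq lv ∷ []
          , +-mono-≤ (≤-trans (d-pos s≢v′) p) (≤-trans q (m≤m+n _ 0))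
    where
    lv : suc k < d u v
    lv = subst (_< d u v) dy (proj₁ Dv)
    s≢v′ : s ≢ v′
    s≢v′ refl = <-irrefl (trans (sym dy) (trans (sym ds) (sym eq))) lv
  ...   | descending v b eq lt′ p q = v ∷ b ∷ [] , ((λ x → 1+n≰n (≤-reflexive (trans (sym eq) (cong (d u) (sym x))))) ∷ []) ∷ [] ∷ []
          , lv ∷ subst (suc k <_) (sym eq) (m<n⇒m<1+n lv) ∷ []
          , ≤-trans (m≤m+n 2 2) (+-mono-≤ p (≤-trans q (m≤m+n _ 0)))
    where
    lv : suc k < d u v
    lv = subst (_< d u v) dy lt′

  2≤cost : ∀ {u w} → 2 ≤ d u w → 2 ≤ cost u
  2≤cost {u} {w} p with level u w (≤-trans (s≤s z≤n) p)
  ... | y , dy , by with two-beyond dy by p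
  ... | vs , un , _ , two = ≤-trans two (vertices≤cost u un)

  -- Two units lie beyond level two, behind `y`. Two more come from `a` on level one: a fork charges
  -- `y`, and a horizontal exit on level two charges both its ends. Any other exit yields four units
  -- by itself.
  4≤cost : ∀ {u z} → 3 ≤ d u z → 4 ≤ cost u
  4≤cost {u} {z} p with level u z (≤-trans (n≤1+n 2) p)
  ... | y , dy , by with level u y (subst (1 ≤_) (sym dy) (s≤s z≤n))
  ... | a , da , ba with two-beyond dy by p | dom-or-fork da ba (subst (1 <_) (sym dy) ≤-refl)
  ... | vs , un , deep , two | inj₂ two′ =
    ≤-trans (+-mono-≤ two′ two) (vertices≤cost u (All.map (λ { lt refl → <-irrefl (sym dy) lt }) deep ∷ un))
  ... | vs , un , deep , two | inj₁ dom with leave (positive≢ da) dom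
  ...   | descending v b eq _ one three = cost-two (λ x → 1+n≰n (≤-reflexive (trans (sym eq) (cong (d u) (sym x))))) one three
  ...   | horizontal v v′ s e eq Dv _ ds bs _ p₁ p₂ p₃ with 3 ≤? d u v
  ...     | yes far = cost-two (~⇒≢ e) (≤-trans long p₁) (p₃ long)
    where
    long : 2 ≤ d s v′
    long = s≤s⁻¹ (subst (3 ≤_) (trans eq (trans (sym bs) (cong (_+ d s v′) (trans ds da)))) far)
  ...     | no ¬far = ≤-trans (+-mono-≤ (≤-trans (d-pos s≢v′) p₁) (+-mono-≤ p₂ two))
      (vertices≤cost u ((~⇒≢ e ∷ All.map (λ { lt refl → ¬far lt }) deep) ∷ All.map (λ { lt refl → ¬far (subst (3 ≤_) (sym eq) lt) }) deep ∷ un))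
    where
    s≢v′ : s ≢ v′
    s≢v′ refl = <-irrefl (trans (sym da) (trans (sym (trans ds refl)) (trans (sym eq) refl))) (subst (_< d u v) da (proj₁ Dv))

∑∑-+ : (f h : Fin n × Fin n → ℕ) → ∑∑ (λ e → f e + h e) ≡ ∑∑ f + ∑∑ h
∑∑-+ f h = trans (∑-cong λ i → ∑-+ _ _) (∑-+ _ _)

∑∑-punch : (x : Fin (suc n)) (f : Fin (suc n) × Fin (suc n) → ℕ) →
           ∑∑ f ≡ ∑ (λ j → f (x , j)) + (∑ (λ i → f (punchIn x i , x)) + ∑∑ (λ (i , j) → f (punchIn x i , punchIn x j)))
∑∑-punch x f = trans (∑-punch x _) (cong (λ t → ∑ (λ j → f (x , j)) + t)
  (trans (∑-cong λ i → ∑-punch x (λ j → f (punchIn x i , j))) (∑-+ (λ i → f (punchIn x i , x)) _)))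

term≤∑ : (f : Fin n → ℕ) (x : Fin n) → f x ≤ ∑ f
term≤∑ f x = ≤-trans (m≤m+n _ 0) (sumᴸ≤∑ f {x ∷ []} ([] ∷ []))

punch-onto : {x y : Fin (suc n)} → x ≢ y → ∃ λ i → punchIn x i ≡ y
punch-onto x≢y = punchOut x≢y , punchIn-punchOut x≢y

-- Removing a dominated vertex

Dominates : Graph n → (a x : Fin n) → Set
Dominates G a x = Adj G x a × (∀ {y} → y ≢ a → Adj G x y → Adj G a y)

-- A vertex farthest from a root r of G ∖ a is not a cut vertex of G ∖ a.

Farthest : {G : Graph (suc n)} (tc : TwoConnected G) (a x : Fin (suc n)) → Set
Farthest {n} {G} tc a x = ∃₂ λ (r x′ : Fin n) → punchIn a x′ ≡ x × r ≢ x′ × (∀ v → d r v ≤ d r x′)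
  where open Distances (FromWalks.distances (G ∖ a) (TwoConnected.noCutVertex tc a))

module Totals {n : ℕ} {G : Graph (suc n)} (D : Distances G) where
  open Metric D
  open Detours D

  c-self : ∀ u → c u u ≡ 0
  c-self u = cong₂ _∸_ (trans (∑-cong λ s → trans (∑-cong λ t →
      ⟦⟧-no (good? u u (s , t)) (λ (_ , y , z) → <-asym y z)) (zeros (suc n))) (zeros (suc n))) (d0 u)
    where
    zeros : ∀ n → ∑ {n} (λ _ → 0) ≡ 0
    zeros n = trans (∑-const n 0) (*-zeroʳ n)

  total-split : ∀ x → total ≡ cost x + (cost x + ∑∑ (λ (i , j) → c (punchIn x i) (punchIn x j)))
  total-split x = trans (∑∑-punch x (λ (u , v) → c u v)) (cong (λ t → cost x + (t + ∑∑ (λ (i , j) → c (punchIn x i) (punchIn x j))))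
    (trans (∑-cong λ i → c-sym (punchIn x i) x) (trans (sym (cong (_+ ∑ (c x ∘ punchIn x)) (c-self x))) (sym (∑-punch x (c x))))))

  2cost≤total : ∀ x → cost x + cost x ≤ total
  2cost≤total x = ≤-trans (+-monoʳ-≤ (cost x) (m≤m+n (cost x) _)) (≤-reflexive (sym (total-split x)))

module Removal {m : ℕ} {G : Graph (2+ m)} (D : Distances G) (tc : TwoConnected G) (m≥2 : 2 ≤ m)
               {a x : Fin (2+ m)} (dominates : Dominates G a x) where
  open Metric D
  open Detours D
  open Totals D

  private
    x~a : x ~ a
    x~a = proj₁ dominates

    dominated : ∀ {y} → y ≢ a → x ~ y → a ~ y
    dominated = proj₂ dominates

    p : Fin (suc m) → Fin (2+ m)
    p = punchIn x

  -- Only `step` needs an argument: a shortest walk through `x` is rerouted through `a`, since the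
  -- vertex after `x` is `a` or a neighbour of `a`, and so is the vertex before it.
  distances : Distances (G ∖ x)
  distances = record
    { d = λ i j → d (p i) (p j)
    ; d0 = λ i → d0 (p i)
    ; d0⇒≡ = λ eq → punchIn-injective x _ _ (d0⇒≡ eq)
    ; d-sym = λ i j → d-sym (p i) (p j)
    ; d-tri = λ i j k → d-tri (p i) (p j) (p k)
    ; adj⇒1 = adj⇒1
    ; 1⇒adj = 1⇒adj
    ; step = step′
    }
    where
    bypass : ∀ {u v k} → d u v ≡ suc k → v ≢ x → ∃ λ w → u ~ w × d w v ≡ k × w ≢ x
    bypass {u} {v} {k} eq v≢x with step eq
    ... | w , e , eq′ with w ≟ x
    ...   | no w≢x = w , e , eq′ , w≢x
    bypass {u} {v} {zero} eq v≢x | w , e , eq′ | yes refl = contradiction (sym (d0⇒≡ eq′)) v≢x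
    bypass {u} {v} {suc k} eq v≢x | w , e , eq′ | yes refl with step eq′
    ... | t , f , eq″ = a , u~a , ≤-antisym dav (s≤s⁻¹ (subst (_≤ suc (d a v)) eq (d-adjˡ v u~a))) , ~⇒≢ (~-sym x~a)
      where
      dav : d a v ≤ suc k
      dav with t ≟ a
      ... | yes refl = ≤-trans (≤-reflexive eq″) (n≤1+n k)
      ... | no t≢a = subst (λ j → d a v ≤ suc j) eq″ (d-adjˡ v (dominated t≢a f))
      u≢a : u ≢ a
      u≢a refl = 1+n≰n (subst (_≤ suc k) eq dav)
      u~a : u ~ a
      u~a = ~-sym (dominated u≢a (~-sym e))
    step′ : ∀ {i j k} → d (p i) (p j) ≡ suc k → ∃ λ w → Adj (G ∖ x) i w × d (p w) (p j) ≡ k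
    step′ {i} {j} eq with bypass eq (punchInᵢ≢i x j)
    ... | w , e , eq′ , w≢x with punch-onto (w≢x ∘ sym)
    ... | w′ , refl = w′ , e , eq′

  private
    module D′ = Metric distances

    -- The retraction of `G` onto `G ∖ x`. It carries every edge to an edge or to a single vertex,
    -- and so walks that avoid `w` to walks that avoid `w`, provided `w` is not `a`.
    ρ : Fin (2+ m) → Fin (2+ m)
    ρ v with v ≟ x
    ... | yes _ = a
    ... | no _  = v

    ρ≢x : ∀ v → ρ v ≢ x
    ρ≢x v with v ≟ x
    ... | yes _ = ~⇒≢ (~-sym x~a)
    ... | no v≢x = v≢x

    ρ-fix : ∀ {v} → v ≢ x → ρ v ≡ v
    ρ-fix {v} v≢x with v ≟ x
    ... | yes v≡x = contradiction v≡x v≢x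
    ... | no _ = refl

    ρ≢ : ∀ {v w} → a ≢ w → v ≢ w → ρ v ≢ w
    ρ≢ {v} a≢w v≢w with v ≟ x
    ... | yes _ = a≢w
    ... | no _ = v≢w

    ρ-adj : ∀ {u v} → u ~ v → ρ u ≡ ρ v ⊎ ρ u ~ ρ v
    ρ-adj {u} {v} e with u ≟ x | v ≟ x
    ... | yes refl | yes refl = inj₁ refl
    ... | no _ | no _ = inj₂ e
    ... | yes refl | no _ with v ≟ a
    ...   | yes v≡a = inj₁ (sym v≡a)
    ...   | no v≢a = inj₂ (dominated v≢a e)
    ρ-adj {u} {v} e | no _ | yes refl with u ≟ a
    ...   | yes u≡a = inj₁ u≡a
    ...   | no u≢a = inj₂ (~-sym (dominated u≢a (~-sym e)))

    module _ (w : Fin (suc m)) where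
      q : Fin m → Fin (2+ m)
      q = p ∘ punchIn w

      q-injective : ∀ {i j} → q i ≡ q j → i ≡ j
      q-injective eq = punchIn-injective w _ _ (punchIn-injective x _ _ eq)

      q-onto : ∀ {v} → v ≢ x → v ≢ p w → ∃ λ i → q i ≡ v
      q-onto v≢x v≢w with punch-onto (v≢x ∘ sym)
      ... | j , refl with punch-onto {x = w} {j} (λ { refl → v≢w refl })
      ... | i , refl = i , refl

      retract : a ≢ p w → ∀ {k i j i′ j′} → Walk (G ∖ p w) k i j → q i′ ≡ ρ (punchIn (p w) i) → q j′ ≡ ρ (punchIn (p w) j) →
                ∃ λ k → Walk ((G ∖ x) ∖ w) k i′ j′
      retract a≢w {i′ = i′} [] ei ej = 0 , subst (Walk _ 0 i′) (q-injective (trans ei (sym ej))) []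
      retract a≢w {i′ = i′} (_∷_ {v = v} e wk) ei ej with q-onto (ρ≢x (punchIn (p w) v)) (ρ≢ a≢w (punchInᵢ≢i (p w) v))
      ... | v′ , ev with retract a≢w wk ev ej | ρ-adj e
      ... | k , wk′ | inj₁ same = k , subst (λ t → Walk _ k t _) (q-injective (trans ev (trans (sym same) (sym ei)))) wk′
      ... | k , wk′ | inj₂ e′ = suc k , subst₂ (Adj G) (sym ei) (sym ev) e′ ∷ wk′

      away : a ≢ p w → Connected ((G ∖ x) ∖ w)
      away a≢w i j with punch-onto {x = p w} {q i} (λ eq → punchInᵢ≢i w i (punchIn-injective x _ _ (sym eq)))
                      | punch-onto {x = p w} {q j} (λ eq → punchInᵢ≢i w j (punchIn-injective x _ _ (sym eq)))
      ... | i₀ , ei | j₀ , ej = retract a≢w (proj₂ (TwoConnected.noCutVertex tc (p w) i₀ j₀))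
                                  (lift (sym ei)) (lift (sym ej))
        where
        lift : ∀ {i i₀} → q i ≡ punchIn (p w) i₀ → q i ≡ ρ (punchIn (p w) i₀)
        lift {i} eq = trans eq (sym (ρ-fix (λ x≡ → punchInᵢ≢i x _ (trans eq x≡))))

      at-a : a ≡ p w → Farthest tc a x → Connected ((G ∖ x) ∖ w)
      at-a refl (r , x′ , ex , r≢x′ , far) i j with q-onto r≢x (punchInᵢ≢i a r)
        where
        r≢x : punchIn a r ≢ x
        r≢x eq = r≢x′ (punchIn-injective a _ _ (trans eq (sym ex)))
      ... | r″ , er = _ , (proj₂ (home i) ++ʷ reverseʷ (proj₂ (home j)))
        where
        module A = Distances (FromWalks.distances (G ∖ a) (TwoConnected.noCutVertex tc a))
        toward : ∀ k {i i″} → A.d i r ≡ k → i ≢ x′ → q i″ ≡ punchIn a i → ∃ λ k → Walk ((G ∖ x) ∖ w) k i″ r″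
        toward zero {i} {i″} eq _ ei = 0 , subst (Walk _ 0 i″) (q-injective (trans ei (trans (cong (punchIn a) (A.d0⇒≡ eq)) (sym er)))) []
        toward (suc k) {i} {i″} eq i≢ ei with A.step eq
        ... | t , e , eq′ with q-onto {punchIn a t} (λ et → t≢x′ (punchIn-injective a _ _ (trans et (sym ex)))) (punchInᵢ≢i a t)
          where
          t≢x′ : t ≢ x′
          t≢x′ refl = 1+n≰n (≤-trans (≤-reflexive (trans (sym eq) (A.d-sym i r))) (≤-trans (far i) (≤-reflexive (trans (A.d-sym r t) eq′))))
        ... | t″ , et with toward k eq′ (λ { refl → 1+n≰n (≤-trans (≤-reflexive (trans (sym eq) (A.d-sym i r))) (≤-trans (far i) (≤-reflexive (trans (A.d-sym r t) eq′)))) }) et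
        ... | k′ , wk = suc k′ , subst₂ (Adj G) (sym ei) (sym et) e ∷ wk
        home : ∀ i → ∃ λ k → Walk ((G ∖ x) ∖ w) k i r″
        home i with punch-onto {x = a} {q i} (λ eq → punchInᵢ≢i w i (punchIn-injective x _ _ (sym eq)))
        ... | i₀ , ei = toward _ refl (λ { refl → punchInᵢ≢i x _ (trans (sym ei) ex) }) (sym ei)

  twoConnected : Farthest tc a x → TwoConnected (G ∖ x)
  twoConnected far = record
    { order≥3 = s≤s m≥2
    ; connected = λ u v → _ , walk-of-length-d distances _ refl
    ; noCutVertex = λ w → case a ≟ p w of λ where
        (yes eq) → at-a w eq far
        (no ¬eq) → away w ¬eq
    }

  g-split : ∀ i j → g (p i) (p j) ≡ ∑ (λ q → ⟦ good? (p i) (p j) (x , q) ⟧) + (∑ (λ q → ⟦ good? (p i) (p j) (p q , x) ⟧) + D′.g i j)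
  g-split i j = ∑∑-punch x (λ e → ⟦ good? (p i) (p j) e ⟧)

  c-mono : ∀ i j → D′.c i j ≤ c (p i) (p j)
  c-mono i j = ∸-monoˡ-≤ (d (p i) (p j)) (≤-trans (m≤n+m _ (∑ (λ q → ⟦ good? (p i) (p j) (p q , x) ⟧)))
      (≤-trans (m≤n+m _ (∑ (λ q → ⟦ good? (p i) (p j) (x , q) ⟧))) (≤-reflexive (sym (g-split i j)))))

  -- The two edges of the path over `x` are good for its ends, and `G ∖ x` lacks both, while the
  -- distance is the same.
  c-through : ∀ {i j} → x ~ p i → x ~ p j → i ≢ j → ¬ p i ~ p j → D′.c i j + 2 ≤ c (p i) (p j)
  c-through {i} {j} ei ej i≢j i≁j = m+n≤o⇒m≤o∸n (D′.c i j + 2) (begin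
    D′.c i j + 2 + D′.d i j      ≡⟨ shuffle (D′.c i j) (D′.d i j) ⟩
    1 + (1 + (D′.d i j + D′.c i j)) ≡⟨ cong (λ t → 1 + (1 + t)) (Detours.d+c≡g distances i j) ⟩
    1 + (1 + D′.g i j)           ≤⟨ +-mono-≤ row (+-monoˡ-≤ (D′.g i j) column) ⟩
    _                            ≡⟨ g-split i j ⟨
    g (p i) (p j)                ∎)
    where
    open ≤-Reasoning
    shuffle : ∀ s t → s + 2 + t ≡ 1 + (1 + (t + s))
    shuffle = solve-∀
    far : 2 ≤ d (p i) (p j)
    far = d≥2 (i≢j ∘ punchIn-injective x _ _) i≁j
    zero<one : ∀ {s t} → s ~ t → d s s < d s t
    zero<one {s} e = subst₂ _<_ (sym (d0 s)) (sym (adj⇒1 e)) (s≤s z≤n)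
    row : 1 ≤ ∑ (λ q → ⟦ good? (p i) (p j) (x , q) ⟧)
    row = ≤-trans (≤-reflexive (sym (⟦⟧-yes (good? (p i) (p j) (x , p j)) (ej , subst (_< d (p i) (p j)) (sym (adj⇒1 (~-sym ei))) far , zero<one (~-sym ej)))))
            (term≤∑ (λ q → ⟦ good? (p i) (p j) (x , q) ⟧) (p j))
    column : 1 ≤ ∑ (λ q → ⟦ good? (p i) (p j) (p q , x) ⟧)
    column = ≤-trans (≤-reflexive (sym (⟦⟧-yes (good? (p i) (p j) (p i , x)) (~-sym ei , zero<one (~-sym ei)
                 , subst₂ _<_ (sym (adj⇒1 (~-sym ej))) (d-sym (p i) (p j)) far))))
            (term≤∑ (λ q → ⟦ good? (p i) (p j) (p q , x) ⟧) i)

  -- `total` runs over ordered pairs, so the pairs that contain `x` contribute `cost x` twice.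
  gain : D′.total + (cost x + cost x) ≤ total
  gain = begin
    D′.total + (cost x + cost x)   ≤⟨ +-monoˡ-≤ (cost x + cost x) (∑∑-mono (uncurry c-mono)) ⟩
    ∑∑ (λ (i , j) → c (p i) (p j)) + (cost x + cost x) ≡⟨ shuffle _ (cost x) ⟩
    cost x + (cost x + ∑∑ (λ (i , j) → c (p i) (p j)))  ≡⟨ total-split x ⟨
    total                          ∎
    where
    open ≤-Reasoning
    shuffle : ∀ s t → s + (t + t) ≡ t + (t + s)
    shuffle = solve-∀

  gain-through : ∀ {y y′} → x ~ y → x ~ y′ → y ≢ y′ → ¬ y ~ y′ → D′.total + (cost x + cost x) + 4 ≤ total
  gain-through {y} {y′} e e′ y≢y′ y≁y′ with punch-onto (~⇒≢ e) | punch-onto (~⇒≢ e′)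
  ... | i , refl | j , refl = begin
    D′.total + (cost x + cost x) + 4    ≤⟨ +-monoʳ-≤ (D′.total + (cost x + cost x)) four ⟩
    D′.total + (cost x + cost x) + ∑∑ δ ≡⟨ shuffle D′.total (cost x) (∑∑ δ) ⟩
    cost x + (cost x + (D′.total + ∑∑ δ))  ≡⟨ cong (λ t → cost x + (cost x + t)) (trans (sym (∑∑-+ (uncurry D′.c) δ))
                                            (∑-cong λ k → ∑-cong λ l → m+[n∸m]≡n (c-mono k l))) ⟩
    cost x + (cost x + ∑∑ (λ (i , j) → c (p i) (p j)))  ≡⟨ total-split x ⟨
    total                          ∎
    where
    open ≤-Reasoning
    δ : Fin (suc m) × Fin (suc m) → ℕ
    δ (i , j) = c (p i) (p j) ∸ D′.c i j
    i≢j : i ≢ j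
    i≢j refl = y≢y′ refl
    two : ∀ {i j} → x ~ p i → x ~ p j → i ≢ j → ¬ p i ~ p j → 2 ≤ δ (i , j)
    two {i} {j} ei ej n≢ n≁ = m+n≤o⇒m≤o∸n 2 (≤-trans (≤-reflexive (+-comm 2 _)) (c-through ei ej n≢ n≁))
    -- Two new good edges for the pair in each of its two orders.
    four : 4 ≤ ∑∑ δ
    four = ≤-trans (+-mono-≤ (two e e′ i≢j y≁y′) (≤-trans (two e′ e (i≢j ∘ sym) (y≁y′ ∘ ~-sym)) (m≤m+n _ 0)))
             (sumᴸ≤∑∑ δ {(i , j) ∷ (j , i) ∷ []} (((λ eq → i≢j (cong proj₁ eq)) ∷ []) ∷ [] ∷ []))
    shuffle : ∀ s t r → s + (t + t) + r ≡ t + (t + (s + r))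
    shuffle = solve-∀

maximal : (f : Fin (suc n) → ℕ) → ∃ λ x → ∀ v → f v ≤ f x
maximal {zero} f = zero , λ { zero → ≤-refl }
maximal {suc n} f with maximal (f ∘ suc)
... | x , mx with f zero ≤? f (suc x)
...   | yes p = suc x , λ { zero → p ; (suc v) → mx v }
...   | no p  = zero , λ { zero → ≤-refl ; (suc v) → ≤-trans (mx v) (<⇒≤ (≰⇒> p)) }

fresh : (vs : List (Fin n)) → length vs < n → ∃ λ v → All (v ≢_) vs
fresh {n} vs lt with any? (λ v → ¬? (Any.any? (v ≟_) vs))
... | yes (v , v∉) = v , All.¬Any⇒All¬ vs v∉
... | no none with pigeonhole lt (λ v → Any.index (member v))
  where
  member : ∀ v → v ∈ vs
  member v = decidable-stable (Any.any? (v ≟_) vs) (λ v∉ → none (v , v∉))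
... | i , j , i<j , eq = contradiction (trans (Any.lookup-index (member i)) (trans (cong (List.lookup vs) eq) (sym (Any.lookup-index (member j))))) (Fin.<⇒≢ i<j)
  where
  member : ∀ v → v ∈ vs
  member v = decidable-stable (Any.any? (v ≟_) vs) (λ v∉ → none (v , v∉))

-- Vertices of small cost

record Removable {m : ℕ} {G : Graph (2+ m)} (tc : TwoConnected G) : Set where
  field
    a x       : Fin (2+ m)
    dominates : Dominates G a x
    farthest  : Farthest tc a x
    -- A vertex not adjacent to `x` ensures that `cost x` is at least two.
    w         : Fin (2+ m)
    x≢w       : x ≢ w
    x≁w       : ¬ Adj G x w

module Candidates {m : ℕ} {G : Graph (2+ m)} (D : Distances G) (tc : TwoConnected G) where
  open Metric D
  open Detours D
  open Exits D tc
  open Costs D tc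

  module Without (a : Fin (2+ m)) where
    open Metric (FromWalks.distances (G ∖ a) (TwoConnected.noCutVertex tc a)) public using () renaming (d to δ; adj⇒1 to δ-adj; d0 to δ0; step to δ-step; d-sym to δ-sym; d0⇒≡ to δ0⇒≡)
    open Detours (FromWalks.distances (G ∖ a) (TwoConnected.noCutVertex tc a)) public using () renaming (d≥2 to δ≥2; d-adjʳ to δ-adjʳ)

  -- Every other vertex is dominated by `h`, so the vertex farthest from `p` in `G ∖ h` will do. The
  -- presence of `q` puts it at distance at least two, and `p` is then its non-neighbour.
  universal : ∀ {h p q} → (∀ {v} → v ≢ h → h ~ v) → p ≢ q → ¬ p ~ q → Removable tc
  universal {h} {p} {q} univ p≢q p≁q with punch-onto {x = h} {p} (λ { refl → p≁q (univ (p≢q ∘ sym)) })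
                                     | punch-onto {x = h} {q} (λ { refl → p≁q (~-sym (univ p≢q)) })
  ... | p′ , refl | q′ , refl with maximal (Without.δ h p′)
  ... | x′ , mx = record
    { a = h ; x = punchIn h x′
    ; dominates = ~-sym (univ (punchInᵢ≢i h x′)) , λ y≢h _ → univ y≢h
    ; farthest = p′ , x′ , refl , p′≢x′ , mx
    ; w = p ; x≢w = p′≢x′ ∘ sym ∘ punchIn-injective h _ _
    ; x≁w = λ e → 1+n≰n (≤-trans far (≤-reflexive (δ-adj (~-sym e))))
    }
    where
    open Without h
    far : 2 ≤ δ p′ x′
    far = ≤-trans (δ≥2 (λ { refl → p≢q refl }) p≁q) (mx q′)
    p′≢x′ : p′ ≢ x′
    p′≢x′ refl = contradiction (≤-trans far (≤-reflexive (δ0 p′))) λ ()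

  module Poor {u : Fin (2+ m)} (poor : cost u ≤ 3) where

    cheap : ∀ {A : Set} → 4 ≤ cost u → A
    cheap four = contradiction four (<⇒≱ (s≤s poor))

    ecc : ∀ v → d u v ≤ 2
    ecc v with d u v ≤? 2
    ... | yes p = p
    ... | no p = cheap (4≤cost (≰⇒> p))

    C : Fin (2+ m) → Set
    C v = d u v ≡ 2

    C? : Decidable C
    C? v = d u v ℕ.≟ 2

    Parent : (x b : Fin (2+ m)) → Set
    Parent x b = u ~ b × b ~ x

    parent? : ∀ x b → Dec (Parent x b)
    parent? x b = adj? G u b ×-dec adj? G b x

    parent : ∀ {x} → C x → ∃ (Parent x)
    parent cx with step cx
    ... | b , e , eq = b , e , 1⇒adj eq

    inC : ∀ {x} → x ≢ u → ¬ u ~ x → C x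
    inC x≢u u≁x = ≤-antisym (ecc _) (d≥2 (x≢u ∘ sym) u≁x)

    C⇒≢ : ∀ {x} → C x → x ≢ u
    C⇒≢ cx refl = contradiction (trans (sym (d0 u)) cx) λ ()

    C⇒≁ : ∀ {x} → C x → ¬ u ~ x
    C⇒≁ cx e = contradiction (trans (sym (adj⇒1 e)) cx) λ ()

    parent≢ : ∀ {x y b} → C y → Parent x b → b ≢ y
    parent≢ cy (e , _) refl = C⇒≁ cy e

    two-parents : ∀ {x b b′} → C x → Parent x b → Parent x b′ → b ≢ b′ → 2 ≤ c u x
    two-parents cx (e , f) (e′ , f′) b≢b′ = fork (adj⇒1 e) (adj⇒1 e′) b≢b′
      (trans (cong₂ _+_ (adj⇒1 e) (adj⇒1 f)) (sym cx)) (trans (cong₂ _+_ (adj⇒1 e′) (adj⇒1 f′)) (sym cx))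
      (subst (1 <_) (sym cx) ≤-refl)

    -- Beside the walk through `b`, each of the two other parents brings one edge from `u` and one
    -- edge to `x`.
    three-parents : ∀ {x b b′ b″} → C x → Parent x b → Parent x b′ → Parent x b″ → b ≢ b′ → b ≢ b″ → b′ ≢ b″ → 4 ≤ c u x
    three-parents {x} {b} {b′} {b″} cx (e , f) (e′ , f′) (e″ , f″) n n′ n″ = excess (detour bt
        (((λ z → n″ (cong proj₂ z)) ∷ (λ z → ~⇒≢ e′ (cong proj₁ z)) ∷ (λ z → ~⇒≢ e″ (cong proj₁ z)) ∷ [])
         ∷ ((λ z → ~⇒≢ e′ (cong proj₁ z)) ∷ (λ z → ~⇒≢ e″ (cong proj₁ z)) ∷ []) ∷ ((λ z → n″ (cong proj₁ z)) ∷ []) ∷ [] ∷ [])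
        (top e′ f′ ∷ top e″ f″ ∷ bottom e′ f′ ∷ bottom e″ f″ ∷ [])
        (inj₂ (off e′ (n ∘ sym)) ∷ inj₂ (off e″ (n′ ∘ sym)) ∷ inj₁ (off e′ (n ∘ sym)) ∷ inj₁ (off e″ (n′ ∘ sym)) ∷ []))
      where
      bt : Between u x b
      bt = trans (cong₂ _+_ (adj⇒1 e) (adj⇒1 f)) (sym cx)
      top : ∀ {p} → u ~ p → p ~ x → Good u x (u , p)
      top e f = e , subst₂ _<_ (sym (d0 u)) (sym (adj⇒1 e)) ≤-refl , subst₂ _<_ (sym (adj⇒1 (~-sym f))) (sym (trans (d-sym x u) cx)) ≤-refl
      bottom : ∀ {p} → u ~ p → p ~ x → Good u x (p , x)
      bottom e f = f , subst₂ _<_ (sym (adj⇒1 e)) (sym cx) ≤-refl , subst₂ _<_ (sym (d0 x)) (sym (adj⇒1 (~-sym f))) ≤-refl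
      off : ∀ {p} → u ~ p → p ≢ b → ¬ On u x b p
      off e′ = off-level bt (trans (adj⇒1 e′) (sym (adj⇒1 e)))

    -- The edge from `b` to `w` is the one that counts: it is good for `u` and `x`, because `x` is
    -- adjacent to `w` and not to `b`, and `w` is not between `u` and `x`.
    CrossEdge : (x b w : Fin (2+ m)) → Set
    CrossEdge x b w = C w × x ~ w × Parent w b × ¬ b ~ x

    cross-good : ∀ {x b w} → C x → CrossEdge x b w → Good u x (b , w) × ¬ Between u x w
    cross-good {x} {b} {w} cx (cw , e , (f , h) , ¬k) =
      (h , subst₂ _<_ (sym (adj⇒1 f)) (sym cw) ≤-refl , subst (_< d x b) (sym (adj⇒1 e)) (d≥2 (parent≢ cx (f , h) ∘ sym) (¬k ∘ ~-sym)))
      , λ bt → contradiction (trans (sym (cong₂ _+_ cw (adj⇒1 (~-sym e)))) (trans bt cx)) λ ()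

    one-cross : ∀ {x b w} → C x → CrossEdge x b w → 1 ≤ c u x
    one-cross cx ce = extra (proj₁ (cross-good cx ce)) (inj₂ (proj₂ (cross-good cx ce)))

    two-cross : ∀ {x b w b′ w′} → C x → CrossEdge x b w → CrossEdge x b′ w′ → (b , w) ≢ (b′ , w′) → 2 ≤ c u x
    two-cross {x} cx ce ce′ ne = excess (detour (between-start u x) ((ne ∷ []) ∷ [] ∷ []) (proj₁ (cross-good cx ce) ∷ proj₁ (cross-good cx ce′) ∷ [])
        (inj₂ (proj₂ (cross-good cx ce) ∘ On⇒Between (between-start u x)) ∷ inj₂ (proj₂ (cross-good cx ce′) ∘ On⇒Between (between-start u x)) ∷ []))

    -- A vertex of level two for which neither a second parent nor a cross edge forces an excess.
    -- All its neighbours then lie in the closed neighbourhood of `a`.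
    Free : (a x : Fin (2+ m)) → Set
    Free a x = C x × Parent x a × (∀ b → Parent x b → b ≡ a) × (∀ w → C w → x ~ w → ∀ b → Parent w b → b ≡ a)

    classify : ∀ {x} → C x → (∃ λ a → Free a x) ⊎ (2 ≤ c u x ⊎ ∃₂ λ b w → CrossEdge x b w)
    classify {x} cx with parent cx
    ... | a , pa with any? (λ b → parent? x b ×-dec ¬? (b ≟ a))
    ... | yes (b , pb , b≢a) = inj₂ (inj₁ (two-parents cx pa pb (b≢a ∘ sym)))
    ... | no sole with any? (λ w → any? (λ b → C? w ×-dec adj? G x w ×-dec parent? w b ×-dec ¬? (b ≟ a)))
    ...   | yes (w , b , cw , e , pb , b≢a) = inj₂ (inj₂ (b , w , cw , e , pb , λ f → sole (b , (proj₁ pb , f) , b≢a)))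
    ...   | no none = inj₁ (a , cx , pa , (λ b pb → decidable-stable (b ≟ a) λ b≢a → sole (b , pb , b≢a))
                           , λ w cw e b pb → decidable-stable (b ≟ a) λ b≢a → none (w , b , cw , e , pb , b≢a))

    -- Free vertices with parent a are exactly the vertices at distance at least four from u in G ∖ a.

    free⇒removable : ∀ {a x} → Free a x → Removable tc
    free⇒removable {a} {x} (cx , pa , sole , only) with punch-onto {x = a} {u} (~⇒≢ (~-sym (proj₁ pa))) | punch-onto {x = a} {x} (parent≢ cx pa)
    ... | u′ , eu | x′ , ex with maximal (Without.δ a u′)
    ... | y′ , mx = record
      { a = a ; x = y
      ; dominates = ~-sym (proj₂ pay) , dominated
      ; farthest = u′ , y′ , refl , (λ { refl → C⇒≢ cy eu }) , mx
      ; w = u ; x≢w = C⇒≢ cy ; x≁w = C⇒≁ cy ∘ ~-sym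
      }
      where
      open Without a
      y : Fin (2+ m)
      y = punchIn a y′

      second : ∀ {t k} → C (punchIn a t) → δ t u′ ≡ k → 2 ≤ k
      second {t} {zero} ct eq = contradiction (trans (cong (punchIn a) (δ0⇒≡ eq)) eu) (C⇒≢ ct)
      second {t} {suc zero} ct eq with δ-step eq
      ... | s , e , eq′ = contradiction (~-sym (subst (punchIn a t ~_) (trans (cong (punchIn a) (δ0⇒≡ eq′)) eu) e)) (C⇒≁ ct)
      second {t} {suc (suc k)} ct eq = s≤s (s≤s z≤n)

      third : ∀ {t k} → C (punchIn a t) → (∀ b → Parent (punchIn a t) b → b ≡ a) → δ t u′ ≡ suc k →
              ∃ λ s → punchIn a t ~ punchIn a s × δ s u′ ≡ k × C (punchIn a s)
      third {t} ct alone eq with δ-step eq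
      ... | s , e , eq′ = s , e , eq′ , inC (λ eu′ → C⇒≁ ct (subst (_~ punchIn a t) eu′ (~-sym e))) λ f → punchInᵢ≢i a s (alone _ (f , ~-sym e))

      fourth : ∀ {k} → δ x′ u′ ≡ k → 4 ≤ k
      fourth {zero} eq = contradiction (second (subst C (sym ex) cx) eq) λ ()
      fourth {suc k} eq with third (subst C (sym ex) cx) (subst (λ t → ∀ b → Parent t b → b ≡ a) (sym ex) sole) eq
      fourth {suc zero} _ | s , e , eq′ , cs = contradiction (second cs eq′) λ ()
      fourth {suc (suc k)} _ | s , e , eq′ , cs with third cs (only _ cs (subst (_~ punchIn a s) ex e)) eq′
      ... | t , _ , eq″ , ct = s≤s (s≤s (second ct eq″))

      -- The free vertex `x` is at distance at least four, hence so is the farthest vertex `y`.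
      -- Distance four rules out that `y` is adjacent to `u`, has a second parent, or has a
      -- level-two neighbour with a parent other than `a`.
      far : 4 ≤ δ u′ y′
      far = ≤-trans (fourth refl) (≤-trans (≤-reflexive (δ-sym x′ u′)) (mx x′))

      near₁ : ∀ {b′} → u ~ punchIn a b′ → δ u′ b′ ≤ 1
      near₁ {b′} e = ≤-reflexive (δ-adj (subst (_~ punchIn a b′) (sym eu) e))

      near₂ : ∀ {b t′} → b ≢ a → Parent (punchIn a t′) b → δ u′ t′ ≤ 2
      near₂ b≢a (e , f) with punch-onto (b≢a ∘ sym)
      ... | b′ , refl = ≤-trans (δ-adjʳ u′ (~-sym f)) (s≤s (near₁ e))

      cy : C y
      cy = inC (λ eq → contradiction (≤-trans far (≤-reflexive (trans (cong (δ u′) (punchIn-injective a _ _ (trans eq (sym eu)))) (δ0 u′)))) λ ())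
               (λ e → contradiction (≤-trans far (near₁ e)) λ { (s≤s ()) })

      soley : ∀ b → Parent y b → b ≡ a
      soley b pb = decidable-stable (b ≟ a) λ b≢a → contradiction (≤-trans far (near₂ b≢a pb)) λ { (s≤s (s≤s ())) }

      pay : Parent y a
      pay with parent cy
      ... | b , pb = subst (Parent y) (soley b pb) pb

      dominated : ∀ {z} → z ≢ a → y ~ z → a ~ z
      dominated {z} z≢a e with z ≟ u | adj? G u z
      ... | yes refl | _ = contradiction (~-sym e) (C⇒≁ cy)
      ... | no _ | yes f = contradiction (soley z (f , ~-sym e)) z≢a
      ... | no z≢u | no ¬f with parent (inC z≢u ¬f) | punch-onto (z≢a ∘ sym)
      ... | b , pb | z′ , refl with b ≟ a
      ...   | yes refl = proj₂ pb
      ...   | no b≢a = contradiction (≤-trans far (≤-trans (δ-adjʳ u′ e) (s≤s (near₂ b≢a pb)))) λ { (s≤s (s≤s (s≤s ()))) }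

-- Private neighbours of a vertex of small cost

module PrivateNeighbours {m : ℕ} {G : Graph (2+ m)} (D : Distances G) (tc : TwoConnected G) (m≥4 : 4 ≤ m)
                         {u : Fin (2+ m)} (poor : Metric.cost D u ≤ 3) where
  open Metric D
  open Detours D
  open Costs D tc
  open Candidates D tc
  open Poor poor
  open Without u

  -- Every neighbour of such a vertex is `u` or adjacent to `u`, so `u` dominates it.
  Private : Fin (2+ m) → Set
  Private v = u ~ v × (∀ w → C w → ¬ v ~ w)

  -- If some vertex is at distance three or more from `r′` in `G ∖ u`, then `near` makes the
  -- farthest one private. If none is, the given private vertex, not being adjacent to the level-two
  -- vertex `r′`, is itself farthest.
  private⇒removable : ∀ {r′ v′} → C (punchIn u r′) → Private (punchIn u v′) →
    (∀ t′ → C (punchIn u t′) ⊎ (∃ λ w → C w × punchIn u t′ ~ w) → δ r′ t′ ≤ 2) → Removable tc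
  private⇒removable {r′} {v′} cr priv near with maximal (δ r′)
  ... | z′ , mx with δ r′ z′ ≤? 2
  ...   | yes close = conclude v′ priv (λ t → ≤-trans (mx t) (≤-trans close (δ≥2 (r≢ priv) λ e → proj₂ priv _ cr (~-sym e))))
    where
    r≢ : ∀ {v′} → Private (punchIn u v′) → r′ ≢ v′
    r≢ p refl = C⇒≁ cr (proj₁ p)
    conclude : ∀ x′ → Private (punchIn u x′) → (∀ t → δ r′ t ≤ δ r′ x′) → Removable tc
    conclude x′ p far = record
      { a = u ; x = punchIn u x′
      ; dominates = ~-sym (proj₁ p) , λ {y} y≢u e → decidable-stable (adj? G u y) (λ u≁y → proj₂ p y (inC y≢u u≁y) e)
      ; farthest = r′ , x′ , refl , r≢ p , far
      ; w = punchIn u r′ ; x≢w = r≢ p ∘ sym ∘ punchIn-injective u _ _ ; x≁w = proj₂ p _ cr }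
  ...   | no deep = record
      { a = u ; x = punchIn u z′
      ; dominates = ~-sym u~z , λ {y} y≢u e → decidable-stable (adj? G u y) (λ u≁y → ¬C y (inC y≢u u≁y) e)
      ; farthest = r′ , z′ , refl , r≢z , mx
      ; w = punchIn u r′ ; x≢w = r≢z ∘ sym ∘ punchIn-injective u _ _ ; x≁w = ¬C _ cr }
    where
    ¬C : ∀ w → C w → ¬ punchIn u z′ ~ w
    ¬C w cw e = deep (near z′ (inj₂ (w , cw , e)))
    u~z : u ~ punchIn u z′
    u~z = decidable-stable (adj? G u _) (λ u≁ → deep (near z′ (inj₁ (inC (punchInᵢ≢i u z′) u≁))))
    r≢z : r′ ≢ z′
    r≢z refl = C⇒≁ cr u~z

  -- Any vertex other than `u`, `w`, `w′`, `b`, `b′` is private, and with order at least six there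
  -- is one.
  few⇒removable : ∀ {w w′ b b′} → C w → C w′ → w ≡ w′ ⊎ w ~ w′ → (∀ v → C v → v ≡ w ⊎ v ≡ w′) →
    (∀ t → Parent w t ⊎ Parent w′ t → t ≡ b ⊎ t ≡ b′) → Removable tc
  few⇒removable {w} {w′} {b} {b′} cw cw′ ww′ cover parents
    with fresh (u ∷ w ∷ w′ ∷ b ∷ b′ ∷ []) (s≤s (s≤s m≥4)) | punch-onto (C⇒≢ cw ∘ sym) | punch-onto (C⇒≢ cw′ ∘ sym)
  ... | v , v≢u ∷ v≢w ∷ v≢w′ ∷ v≢b ∷ v≢b′ ∷ [] | r , refl | s , refl with punch-onto (v≢u ∘ sym)
  ...   | v′ , refl = private⇒removable cw (u~v , alone) near
    where
    ¬cv : ¬ C (punchIn u v′)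
    ¬cv cv = [ v≢w , v≢w′ ]′ (cover _ cv)
    u~v : u ~ punchIn u v′
    u~v = decidable-stable (adj? G u _) λ u≁v → ¬cv (inC v≢u u≁v)
    alone : ∀ t → C t → ¬ punchIn u v′ ~ t
    alone t ct e with cover t ct
    ... | inj₁ refl = [ v≢b , v≢b′ ]′ (parents _ (inj₁ (u~v , e)))
    ... | inj₂ refl = [ v≢b , v≢b′ ]′ (parents _ (inj₂ (u~v , e)))
    rs : δ r s ≤ 1
    rs = [ (λ eq → ≤-trans (≤-reflexive (trans (cong (δ r) (punchIn-injective u _ _ (sym eq))) (δ0 r))) z≤n)
         , (λ e → ≤-reflexive (δ-adj e)) ]′ ww′
    near : ∀ t′ → C (punchIn u t′) ⊎ (∃ λ w → C w × punchIn u t′ ~ w) → δ r t′ ≤ 2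
    near t′ (inj₁ ct) with cover _ ct
    ... | inj₁ eq = ≤-trans (≤-reflexive (trans (cong (δ r) (punchIn-injective u _ _ eq)) (δ0 r))) z≤n
    ... | inj₂ eq = ≤-trans (≤-reflexive (cong (δ r) (punchIn-injective u _ _ eq))) (≤-trans rs (s≤s z≤n))
    near t′ (inj₂ (x , cx , e)) with cover x cx
    ... | inj₁ refl = ≤-trans (δ-adjʳ r e) (s≤s (≤-trans (≤-reflexive (δ0 r)) z≤n))
    ... | inj₂ refl = ≤-trans (δ-adjʳ r e) (s≤s rs)

  parents-of : ∀ {x} → C x → (∃ λ p → Parent x p × (∀ b → Parent x b → b ≡ p))
    ⊎ (∃₂ λ p p′ → Parent x p × Parent x p′ × p ≢ p′ × (∀ b → Parent x b → b ≡ p ⊎ b ≡ p′))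
  parents-of {x} cx with parent cx
  ... | p , pp with any? (λ b → parent? x b ×-dec ¬? (b ≟ p))
  ... | no none = inj₁ (p , pp , λ b pb → decidable-stable (b ≟ p) λ b≢ → none (b , pb , b≢))
  ... | yes (p′ , pp′ , p′≢p) = inj₂ (p , p′ , pp , pp′ , p′≢p ∘ sym , only)
    where
    only : ∀ b → Parent x b → b ≡ p ⊎ b ≡ p′
    only b pb with b ≟ p | b ≟ p′
    ... | yes eq | _ = inj₁ eq
    ... | no _ | yes eq = inj₂ eq
    ... | no b≢p | no b≢p′ = cheap (cost-one (three-parents cx pp pp′ pb (p′≢p ∘ sym) (b≢p ∘ sym) (b≢p′ ∘ sym)))

  -- Otherwise `w` costs two for its two parents, and `w′` costs two because the edges from both of
  -- them to `w` are cross edges; that is four.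
  merge : ∀ {w w′ p p′ q} → C w → C w′ → w ~ w′ → w ≢ w′ → Parent w p → Parent w p′ → p ≢ p′ → (∀ b → Parent w b → b ≡ p ⊎ b ≡ p′) →
          (∀ b → Parent w′ b → b ≡ q) → Parent w′ q → q ≡ p ⊎ q ≡ p′
  merge {w} {w′} {p} {p′} {q} cw cw′ e w≢w′ pp pp′ p≢p′ only sole pq with q ≟ p | q ≟ p′
  ... | yes eq | _ = inj₁ eq
  ... | no _ | yes eq = inj₂ eq
  ... | no q≢p | no q≢p′ = cheap (cost-two w≢w′ (two-parents cw pp pp′ p≢p′)
      (two-cross cw′ (cw , ~-sym e , pp , λ f → q≢p (sym (sole p (proj₁ pp , f))))
                     (cw , ~-sym e , pp′ , λ f → q≢p′ (sym (sole p′ (proj₁ pp′ , f)))) (p≢p′ ∘ cong proj₁)))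

  module NoFree (nf : ∀ {x} → C x → 2 ≤ c u x ⊎ ∃₂ λ b w → CrossEdge x b w) where

    positive : ∀ {x} → C x → 1 ≤ c u x
    positive cx with nf cx
    ... | inj₁ two = ≤-trans (s≤s z≤n) two
    ... | inj₂ (_ , _ , ce) = one-cross cx ce

    pair⇒removable : ∀ {w w′} → C w → C w′ → w ≢ w′ → (∀ v → C v → v ≡ w ⊎ v ≡ w′) → Removable tc
    pair⇒removable {w} {w′} cw cw′ w≢w′ cover with adj? G w w′
    ... | no w≁w′ = cheap (cost-two w≢w′ (double cw cover w≁w′) (double cw′ (λ v cv → [ inj₂ , inj₁ ]′ (cover v cv)) (w≁w′ ∘ ~-sym)))
      where
      -- With `w` and `w′` not adjacent, no cross edge exists, so only an excess of two remains for
      -- each.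
      double : ∀ {w w′} → C w → (∀ v → C v → v ≡ w ⊎ v ≡ w′) → ¬ w ~ w′ → 2 ≤ c u w
      double cw cover w≁w′ with nf cw
      ... | inj₁ two = two
      ... | inj₂ (b , t , ct , e , _) with cover t ct
      ...   | inj₁ refl = contradiction refl (~⇒≢ e)
      ...   | inj₂ refl = contradiction e w≁w′
    ... | yes e with parents-of cw | parents-of cw′
    ...   | inj₁ (p , pp , sole) | inj₁ (q , pq , sole′) =
      few⇒removable cw cw′ (inj₂ e) cover λ t → [ inj₁ ∘ sole t , inj₂ ∘ sole′ t ]′
    ...   | inj₂ (p , p′ , pp , pp′ , p≢p′ , only) | inj₁ (q , pq , sole) =
      few⇒removable cw cw′ (inj₂ e) cover λ t → [ only t , (λ pt → subst (λ z → z ≡ p ⊎ z ≡ p′) (sym (sole t pt))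
        (merge cw cw′ e w≢w′ pp pp′ p≢p′ only sole pq)) ]′
    ...   | inj₁ (q , pq , sole) | inj₂ (p , p′ , pp , pp′ , p≢p′ , only) =
      few⇒removable cw cw′ (inj₂ e) cover λ t → [ (λ pt → subst (λ z → z ≡ p ⊎ z ≡ p′) (sym (sole t pt))
        (merge cw′ cw (~-sym e) (w≢w′ ∘ sym) pp pp′ p≢p′ only sole pq)) , only t ]′
    ...   | inj₂ (p , p′ , pp , pp′ , p≢p′ , _) | inj₂ (q , q′ , pq , pq′ , q≢q′ , _) =
      cheap (cost-two w≢w′ (two-parents cw pp pp′ p≢p′) (two-parents cw′ pq pq′ q≢q′))

    three-costs : ∀ {x y z i j k} → x ≢ y → x ≢ z → y ≢ z → i ≤ c u x → j ≤ c u y → k ≤ c u z → i + (j + k) ≤ cost u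
    three-costs {x} {y} {z} {k = k} p q r s t v = ≤-trans (+-mono-≤ s (+-mono-≤ t (≤-trans v (m≤m+n _ 0))))
      (vertices≤cost u {x ∷ y ∷ z ∷ []} ((p ∷ q ∷ []) ∷ (r ∷ []) ∷ [] ∷ []))

    Cross : (x w : Fin (2+ m)) → Set
    Cross x w = ∃ λ b → CrossEdge x b w

    module Triple {x y z} (cx : C x) (cy : C y) (cz : C z) (x≢y : x ≢ y) (x≢z : x ≢ z) (y≢z : y ≢ z) where

      -- Each of the three has positive excess and the cost is at most three, so each has excess
      -- exactly one.
      no-two : ∀ {t} → t ∈ (x ∷ y ∷ z ∷ []) → ¬ 2 ≤ c u t
      no-two (here refl) two = cheap (three-costs x≢y x≢z y≢z two (positive cy) (positive cz))
      no-two (there (here refl)) two = cheap (three-costs x≢y x≢z y≢z (positive cx) two (positive cz))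
      no-two (there (there (here refl))) two = cheap (three-costs x≢y x≢z y≢z (positive cx) (positive cy) two)

      member : ∀ {t} → t ∈ (x ∷ y ∷ z ∷ []) → C t
      member (here refl) = cx
      member (there (here refl)) = cy
      member (there (there (here refl))) = cz

      target : ∀ {t} → C t → t ∈ (x ∷ y ∷ z ∷ [])
      target {t} ct with x ≟ t | y ≟ t | z ≟ t
      ... | yes refl | _ | _ = here refl
      ... | no _ | yes refl | _ = there (here refl)
      ... | no _ | no _ | yes refl = there (there (here refl))
      ... | no x≢ | no y≢ | no z≢ = cheap (≤-trans
        (+-mono-≤ (positive cx) (+-mono-≤ (positive cy) (+-mono-≤ (positive cz) (≤-trans (positive ct) (m≤m+n _ 0)))))
        (vertices≤cost u {x ∷ y ∷ z ∷ t ∷ []} ((x≢y ∷ x≢z ∷ x≢ ∷ []) ∷ (y≢z ∷ y≢ ∷ []) ∷ (z≢ ∷ []) ∷ [] ∷ [])))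

      cross : ∀ {t} → t ∈ (x ∷ y ∷ z ∷ []) → ∃ λ w → w ∈ (x ∷ y ∷ z ∷ []) × Cross t w
      cross t∈ with nf (member t∈)
      ... | inj₁ two = contradiction two (no-two t∈)
      ... | inj₂ (b , w , ce) = w , target (proj₁ ce) , b , ce

      -- A parent `a` of `t` is not adjacent to `w`: with `b` it would be a second parent of `w`,
      -- giving `w` excess two.
      cross-sym : ∀ {t w} → t ∈ (x ∷ y ∷ z ∷ []) → w ∈ (x ∷ y ∷ z ∷ []) → Cross t w → Cross w t
      cross-sym t∈ w∈ (b , cw , e , pb , b≁t) with parent (member t∈)
      ... | a , pa = a , member t∈ , ~-sym e , pa , λ f → no-two w∈ (two-parents cw (proj₁ pa , f) pb λ { refl → b≁t (proj₂ pa) })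

      cross-unique : ∀ {t w w′} → t ∈ (x ∷ y ∷ z ∷ []) → Cross t w → Cross t w′ → w ≡ w′
      cross-unique {w = w} {w′} t∈ (_ , ce) (_ , ce′) = decidable-stable (w ≟ w′) λ w≢w′ → no-two t∈ (two-cross (member t∈) ce ce′ (w≢w′ ∘ cong proj₂))

      cross-irrefl : ∀ {t} → ¬ Cross t t
      cross-irrefl (_ , _ , e , _) = ~⇒≢ e refl

    -- Crossing would be a perfect matching on three vertices.

    no-triple : ∀ {x y z} → C x → C y → C z → x ≢ y → x ≢ z → y ≢ z → ⊥
    no-triple {x} {y} {z} cx cy cz x≢y x≢z y≢z = main (cross x∈) (cross y∈) (cross z∈)
      where
      open Triple cx cy cz x≢y x≢z y≢z
      x∈ = here refl
      y∈ = there (here refl)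
      z∈ = there (there (here refl))
      Target : Fin (2+ m) → Set
      Target t = ∃ λ w → w ∈ (x ∷ y ∷ z ∷ []) × Cross t w
      xy : Cross x y → Target z → ⊥
      xy p (_ , here refl , q) = y≢z (cross-unique x∈ p (cross-sym z∈ x∈ q))
      xy p (_ , there (here refl) , q) = x≢z (cross-unique y∈ (cross-sym x∈ y∈ p) (cross-sym z∈ y∈ q))
      xy p (_ , there (there (here refl)) , q) = cross-irrefl q
      xz : Cross x z → Target y → ⊥
      xz p (_ , here refl , q) = y≢z (cross-unique x∈ (cross-sym y∈ x∈ q) p)
      xz p (_ , there (here refl) , q) = cross-irrefl q
      xz p (_ , there (there (here refl)) , q) = x≢y (cross-unique z∈ (cross-sym x∈ z∈ p) (cross-sym y∈ z∈ q))
      main : Target x → Target y → Target z → ⊥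
      main (_ , here refl , p) _ _ = cross-irrefl p
      main (_ , there (here refl) , p) _ tz = xy p tz
      main (_ , there (there (here refl)) , p) ty _ = xz p ty

    removable : ∀ {w} → C w → Removable tc
    removable {w} cw with any? (λ w′ → C? w′ ×-dec ¬? (w′ ≟ w))
    ... | yes (w′ , cw′ , w′≢w) = pair⇒removable cw cw′ (w′≢w ∘ sym) cover
      where
      cover : ∀ v → C v → v ≡ w ⊎ v ≡ w′
      cover v cv with v ≟ w | v ≟ w′
      ... | yes eq | _ = inj₁ eq
      ... | no _ | yes eq = inj₂ eq
      ... | no v≢w | no v≢w′ = ⊥-elim (no-triple cw cw′ cv (w′≢w ∘ sym) (v≢w ∘ sym) (v≢w′ ∘ sym))
    ... | no none with parents-of cw
    ...   | inj₁ (p , _ , sole) = few⇒removable cw cw (inj₁ refl) cover λ t → [ inj₁ {B = t ≡ p} ∘ sole t , inj₁ ∘ sole t ]′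
      where
      cover : ∀ v → C v → v ≡ w ⊎ v ≡ w
      cover v cv = inj₁ (decidable-stable (v ≟ w) λ v≢w → none (v , cv , v≢w))
    ...   | inj₂ (p , p′ , _ , _ , _ , only) = few⇒removable cw cw (inj₁ refl) (λ v cv → inj₁ (decidable-stable (v ≟ w) λ v≢w → none (v , cv , v≢w)))
        λ t → [ only t , only t ]′

  poor⇒removable : ∀ {w} → w ≢ u → ¬ u ~ w → Removable tc
  poor⇒removable {w} w≢u u≁w with any? (λ a → any? (λ x → free? a x))
    where
    free? : ∀ a x → Dec (Free a x)
    free? a x = C? x ×-dec parent? x a ×-dec all? (λ b → parent? x b →-dec b ≟ a)
      ×-dec all? (λ w → C? w →-dec adj? G x w →-dec all? λ b → parent? w b →-dec b ≟ a)
  ... | yes (a , x , free) = free⇒removable free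
  ... | no none = NoFree.removable (λ {x} cx → [ (λ (a , free) → ⊥-elim (none (a , x , free))) , (λ z → z) ]′ (classify cx)) (inC w≢u u≁w)

-- Exceptional graphs, and two sides joined by two edges

∑-δ : (x : Fin n) → ∑ (λ v → ⟦ v ≟ x ⟧) ≡ 1
∑-δ {suc n} x = trans (∑-punch x _) (cong₂ _+_ (⟦⟧-yes (x ≟ x) refl)
  (trans (∑-cong λ i → ⟦⟧-no (punchIn x i ≟ x) (punchInᵢ≢i x i)) (trans (∑-const n 0) (*-zeroʳ n))))

degree : Graph n → Fin n → ℕ
degree G x = ∑ λ v → ⟦ adj? G x v ⟧

AllAdjacentExcept : Graph n → Fin n → Set
AllAdjacentExcept G z = ∀ {v w} → v ≢ z → w ≢ z → v ≢ w → Adj G v w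

-- For 2-connected G: isomorphic to completePlus n t with t = 2 or t = n - 2, or complete.

Exceptional′ : Graph n → Set
Exceptional′ {n} G = ∃ λ z → AllAdjacentExcept G z × (degree G z ≤ 2 ⊎ n ≤ 2 + degree G z)

-- Two sides a ∪ A and b ∪ B joined by exactly the edges ab and vv′.

record TwoBridges {n : ℕ} (G : Graph n) (A B U : Fin n → Set) (a b v v′ : Fin n) : Set where
  field
    a~b  : Adj G a b
    v~v′ : Adj G v v′
    Av   : A v
    Bv′  : B v′
    A~a  : ∀ {x} → A x → Adj G a x
    B~b  : ∀ {x} → B x → Adj G b x
    A≁b  : ∀ {x} → A x → ¬ Adj G b x
    B≁a  : ∀ {x} → B x → ¬ Adj G a x
    A≢b  : ∀ {x} → A x → x ≢ b
    B≢a  : ∀ {x} → B x → x ≢ a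
    AB   : ∀ {x y} → A x → B y → Adj G x y → x ≡ v × y ≡ v′
    nbrA : ∀ {x t} → A x → Adj G x t → t ≡ a ⊎ A t ⊎ B t
    nbrB : ∀ {x t} → B x → Adj G x t → t ≡ b ⊎ B t ⊎ A t
    U~a  : ∀ {t} → U t → Adj G t a
    U~b  : ∀ {t} → U t → Adj G t b
    U≢a  : ∀ {t} → U t → t ≢ a
    U≢b  : ∀ {t} → U t → t ≢ b
    U-A  : ∀ {t} → U t → ¬ A t
    U-B  : ∀ {t} → U t → ¬ B t

module _ {G : Graph n} {A B U : Fin n → Set} {a b v v′ : Fin n} where

  swap-sides : TwoBridges G A B U a b v v′ → TwoBridges G B A U b a v′ v
  swap-sides θ = record
    { a~b = Graph.sym G a~b ; v~v′ = Graph.sym G v~v′ ; Av = Bv′ ; Bv′ = Av ; A~a = B~b ; B~b = A~a ; A≁b = B≁a ; B≁a = A≁b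
    ; A≢b = B≢a ; B≢a = A≢b
    ; AB = λ bx ay e → let (x , y) = AB ay bx (Graph.sym G e) in y , x
    ; nbrA = nbrB ; nbrB = nbrA ; U~a = U~b ; U~b = U~a ; U≢a = U≢b ; U≢b = U≢a ; U-A = U-B ; U-B = U-A }
    where open TwoBridges θ

module Bridges {n : ℕ} {G : Graph n} (D : Distances G) {A B U : Fin n → Set} {a b v v′ : Fin n} (θ : TwoBridges G A B U a b v v′) where
  open Metric D
  open Detours D
  open TwoBridges θ

  A≢a : ∀ {x} → A x → x ≢ a
  A≢a ax refl = ~⇒≢ (A~a ax) refl

  v≢b : v ≢ b
  v≢b = A≢b Av

  d-av′ : d a v′ ≡ 2
  d-av′ = d≡2 (B≢a Bv′ ∘ sym) (B≁a Bv′) a~b (B~b Bv′)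

  d-vb : d v b ≡ 2
  d-vb = d≡2 v≢b (A≁b Av ∘ ~-sym) (~-sym (A~a Av)) a~b

  B≢v : ∀ {y} → B y → y ≢ v
  B≢v by refl = A≁b Av (B~b by)

  nearer-v′ : ∀ {y} → y ≡ b ⊎ B y → d y v′ < d y v
  nearer-v′ (inj₁ refl) = subst₂ _<_ (sym (adj⇒1 (B~b Bv′))) (sym (trans (d-sym b v) d-vb)) ≤-refl
  nearer-v′ {y} (inj₂ by) with y ≟ v′ | adj? G y v′
  ... | yes refl | _ = subst₂ _<_ (sym (d0 y)) (sym (adj⇒1 (~-sym v~v′))) ≤-refl
  ... | no y≢v′ | yes e = subst (_< d y v) (sym (adj⇒1 e)) (d≥2 (B≢v by) (λ f → y≢v′ (proj₂ (AB Av by (~-sym f)))))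
  ... | no y≢v′ | no y≁v′ = ≤-trans (s≤s (≤-trans (d-adjˡ v′ (~-sym (B~b by))) (s≤s (≤-reflexive (adj⇒1 (B~b Bv′)))))) (three (d y v) refl)
    where
    y≁v : ¬ y ~ v
    y≁v f = y≢v′ (proj₂ (AB Av by (~-sym f)))
    -- The middle of a walk of length two would be `b`, which is not adjacent to `v`, or the walk
    -- would use the edge between `v` and `v′`, making `y` equal or adjacent to `v′`.
    three : ∀ k → d y v ≡ k → 3 ≤ k
    three zero eq = contradiction (d0⇒≡ eq) (B≢v by)
    three (suc zero) eq = contradiction (1⇒adj eq) y≁v
    three (suc (suc (suc k))) eq = s≤s (s≤s (s≤s z≤n))
    three (suc (suc zero)) eq with step eq
    ... | t , e , eq′ with nbrB by e
    ...   | inj₁ refl = contradiction (1⇒adj eq′) (A≁b Av)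
    ...   | inj₂ (inj₁ bt) = contradiction (subst (y ~_) (proj₂ (AB Av bt (~-sym (1⇒adj eq′)))) e) y≁v′
    ...   | inj₂ (inj₂ at) = contradiction (proj₂ (AB at by (~-sym e))) y≢v′

  nearer-a : ∀ {x} → x ≡ a ⊎ A x → d x a < d x b
  nearer-a (inj₁ refl) = subst₂ _<_ (sym (d0 a)) (sym (adj⇒1 a~b)) ≤-refl
  nearer-a {x} (inj₂ ax) = subst (_< d x b) (sym (adj⇒1 (~-sym (A~a ax)))) (d≥2 (A≢b ax) (A≁b ax ∘ ~-sym))

  c-av′ : 2 ≤ c a v′
  c-av′ = fork (adj⇒1 a~b) (adj⇒1 (A~a Av)) (v≢b ∘ sym)
    (trans (cong₂ _+_ (adj⇒1 a~b) (adj⇒1 (B~b Bv′))) (sym d-av′))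
    (trans (cong₂ _+_ (adj⇒1 (A~a Av)) (adj⇒1 v~v′)) (sym d-av′)) (subst (1 <_) (sym d-av′) ≤-refl)

  c-av : 1 ≤ c a v
  c-av = extra {p = b} {q = v′} (B~b Bv′ , subst₂ _<_ (sym (adj⇒1 a~b)) (sym d-av′) ≤-refl , subst₂ _<_ (sym (adj⇒1 v~v′)) (sym d-vb) ≤-refl)
    (inj₂ λ bt → contradiction (trans (sym (cong₂ _+_ d-av′ (adj⇒1 (~-sym v~v′)))) (trans bt (adj⇒1 (A~a Av)))) λ ())

  c-Uv : ∀ {t} → U t → 1 ≤ c v t
  c-Uv {t} ut = subst (1 ≤_) (c-sym t v) (extra {p = b} {q = v′}
    (B~b Bv′ , subst (_< d t v′) (sym (adj⇒1 (U~b ut))) far , subst₂ _<_ (sym (adj⇒1 v~v′)) (sym d-vb) ≤-refl)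
    (inj₂ λ bt → 1+n≰n (≤-trans (+-mono-≤ far (≤-reflexive (sym (adj⇒1 (~-sym v~v′))))) (≤-trans (≤-reflexive bt) near))))
    where
    far : 2 ≤ d t v′
    far = d≥2 (λ { refl → U-B ut Bv′ }) λ e → [ U≢b ut , [ U-B ut , U-A ut ]′ ]′ (nbrB Bv′ (~-sym e))
    near : d t v ≤ 2
    near = ≤-trans (d-adjˡ v (U~a ut)) (s≤s (≤-reflexive (adj⇒1 (A~a Av))))

  -- Both joining edges are good. If `a` is not between `x` and `y`, the edge from `a` to `b` is
  -- extra. If it is, a shortest walk through `a` could meet `v′` only at its end, so the other
  -- joining edge is extra.
  through-a : ∀ {x y} → x ≡ a ⊎ A x → y ≡ b ⊎ B y → y ≢ v′ → Good x y (a , b) → Good x y (v , v′) → 1 ≤ c x y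
  through-a {x} {y} xa yb y≢v′ g₁ g₂ with between? x y a
  ... | no off = extra g₁ (inj₁ off)
  ... | yes bt = excess (detour bt ([] ∷ []) (g₂ ∷ []) (inj₂ off ∷ []))
    where
    xa≤1 : d x a ≤ 1
    xa≤1 = [ (λ { refl → ≤-trans (≤-reflexive (d0 a)) z≤n }) , (λ ax → ≤-reflexive (adj⇒1 (~-sym (A~a ax)))) ]′ xa
    ay≤2 : d a y ≤ 2
    ay≤2 = ≤-trans (d-adjˡ y a~b) (s≤s ([ (λ { refl → ≤-trans (≤-reflexive (d0 b)) z≤n }) , (λ by → ≤-reflexive (adj⇒1 (B~b by))) ]′ yb))
    off : ¬ On x y a v′
    off (inj₁ z) = 1+n≰n (≤-trans (≤-reflexive (sym (trans (d-sym v′ a) d-av′))) (≤-trans (m≤n+m _ (d x v′)) (≤-trans (≤-reflexive z) xa≤1)))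
    off (inj₂ z) = y≢v′ (sym (d0⇒≡ (n≤0⇒n≡0 (+-cancelˡ-≤ 2 _ 0 (≤-trans (≤-reflexive (trans (cong (_+ d v′ y) (sym d-av′)) z)) ay≤2)))))

opaque
  -- Opaque, so that a case distinction on `x ≟ a` leaves the indicator of the whole side intact.
  with? : (a : Fin n) {A : Fin n → Set} → Decidable A → ∀ x → Dec (x ≡ a ⊎ A x)
  with? a A? x = x ≟ a ⊎-dec A? x

module BridgeCounts {n : ℕ} {G : Graph n} (D : Distances G) {A B U : Fin n → Set} {a b v v′ : Fin n} (θ : TwoBridges G A B U a b v v′)
                    (A? : Decidable A) (B? : Decidable B) (U? : Decidable U) where
  open Metric D
  open Detours D
  open TwoBridges θ
  private
    module L = Bridges D θ
    module R = Bridges D (swap-sides θ)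

  A⁺? : ∀ x → Dec (x ≡ a ⊎ A x)
  A⁺? = with? a A?

  B⁺? : ∀ x → Dec (x ≡ b ⊎ B x)
  B⁺? = with? b B?

  α β p : ℕ
  α = ∑ λ x → ⟦ A⁺? x ⟧
  β = ∑ λ x → ⟦ B⁺? x ⟧
  p = ∑ λ x → ⟦ U? x ⟧

  c-AB : ∀ {x y} → x ≡ a ⊎ A x → y ≡ b ⊎ B y → 1 ≤ c x y
  c-AB {x} {y} xa yb with y ≟ v′ | x ≟ v
  ... | no y≢v′ | _ = L.through-a xa yb y≢v′ g₁ g₂
    where
    g₁ = a~b , L.nearer-a xa , R.nearer-a yb
    g₂ = v~v′ , R.nearer-v′ xa , L.nearer-v′ yb
  ... | yes _ | no x≢v = subst (1 ≤_) (c-sym y x) (R.through-a yb xa x≢v g₁ g₂)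
    where
    g₁ = ~-sym a~b , R.nearer-a yb , L.nearer-a xa
    g₂ = ~-sym v~v′ , L.nearer-v′ yb , R.nearer-v′ xa
  ... | yes refl | yes refl = extra (a~b , L.nearer-a xa , R.nearer-a yb) (inj₁ λ bt →
      contradiction (trans (sym (cong₂ _+_ (adj⇒1 (~-sym (A~a Av))) L.d-av′)) (trans bt (adj⇒1 v~v′))) λ ())

  disjoint : ∀ {x} → x ≡ a ⊎ A x → ¬ (x ≡ b ⊎ B x)
  disjoint (inj₁ refl) (inj₁ eq) = ~⇒≢ a~b eq
  disjoint (inj₁ refl) (inj₂ bx) = B≢a bx refl
  disjoint (inj₂ ax) (inj₁ eq) = A≢b ax eq
  disjoint (inj₂ ax) (inj₂ bx) = A≁b ax (B~b bx)

  U-A⁺ : ∀ {x} → U x → ¬ (x ≡ a ⊎ A x)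
  U-A⁺ ux = [ U≢a ux , U-A ux ]′

  U-B⁺ : ∀ {x} → U x → ¬ (x ≡ b ⊎ B x)
  U-B⁺ ux = [ U≢b ux , U-B ux ]′

  -- One unit for each vertex of `U` and of the side of `b`, a second one for `b`, which is reached
  -- both over `a` and over `v′`, and one for `a`.
  cost-v : p + β + 2 ≤ cost v
  cost-v = begin
    p + β + 2                                                     ≡⟨ cong (p + β +_) (cong₂ _+_ (∑-δ b) (∑-δ a)) ⟨
    p + β + (∑ (λ t → ⟦ t ≟ b ⟧) + ∑ (λ t → ⟦ t ≟ a ⟧))           ≡⟨ cong₂ _+_ (∑-+ _ _) (∑-+ _ _) ⟨
    ∑ (λ t → ⟦ U? t ⟧ + ⟦ B⁺? t ⟧) + ∑ (λ t → ⟦ t ≟ b ⟧ + ⟦ t ≟ a ⟧) ≡⟨ ∑-+ _ _ ⟨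
    ∑ (λ t → ⟦ U? t ⟧ + ⟦ B⁺? t ⟧ + (⟦ t ≟ b ⟧ + ⟦ t ≟ a ⟧))       ≤⟨ ∑-mono pointwise ⟩
    cost v                                                        ∎
    where
    open ≤-Reasoning
    pointwise : ∀ t → ⟦ U? t ⟧ + ⟦ B⁺? t ⟧ + (⟦ t ≟ b ⟧ + ⟦ t ≟ a ⟧) ≤ c v t
    pointwise t with U? t
    ... | yes ut rewrite ⟦⟧-no (B⁺? t) (U-B⁺ ut) | ⟦⟧-no (t ≟ b) (U≢b ut) | ⟦⟧-no (t ≟ a) (U≢a ut) = L.c-Uv ut
    ... | no _ with t ≟ b | t ≟ a
    ...   | yes refl | yes refl = contradiction refl (~⇒≢ a~b)
    ...   | yes refl | no _ rewrite ⟦⟧-yes (B⁺? t) (inj₁ refl) = subst (2 ≤_) (c-sym t v) R.c-av′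
    ...   | no _ | yes refl rewrite ⟦⟧-no (B⁺? t) (disjoint (inj₁ refl)) = subst (1 ≤_) (c-sym t v) L.c-av
    ...   | no _ | no _ with B⁺? t
    ...     | yes bt = c-AB (inj₂ Av) bt
    ...     | no _ = z≤n

  cost-a : β + 2 ≤ cost a
  cost-a = begin
    β + 2                                                ≡⟨ cong (β +_) (cong₂ _+_ (∑-δ v′) (∑-δ v)) ⟨
    β + (∑ (λ t → ⟦ t ≟ v′ ⟧) + ∑ (λ t → ⟦ t ≟ v ⟧))      ≡⟨ cong (β +_) (∑-+ _ _) ⟨
    β + ∑ (λ t → ⟦ t ≟ v′ ⟧ + ⟦ t ≟ v ⟧)                  ≡⟨ ∑-+ _ _ ⟨
    ∑ (λ t → ⟦ B⁺? t ⟧ + (⟦ t ≟ v′ ⟧ + ⟦ t ≟ v ⟧))         ≤⟨ ∑-mono pointwise ⟩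
    cost a                                               ∎
    where
    open ≤-Reasoning
    pointwise : ∀ t → ⟦ B⁺? t ⟧ + (⟦ t ≟ v′ ⟧ + ⟦ t ≟ v ⟧) ≤ c a t
    pointwise t with t ≟ v′ | t ≟ v
    ... | yes refl | yes eq = contradiction (sym eq) (~⇒≢ v~v′)
    ... | yes refl | no _ rewrite ⟦⟧-yes (B⁺? t) (inj₂ Bv′) = L.c-av′
    ... | no _ | yes refl rewrite ⟦⟧-no (B⁺? t) (disjoint (inj₂ Av)) = L.c-av
    ... | no _ | no _ with B⁺? t
    ...   | yes bt = c-AB (inj₁ refl) bt
    ...   | no _ = z≤n

  cost-A : ∀ {s} → s ≡ a ⊎ A s → β + ((p + 2) * ⟦ s ≟ v ⟧ + 2 * ⟦ s ≟ a ⟧) ≤ cost s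
  cost-A {s} sa with s ≟ v | s ≟ a
  ... | yes refl | yes eq = contradiction eq (L.A≢a Av)
  ... | yes refl | no _ = ≤-trans (≤-reflexive (shuffle β p)) cost-v
    where
    shuffle : ∀ x y → x + ((y + 2) * 1 + 2 * 0) ≡ y + x + 2
    shuffle = solve-∀
  ... | no _ | yes refl = ≤-trans (≤-reflexive (shuffle β p)) cost-a
    where
    shuffle : ∀ x y → x + ((y + 2) * 0 + 2 * 1) ≡ x + 2
    shuffle = solve-∀
  ... | no _ | no _ = ≤-trans (≤-reflexive (trans (shuffle β p) refl)) (∑-mono pointwise)
    where
    shuffle : ∀ x y → x + ((y + 2) * 0 + 2 * 0) ≡ x
    shuffle = solve-∀
    pointwise : ∀ t → ⟦ B⁺? t ⟧ ≤ c s t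
    pointwise t with B⁺? t
    ... | yes bt = c-AB sa bt
    ... | no _ = z≤n

  extra-A : Fin n → ℕ
  extra-A s = (p + 2) * ⟦ s ≟ v ⟧ + 2 * ⟦ s ≟ a ⟧

  extra-A-outside : ∀ {s} → ¬ (s ≡ a ⊎ A s) → extra-A s ≡ 0
  extra-A-outside {s} s∉ rewrite ⟦⟧-no (s ≟ v) (λ { refl → s∉ (inj₂ Av) }) | ⟦⟧-no (s ≟ a) (s∉ ∘ inj₁) = shuffle p
    where
    shuffle : ∀ y → (y + 2) * 0 + 2 * 0 ≡ 0
    shuffle = solve-∀

  extra-A-total : ∑ extra-A ≡ p + 4
  extra-A-total = begin
    ∑ extra-A                                                    ≡⟨ ∑-+ _ _ ⟩
    ∑ (λ s → (p + 2) * ⟦ s ≟ v ⟧) + ∑ (λ s → 2 * ⟦ s ≟ a ⟧)       ≡⟨ cong₂ _+_ (scale (p + 2) v) (scale 2 a) ⟩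
    p + 2 + 2                                                    ≡⟨ +-assoc p 2 2 ⟩
    p + 4                                                        ∎
    where
    open ≡-Reasoning
    scale : ∀ k (x : Fin n) → ∑ (λ s → k * ⟦ s ≟ x ⟧) ≡ k
    scale k x = trans (∑-cong λ s → *-comm k ⟦ s ≟ x ⟧) (trans (∑-*ʳ (λ s → ⟦ s ≟ x ⟧) k) (trans (cong (_* k) (∑-δ x)) (+-identityʳ k)))

module BridgeTotal {n : ℕ} {G : Graph n} (D : Distances G) (tc : TwoConnected G) {A B U : Fin n → Set} {a b v v′ : Fin n}
                   (θ : TwoBridges G A B U a b v v′) (A? : Decidable A) (B? : Decidable B) (U? : Decidable U)
                   (cover : ∀ x → U x ⊎ (x ≡ a ⊎ A x) ⊎ (x ≡ b ⊎ B x)) where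
  open Metric D
  open Detours D
  open Costs D tc
  open TwoBridges θ
  private
    module L = BridgeCounts D θ A? B? U?
    module R = BridgeCounts D (swap-sides θ) B? A? U?
    module L′ = Bridges D θ
    module R′ = Bridges D (swap-sides θ)
  open L using (α; β; p)

  weight : Fin n → ℕ
  weight s = ⟦ U? s ⟧ * 2 + (⟦ L.A⁺? s ⟧ * β + L.extra-A s + (⟦ L.B⁺? s ⟧ * α + R.extra-A s))

  weight≤cost : ∀ s → weight s ≤ cost s
  weight≤cost s with cover s
  ... | inj₁ us rewrite ⟦⟧-yes (U? s) us | ⟦⟧-no (L.A⁺? s) (L.U-A⁺ us) | ⟦⟧-no (L.B⁺? s) (L.U-B⁺ us)
                      | L.extra-A-outside (L.U-A⁺ us) | R.extra-A-outside (L.U-B⁺ us) =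
    cost-two (~⇒≢ v~v′) (subst (1 ≤_) (c-sym v s) (L′.c-Uv us)) (subst (1 ≤_) (c-sym v′ s) (R′.c-Uv us))
  ... | inj₂ (inj₁ as) rewrite ⟦⟧-no (U? s) (λ us → L.U-A⁺ us as) | ⟦⟧-yes (L.A⁺? s) as | ⟦⟧-no (L.B⁺? s) (L.disjoint as)
                             | R.extra-A-outside (L.disjoint as) =
    ≤-trans (≤-reflexive (shuffle β (L.extra-A s))) (L.cost-A as)
    where
    shuffle : ∀ x y → x + 0 + y + 0 ≡ x + y
    shuffle = solve-∀
  ... | inj₂ (inj₂ bs) rewrite ⟦⟧-no (U? s) (λ us → L.U-B⁺ us bs) | ⟦⟧-no (L.A⁺? s) (λ as → L.disjoint as bs) | ⟦⟧-yes (L.B⁺? s) bs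
                             | L.extra-A-outside (λ as → L.disjoint as bs) =
    ≤-trans (≤-reflexive (cong (_+ R.extra-A s) (+-identityʳ α))) (R.cost-A bs)

  total-weight : ∑ weight ≡ p * 2 + (α * β + (p + 4) + (β * α + (p + 4)))
  total-weight = trans (∑-+ _ _) (cong₂ _+_ (∑-*ʳ _ 2) (trans (∑-+ _ _) (cong₂ _+_
    (trans (∑-+ _ _) (cong₂ _+_ (∑-*ʳ _ β) L.extra-A-total))
    (trans (∑-+ _ _) (cong₂ _+_ (∑-*ʳ _ α) R.extra-A-total)))))

  order : n ≤ p + (α + β)
  order = begin
    n                          ≡⟨ trans (∑-const n 1) (*-identityʳ n) ⟨
    ∑ {n} (λ _ → 1)            ≤⟨ ∑-mono pointwise ⟩
    ∑ (λ s → ⟦ U? s ⟧ + (⟦ L.A⁺? s ⟧ + ⟦ L.B⁺? s ⟧)) ≡⟨ trans (∑-+ _ _) (cong (λ t → p + t) (∑-+ _ _)) ⟩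
    p + (α + β)                ∎
    where
    open ≤-Reasoning
    pointwise : ∀ s → 1 ≤ ⟦ U? s ⟧ + (⟦ L.A⁺? s ⟧ + ⟦ L.B⁺? s ⟧)
    pointwise s with cover s
    ... | inj₁ us rewrite ⟦⟧-yes (U? s) us = s≤s z≤n
    ... | inj₂ (inj₁ as) rewrite ⟦⟧-yes (L.A⁺? s) as = ≤-trans (m≤m+n 1 ⟦ L.B⁺? s ⟧) (m≤n+m _ ⟦ U? s ⟧)
    ... | inj₂ (inj₂ bs) rewrite ⟦⟧-yes (L.B⁺? s) bs = ≤-trans (m≤n+m 1 ⟦ L.A⁺? s ⟧) (m≤n+m _ ⟦ U? s ⟧)

  two≤ : {P : Fin n → Set} (P? : Decidable P) {x y : Fin n} → x ≢ y → P x → P y → 2 ≤ ∑ λ t → ⟦ P? t ⟧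
  two≤ P? {x} {y} x≢y px py = ≤-trans (≤-reflexive (sym (cong₂ (λ i j → i + (j + 0)) (⟦⟧-yes (P? x) px) (⟦⟧-yes (P? y) py))))
    (sumᴸ≤∑ (λ t → ⟦ P? t ⟧) {x ∷ y ∷ []} ((x≢y ∷ []) ∷ [] ∷ []))

  4n≤total : 4 * n ≤ total
  4n≤total = begin
    4 * n                        ≤⟨ *-monoʳ-≤ 4 order ⟩
    4 * (p + (α + β))            ≤⟨ inequality p α β (two≤ L.A⁺? (L′.A≢a Av ∘ sym) (inj₁ refl) (inj₂ Av)) (two≤ L.B⁺? (R′.A≢a Bv′ ∘ sym) (inj₁ refl) (inj₂ Bv′)) ⟩
    p * 2 + (α * β + (p + 4) + (β * α + (p + 4))) ≡⟨ total-weight ⟨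
    ∑ weight                     ≤⟨ ∑-mono weight≤cost ⟩
    total                        ∎
    where
    open ≤-Reasoning
    -- For sides of 2 + i and 2 + j vertices the weights exceed four times the order by 2 i j, so
    -- nothing is left over when one side has just two.
    identity : ∀ p i j → 4 * (p + (2 + i + (2 + j))) + 2 * (i * j) ≡ p * 2 + ((2 + i) * (2 + j) + (p + 4) + ((2 + j) * (2 + i) + (p + 4)))
    identity = solve-∀
    inequality : ∀ p α β → 2 ≤ α → 2 ≤ β → 4 * (p + (α + β)) ≤ p * 2 + (α * β + (p + 4) + (β * α + (p + 4)))
    inequality p (suc (suc i)) (suc (suc j)) _ _ = m+n≤o⇒m≤o _ (≤-reflexive (identity p i j))
    inequality p (suc zero) _ (s≤s ()) _
    inequality p (suc (suc i)) (suc zero) _ (s≤s ())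

-- A vertex of cost two whose neighbours form a clique

module Simplicial {m : ℕ} {G : Graph (2+ m)} (D : Distances G) (tc : TwoConnected G) {u : Fin (2+ m)}
                  (cost≡2 : Metric.cost D u ≡ 2) (clique : ∀ {y y′} → Adj G u y → Adj G u y′ → y ≢ y′ → Adj G y y′) where
  open Metric D
  open Detours D
  open Exits D tc
  open Costs D tc
  open Candidates D tc

  poor : cost u ≤ 3
  poor = ≤-trans (≤-reflexive cost≡2) (n≤1+n 2)
  open Poor poor

  over : ∀ {A : Set} → 3 ≤ cost u → A
  over three = contradiction (subst (3 ≤_) cost≡2 three) λ { (s≤s (s≤s ())) }

  dom : ∀ {a y} → C y → Parent y a → (∀ b → Parent y b → b ≡ a) → Dom u a y
  dom cy pa sole = subst₂ _<_ (sym (adj⇒1 (proj₁ pa))) (sym cy) ≤-refl , λ s ds bs →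
    sole s (1⇒adj (trans ds (adj⇒1 (proj₁ pa))) , 1⇒adj (suc-injective (trans (cong (_+ d s _) (sym (trans ds (adj⇒1 (proj₁ pa))))) (trans bs cy))))

  sole-parent : ∀ {y} → C y → c u y ≤ 1 → ∃ λ a → Parent y a × (∀ b → Parent y b → b ≡ a)
  sole-parent {y} cy le with parent cy
  ... | a , pa = a , pa , λ b pb → decidable-stable (b ≟ a) λ b≢a → <⇒≱ (two-parents cy pb pa b≢a) le

  -- The only kind of exit that a cost of two permits: horizontal and on level two. A descending
  -- exit would already cost four.
  record Crossing (a : Fin (2+ m)) : Set where
    field
      {v v′ b} : Fin (2+ m)
      Cv     : C v
      Cv′    : C v′
      v~v′   : v ~ v′
      pv     : Parent v a
      solev  : ∀ t → Parent v t → t ≡ a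
      pv′    : Parent v′ b
      b≢a    : b ≢ a
      pos    : 1 ≤ c u v
      pos′   : 1 ≤ c u v′

  exit⇒crossing : ∀ {a} → u ~ a → Exit u a → Crossing a
  exit⇒crossing ua (descending v b eq _ one three) = over (≤-trans (n≤1+n 3)
    (cost-two {i = 1} {j = 3} (λ x → 1+n≰n (≤-reflexive (trans (sym eq) (cong (d u) (sym x))))) one three))
  exit⇒crossing {a} u~a (horizontal v v′ s e eq Dv _ ds bs s≢a p q _) = record
    { Cv = cv ; Cv′ = cv′ ; v~v′ = e ; pv = pv
    ; solev = λ t pt → proj₂ Dv t (trans (adj⇒1 (proj₁ pt)) (sym ua)) (trans (cong₂ _+_ (adj⇒1 (proj₁ pt)) (adj⇒1 (proj₂ pt))) (sym cv))
    ; pv′ = 1⇒adj us , 1⇒adj sv′ ; b≢a = s≢a ; pos = ≤-trans (≤-reflexive (sym sv′)) p ; pos′ = q }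
    where
    ua : d u a ≡ 1
    ua = adj⇒1 u~a
    us : d u s ≡ 1
    us = trans ds ua
    cv : C v
    cv = ≤-antisym (ecc v) (subst (_< d u v) ua (proj₁ Dv))
    cv′ : C v′
    cv′ = trans (sym eq) cv
    sv′ : d s v′ ≡ 1
    sv′ = suc-injective (trans (cong (_+ d s v′) (sym us)) (trans bs cv′))
    pv : Parent v a
    pv = u~a , 1⇒adj (suc-injective (trans (cong (_+ d a v) (sym ua)) (trans (dom⇒between Dv) cv)))

  crossing : ∀ {a y} → C y → Parent y a → (∀ b → Parent y b → b ≡ a) → Crossing a
  crossing cy pa sole = exit⇒crossing (proj₁ pa) (leave (~⇒≢ (proj₁ pa)) (dom cy pa sole))

  -- Here `x` takes up the whole cost. Another vertex of level two would lead to a crossing, whose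
  -- vertex `v` has a sole parent, differs from `x` and costs one more. So `x` is alone on its
  -- level, the rest is a clique, and a third neighbour of `x` would be a third parent.
  fork⇒exceptional : ∀ {x p p′} → C x → Parent x p → Parent x p′ → p ≢ p′ → Exceptional′ G
  fork⇒exceptional {x} {p} {p′} cx pp pp′ p≢p′ = x , full , inj₁ small
    where
    two : 2 ≤ c u x
    two = two-parents cx pp pp′ p≢p′
    elsewhere : ∀ {a} → Crossing a → ⊥
    elsewhere χ = over (cost-two {i = 1} {j = 2} (λ { refl → p≢p′ (trans (Crossing.solev χ p pp) (sym (Crossing.solev χ p′ pp′))) }) (Crossing.pos χ) two)
    only : ∀ y → C y → y ≡ x
    only y cy with y ≟ x
    ... | yes eq = eq
    ... | no y≢x with sole-parent cy (≮⇒≥ λ 2≤ → cheap (cost-two {i = 2} {j = 2} y≢x 2≤ two))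
    ...   | a , pa , sole = ⊥-elim (elsewhere (crossing cy pa sole))
    near : ∀ {y} → y ≢ x → y ≢ u → u ~ y
    near y≢x y≢u = decidable-stable (adj? G u _) λ u≁y → y≢x (only _ (inC y≢u u≁y))
    full : AllAdjacentExcept G x
    full {v} {w} v≢x w≢x v≢w with v ≟ u | w ≟ u
    ... | yes refl | _ = near w≢x (v≢w ∘ sym)
    ... | no v≢u | yes refl = ~-sym (near v≢x v≢u)
    ... | no v≢u | no w≢u = clique (near v≢x v≢u) (near w≢x w≢u) v≢w
    small : degree G x ≤ 2
    small = ≤-trans (∑-mono pointwise) (≤-reflexive (trans (∑-+ _ _) (cong₂ _+_ (∑-δ p) (∑-δ p′))))
      where
      pointwise : ∀ t → ⟦ adj? G x t ⟧ ≤ ⟦ t ≟ p ⟧ + ⟦ t ≟ p′ ⟧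
      pointwise t with adj? G x t
      ... | no _ = z≤n
      ... | yes e with t ≟ p | t ≟ p′
      ...   | yes _ | _ = s≤s z≤n
      ...   | no _ | yes _ = s≤s z≤n
      ...   | no t≢p | no t≢p′ = cheap (cost-one (three-parents cx pp pp′ (u~t , ~-sym e) p≢p′ (t≢p ∘ sym) (t≢p′ ∘ sym)))
        where
        u~t : u ~ t
        u~t = near (~⇒≢ (~-sym e)) λ { refl → C⇒≁ cx (~-sym e) }

  module TwoClasses (soles : ∀ {y} → C y → ∃ λ a → Parent y a × (∀ b → Parent y b → b ≡ a)) {a} (χ : Crossing a) where
    open Crossing χ

    -- The two ends of the crossing exhaust the cost of two.
    idle : ∀ {y} → 1 ≤ c u y → y ≡ v ⊎ y ≡ v′
    idle {y} one with y ≟ v | y ≟ v′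
    ... | yes eq | _ = inj₁ eq
    ... | no _ | yes eq = inj₂ eq
    ... | no y≢v | no y≢v′ = over (≤-trans (+-mono-≤ one (+-mono-≤ pos (≤-trans pos′ (m≤m+n _ 0))))
        (vertices≤cost u {y ∷ v ∷ v′ ∷ []} ((y≢v ∷ y≢v′ ∷ []) ∷ (~⇒≢ v~v′ ∷ []) ∷ [] ∷ [])))

    same : ∀ {y p q} → C y → Parent y p → Parent y q → p ≡ q
    same cy pp pq with soles cy
    ... | _ , _ , sole = trans (sole _ pp) (sym (sole _ pq))

    -- A crossing at `q` has to charge `v` or `v′` again, and their sole parents are `a` and `b`.
    side′ : ∀ {y q} → Crossing q → Parent y q → Parent y a ⊎ Parent y b
    side′ {y} {q} χ′ pq with idle (Crossing.pos χ′)
    ... | inj₁ eq = inj₁ (subst (Parent y) (same Cv (subst (λ t → Parent t q) eq (Crossing.pv χ′)) pv) pq)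
    ... | inj₂ eq = inj₂ (subst (Parent y) (same Cv′ (subst (λ t → Parent t q) eq (Crossing.pv χ′)) pv′) pq)

    side : ∀ {y} → C y → Parent y a ⊎ Parent y b
    side cy with soles cy
    ... | q , pq , sole = side′ (crossing cy pq sole) pq

    A B U : Fin (2+ m) → Set
    A y = C y × a ~ y
    B y = C y × b ~ y
    U y = (y ≡ u ⊎ u ~ y) × y ≢ a × y ≢ b

    u~a : u ~ a
    u~a = proj₁ pv

    u~b : u ~ b
    u~b = proj₁ pv′

    U∌C : ∀ {t} → U t → ¬ C t
    U∌C (inj₁ refl , _) ct = C⇒≢ ct refl
    U∌C (inj₂ e , _) ct = C⇒≁ ct e

    nbr : ∀ {x t} → C x → x ~ t → Parent x t ⊎ C t
    nbr {x} {t} cx e with t ≟ u | adj? G u t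
    ... | yes refl | _ = contradiction (~-sym e) (C⇒≁ cx)
    ... | no _ | yes f = inj₁ (f , ~-sym e)
    ... | no t≢u | no ¬f = inj₂ (inC t≢u ¬f)

    -- Neither end is adjacent to the parent of the other, so both ends have a cross edge and hence
    -- positive excess.
    AB : ∀ {x y} → A x → B y → x ~ y → x ≡ v × y ≡ v′
    AB {x} {y} (cx , ax) (cy , by) e with idle (one-cross cx (cy , e , (u~b , by) , λ bx → b≢a (same cx (u~b , bx) (u~a , ax))))
                                         | idle (one-cross cy (cx , ~-sym e , (u~a , ax) , λ ay → b≢a (same cy (u~b , by) (u~a , ay))))
    ... | inj₁ eq | inj₂ eq′ = eq , eq′
    ... | inj₁ refl | inj₁ refl = contradiction refl (~⇒≢ e)
    ... | inj₂ refl | _ = contradiction (same Cv′ pv′ (u~a , ax)) b≢a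

    θ : TwoBridges G A B U a b v v′
    θ = record
      { a~b = clique u~a u~b (b≢a ∘ sym) ; v~v′ = v~v′ ; Av = Cv , proj₂ pv ; Bv′ = Cv′ , proj₂ pv′
      ; A~a = proj₂ ; B~b = proj₂
      ; A≁b = λ (cx , ax) bx → b≢a (same cx (u~b , bx) (u~a , ax))
      ; B≁a = λ (cx , bx) ax → b≢a (same cx (u~b , bx) (u~a , ax))
      ; A≢b = λ { (cx , _) refl → C⇒≁ cx u~b } ; B≢a = λ { (cx , _) refl → C⇒≁ cx u~a }
      ; AB = AB
      ; nbrA = λ (cx , ax) e → [ (λ pt → inj₁ (same cx pt (u~a , ax)))
          , (λ ct → inj₂ ([ (λ p → inj₁ (ct , proj₂ p)) , (λ p → inj₂ (ct , proj₂ p)) ]′ (side ct))) ]′ (nbr cx e)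
      ; nbrB = λ (cx , bx) e → [ (λ pt → inj₁ (same cx pt (u~b , bx)))
          , (λ ct → inj₂ ([ (λ p → inj₂ (ct , proj₂ p)) , (λ p → inj₁ (ct , proj₂ p)) ]′ (side ct))) ]′ (nbr cx e)
      ; U~a = λ { (inj₁ refl , _) → u~a ; (inj₂ e , t≢a , _) → clique e u~a t≢a }
      ; U~b = λ { (inj₁ refl , _) → u~b ; (inj₂ e , _ , t≢b) → clique e u~b t≢b }
      ; U≢a = proj₁ ∘ proj₂ ; U≢b = proj₂ ∘ proj₂
      ; U-A = λ ut (ct , _) → U∌C ut ct ; U-B = λ ut (ct , _) → U∌C ut ct
      }

    cover : ∀ x → U x ⊎ (x ≡ a ⊎ A x) ⊎ (x ≡ b ⊎ B x)
    cover x with x ≟ a | x ≟ b | x ≟ u | adj? G u x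
    ... | yes eq | _ | _ | _ = inj₂ (inj₁ (inj₁ eq))
    ... | no _ | yes eq | _ | _ = inj₂ (inj₂ (inj₁ eq))
    ... | no x≢a | no x≢b | yes eq | _ = inj₁ (inj₁ eq , x≢a , x≢b)
    ... | no x≢a | no x≢b | no _ | yes e = inj₁ (inj₂ e , x≢a , x≢b)
    ... | no _ | no _ | no x≢u | no ¬e = inj₂ ([ (λ p → inj₁ (inj₂ (cx , proj₂ p))) , (λ p → inj₂ (inj₂ (cx , proj₂ p))) ]′ (side cx))
      where
      cx : C x
      cx = inC x≢u ¬e

    4n≤total : 4 * (2+ m) ≤ total
    4n≤total = BridgeTotal.4n≤total D tc θ (λ y → C? y ×-dec adj? G a y) (λ y → C? y ×-dec adj? G b y)
      (λ y → (y ≟ u ⊎-dec adj? G u y) ×-dec ¬? (y ≟ a) ×-dec ¬? (y ≟ b)) cover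

  simplicial : ∀ {w} → w ≢ u → ¬ u ~ w → Exceptional′ G ⊎ 4 * (2+ m) ≤ total
  simplicial {w} w≢u u≁w with any? (λ x → any? (λ p → any? (λ p′ → C? x ×-dec parent? x p ×-dec parent? x p′ ×-dec ¬? (p ≟ p′))))
  ... | yes (x , p , p′ , cx , pp , pp′ , p≢p′) = inj₁ (fork⇒exceptional cx pp pp′ p≢p′)
  ... | no none = inj₂ (start (soles (inC w≢u u≁w)))
    where
    soles : ∀ {y} → C y → ∃ λ a → Parent y a × (∀ b → Parent y b → b ≡ a)
    soles {y} cy with parent cy
    ... | a , pa = a , pa , λ b pb → decidable-stable (b ≟ a) λ b≢a → none (y , b , a , cy , pb , pa , b≢a)
    conclude : ∀ {a} → Crossing a → 4 * (2+ m) ≤ total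
    conclude χ = TwoClasses.4n≤total soles χ
    start : (∃ λ a → Parent w a × (∀ b → Parent w b → b ≡ a)) → 4 * (2+ m) ≤ total
    start (a , pa , sole) = conclude (crossing (inC w≢u u≁w) pa sole)

-- Common neighbours and the cost of a vertex

degree≥2 : {G : Graph n} → TwoConnected G → ∀ x → 2 ≤ degree G x
degree≥2 {n} {G} tc x with fresh (x ∷ []) (≤-trans (s≤s (s≤s z≤n)) (TwoConnected.order≥3 tc))
... | y , y≢x ∷ [] with fresh (x ∷ y ∷ []) (TwoConnected.order≥3 tc)
... | y′ , y′≢x ∷ y′≢y ∷ [] with exit tc y (_≟ x) (y≢x ∘ sym) y′≢y refl y′≢x
... | _ , a , e , refl , a≢x , _ with fresh (x ∷ a ∷ []) (TwoConnected.order≥3 tc)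
... | t , t≢x ∷ t≢a ∷ [] with exit tc a (_≟ x) (a≢x ∘ sym) t≢a refl t≢x
... | _ , b , f , refl , _ , _ , b≢a =
  ≤-trans (≤-reflexive (sym (cong₂ (λ i j → i + (j + 0)) (⟦⟧-yes (adj? G x a) e) (⟦⟧-yes (adj? G x b) f))))
    (sumᴸ≤∑ (λ v → ⟦ adj? G x v ⟧) {a ∷ b ∷ []} (((b≢a ∘ sym) ∷ []) ∷ [] ∷ []))

∑-select : (x : Fin n) (h : Fin n → ℕ) → ∑ (λ v → ⟦ v ≟ x ⟧ * h v) ≡ h x
∑-select x h = trans (∑-cong same) (trans (∑-*ʳ (λ v → ⟦ v ≟ x ⟧) (h x)) (trans (cong (_* h x) (∑-δ x)) (+-identityʳ _)))
  where
  same : ∀ v → ⟦ v ≟ x ⟧ * h v ≡ ⟦ v ≟ x ⟧ * h x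
  same v with v ≟ x
  ... | yes refl = refl
  ... | no _ = refl

module Neighbourhood {n : ℕ} {G : Graph n} (D : Distances G) (x : Fin n) where
  open Metric D
  open Detours D

  t : ℕ
  t = degree G x

  Non : Fin n → Set
  Non w = w ≢ x × ¬ x ~ w

  non? : Decidable Non
  non? w = ¬? (w ≟ x) ×-dec ¬? (adj? G x w)

  s : ℕ
  s = ∑ λ w → ⟦ non? w ⟧

  order : 1 + (t + s) ≡ n
  order = begin
    1 + (t + s)                                          ≡⟨ cong (_+ (t + s)) (∑-δ x) ⟨
    ∑ (λ v → ⟦ v ≟ x ⟧) + (t + s)                        ≡⟨ cong (λ k → ∑ (λ v → ⟦ v ≟ x ⟧) + k) (∑-+ _ _) ⟨
    ∑ (λ v → ⟦ v ≟ x ⟧) + ∑ (λ v → ⟦ adj? G x v ⟧ + ⟦ non? v ⟧) ≡⟨ ∑-+ _ _ ⟨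
    ∑ (λ v → ⟦ v ≟ x ⟧ + (⟦ adj? G x v ⟧ + ⟦ non? v ⟧))  ≡⟨ ∑-cong one ⟩
    ∑ {n} (λ _ → 1)                                      ≡⟨ trans (∑-const n 1) (*-identityʳ n) ⟩
    n                                                    ∎
    where
    open ≡-Reasoning
    one : ∀ v → ⟦ v ≟ x ⟧ + (⟦ adj? G x v ⟧ + ⟦ non? v ⟧) ≡ 1
    one v with v ≟ x | adj? G x v
    ... | yes refl | yes e = contradiction refl (~⇒≢ e)
    ... | yes refl | no _ = refl
    ... | no _ | yes _ = refl
    ... | no _ | no _ = refl

  common? : ∀ w v → Dec (x ~ v × v ~ w)
  common? w v = adj? G x v ×-dec adj? G v w

  codegree : Fin n → ℕ
  codegree w = ∑ λ v → ⟦ common? w v ⟧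

  -- Each common neighbour lies on a path of length two with both edges good. The function `h` makes
  -- room for further good edges, and its conditions keep it off the edges from `x` and the edges
  -- into `w`.
  common-edges : ∀ {w} → Non w → (h : Edge → ℕ) → (∀ e → h e ≤ ⟦ good? x w e ⟧) → (∀ q → h (x , q) ≡ 0) → (∀ p → h (p , w) ≡ 0) →
                 2 * codegree w + ∑∑ h ≤ g x w
  common-edges {w} (w≢x , x≁w) h h≤ hx hw = begin
    2 * codegree w + ∑∑ h                             ≡⟨ cong (λ k → codegree w + k + ∑∑ h) (+-identityʳ _) ⟩
    codegree w + codegree w + ∑∑ h                    ≡⟨ cong₂ (λ i j → i + j + ∑∑ h) first second ⟨
    ∑∑ out + ∑∑ into + ∑∑ h                           ≡⟨ cong (_+ ∑∑ h) (∑∑-+ out into) ⟨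
    ∑∑ (λ e → out e + into e) + ∑∑ h                  ≡⟨ ∑∑-+ _ h ⟨
    ∑∑ (λ e → out e + into e + h e)                   ≤⟨ ∑∑-mono (uncurry pointwise) ⟩
    g x w                                             ∎
    where
    open ≤-Reasoning
    out into : Edge → ℕ
    out (p , q) = ⟦ p ≟ x ⟧ * ⟦ common? w q ⟧
    into (p , q) = ⟦ q ≟ w ⟧ * ⟦ common? w p ⟧
    first : ∑∑ out ≡ codegree w
    first = trans (∑-comm (λ p q → out (p , q))) (∑-cong λ q → ∑-select x (λ _ → ⟦ common? w q ⟧))
    second : ∑∑ into ≡ codegree w
    second = ∑-cong λ p → ∑-select w (λ _ → ⟦ common? w p ⟧)
    zero<one : ∀ {s t} → s ~ t → d s s < d s t
    zero<one {s} e = subst₂ _<_ (sym (d0 s)) (sym (adj⇒1 e)) (s≤s z≤n)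
    one<two : ∀ {s t r} → s ~ t → s ≢ r → ¬ s ~ r → d s t < d s r
    one<two e s≢r s≁r = subst (_< d _ _) (sym (adj⇒1 e)) (d≥2 s≢r s≁r)
    pointwise : ∀ p q → out (p , q) + into (p , q) + h (p , q) ≤ ⟦ good? x w (p , q) ⟧
    pointwise p q with p ≟ x | q ≟ w
    ... | no _ | no _ = h≤ (p , q)
    ... | yes refl | yes refl rewrite hx q | ⟦⟧-no (common? q q) (λ (e , _) → x≁w e) | ⟦⟧-no (common? q p) (λ (e , _) → ~⇒≢ e refl) = z≤n
    ... | yes refl | no _ rewrite hx q | +-identityʳ ⟦ common? w q ⟧ | +-identityʳ ⟦ common? w q ⟧ | +-identityʳ ⟦ common? w q ⟧ =
      ⟦⟧-mono (common? w q) (good? p w (p , q)) λ (e , f) → e , zero<one e , one<two (~-sym f) w≢x (x≁w ∘ ~-sym)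
    ... | no _ | yes refl rewrite hw p | +-identityʳ ⟦ common? q p ⟧ | +-identityʳ ⟦ common? q p ⟧ =
      ⟦⟧-mono (common? q p) (good? x q (p , q)) λ (e , f) → f , one<two e (w≢x ∘ sym) x≁w , zero<one (~-sym f)

  two-codegree : ∀ {w} → Non w → 2 * codegree w ≤ 2 + c x w
  two-codegree {w} nw with any? (common? w)
  ... | no none = ≤-trans (≤-reflexive (cong (2 *_) empty)) z≤n
    where
    empty : codegree w ≡ 0
    empty = trans (∑-cong λ v → ⟦⟧-no (common? w v) (λ cv → none (v , cv))) (trans (∑-const n 0) (*-zeroʳ n))
  ... | yes (v , e , f) = begin
    2 * codegree w                      ≡⟨ +-identityʳ _ ⟨
    2 * codegree w + 0                  ≡⟨ cong (λ k → 2 * codegree w + k) (trans (∑-cong λ _ → trans (∑-const n 0) (*-zeroʳ n)) (trans (∑-const n 0) (*-zeroʳ n))) ⟨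
    2 * codegree w + ∑∑ {n} (λ _ → 0)   ≤⟨ common-edges nw (λ _ → 0) (λ _ → z≤n) (λ _ → refl) (λ _ → refl) ⟩
    g x w                               ≡⟨ d+c≡g x w ⟨
    d x w + c x w                       ≡⟨ cong (_+ c x w) (d≡2 (proj₁ nw ∘ sym) (proj₂ nw) e f) ⟩
    2 + c x w                           ∎
    where open ≤-Reasoning

  two-codegree-extra : ∀ {w p q v} → Non w → Good x w (p , q) → p ≢ x → q ≢ w → x ~ v → v ~ w → 2 * codegree w + 1 ≤ 2 + c x w
  two-codegree-extra {w} {p} {q} nw gd p≢x q≢w e f = begin
    2 * codegree w + 1        ≡⟨ cong (λ k → 2 * codegree w + k) total-one ⟨
    2 * codegree w + ∑∑ h     ≤⟨ common-edges nw h h≤ (λ q′ → zero-left q′) (λ p′ → zero-right p′) ⟩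
    g x w                     ≡⟨ d+c≡g x w ⟨
    d x w + c x w             ≡⟨ cong (_+ c x w) (d≡2 (proj₁ nw ∘ sym) (proj₂ nw) e f) ⟩
    2 + c x w                 ∎
    where
    open ≤-Reasoning
    h : Edge → ℕ
    h (p′ , q′) = ⟦ p′ ≟ p ⟧ * ⟦ q′ ≟ q ⟧
    total-one : ∑∑ h ≡ 1
    total-one = trans (∑-comm (λ p′ q′ → h (p′ , q′))) (trans (∑-cong λ q′ → ∑-select p (λ _ → ⟦ q′ ≟ q ⟧)) (∑-δ q))
    zero-left : ∀ q′ → h (x , q′) ≡ 0
    zero-left q′ rewrite ⟦⟧-no (x ≟ p) (p≢x ∘ sym) = refl
    zero-right : ∀ p′ → h (p′ , w) ≡ 0
    zero-right p′ rewrite ⟦⟧-no (w ≟ q) (q≢w ∘ sym) = *-zeroʳ ⟦ p′ ≟ p ⟧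
    h≤ : ∀ e → h e ≤ ⟦ good? x w e ⟧
    h≤ (p′ , q′) with p′ ≟ p | q′ ≟ q
    ... | yes refl | yes refl = ≤-reflexive (sym (⟦⟧-yes (good? x w (p , q)) gd))
    ... | yes refl | no _ = z≤n
    ... | no _ | _ = z≤n

  full : ∀ {w} → Non w → (∀ {v} → x ~ v → v ~ w) → 2 * t ≤ 2 + c x w
  full {w} nw adj = ≤-trans (*-monoʳ-≤ 2 (∑-mono λ v → ⟦⟧-mono (adj? G x v) (common? w v) (λ e → e , adj e))) (two-codegree nw)

  degree≤ : ∀ {w} z → (∀ {v} → x ~ v → v ≢ z → v ~ w) → t ≤ codegree w + 1
  degree≤ {w} z adj = ≤-trans (∑-mono pointwise) (≤-reflexive (trans (∑-+ _ _) (cong (λ k → codegree w + k) (∑-δ z))))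
    where
    pointwise : ∀ v → ⟦ adj? G x v ⟧ ≤ ⟦ common? w v ⟧ + ⟦ v ≟ z ⟧
    pointwise v with v ≟ z
    ... | yes _ = ≤-trans (⟦⟧-mono (adj? G x v) (yes v) (λ _ → v)) (m≤n+m 1 ⟦ common? w v ⟧)
    ... | no v≢z = ≤-trans (⟦⟧-mono (adj? G x v) (common? w v) (λ e → e , adj e v≢z)) (m≤m+n ⟦ common? w v ⟧ 0)

  double : ∀ k → 2 * (k + 1) ≡ 2 * k + 2
  double = solve-∀

  almost : ∀ {w} z → Non w → (∀ {v} → x ~ v → v ≢ z → v ~ w) → 2 * t ≤ 4 + c x w
  almost {w} z nw adj = ≤-trans (*-monoʳ-≤ 2 (degree≤ z adj)) (≤-trans (≤-reflexive (trans (double (codegree w)) (+-comm _ 2)))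
    (+-monoʳ-≤ 2 (two-codegree nw)))

  -- The neighbour `z` that `w` may miss costs two units; one more good edge regains one of them.
  almost-extra : ∀ {w} z {p q v} → Non w → (∀ {v} → x ~ v → v ≢ z → v ~ w) → Good x w (p , q) → p ≢ x → q ≢ w → x ~ v → v ~ w →
                 2 * t ≤ 3 + c x w
  almost-extra {w} z nw adj gd p≢x q≢w e f = ≤-trans (*-monoʳ-≤ 2 (degree≤ z adj))
    (≤-trans (≤-reflexive (trans (double (codegree w)) (trans (sym (+-assoc (2 * codegree w) 1 1)) (+-comm _ 1))))
    (+-monoʳ-≤ 1 (two-codegree-extra nw gd p≢x q≢w e f)))

  -- `h` records how far single non-neighbours may fall short of `K`.
  sum-non : ∀ K (h : Fin n → ℕ) → (∀ {w} → Non w → K ≤ c x w + h w) → s * K ≤ cost x + ∑ h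
  sum-non K h le = ≤-trans (≤-reflexive (sym (∑-*ʳ _ K))) (≤-trans (∑-mono pointwise) (≤-reflexive (∑-+ _ _)))
    where
    pointwise : ∀ w → ⟦ non? w ⟧ * K ≤ c x w + h w
    pointwise w = bound (non? w)
      where
      bound : (δ : Dec (Non w)) → ⟦ δ ⟧ * K ≤ c x w + h w
      bound (yes nw) = ≤-trans (≤-reflexive (+-identityʳ K)) (le nw)
      bound (no _) = z≤n

  s≥1 : ∀ {w} → Non w → 1 ≤ s
  s≥1 {w} nw = ≤-trans (≤-reflexive (sym (⟦⟧-yes (non? w) nw))) (term≤∑ _ w)

  -- A non-neighbour shares all `t` neighbours with `x`, which makes 2 t good edges at distance two.
  star : AllAdjacentExcept G x → s * (2 * t ∸ 2) ≤ cost x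
  star clique = ≤-trans (sum-non (2 * t ∸ 2) (λ _ → 0) λ {w} nw →
      ≤-trans (m≤n+o⇒m∸n≤o _ 2 (full nw λ e → clique (~⇒≢ (~-sym e)) (proj₁ nw) λ { refl → proj₂ nw e })) (m≤m+n _ 0))
    (≤-reflexive (trans (cong (λ k → cost x + k) (trans (∑-const n 0) (*-zeroʳ n))) (+-identityʳ _)))

-- Inequalities between s, t and s (2 t - 2)

private
  -- With s = 1 + i and t = 2 + j.
  product : ∀ i j → (1 + i) * (2 * (2 + j) ∸ 2) ≡ 2 + 2 * (i + j) + 2 * (i * j)
  product i j = trans (cong (λ k → (1 + i) * (k ∸ 2)) (twice j)) (identity i j)
    where
    twice : ∀ j → 2 * (2 + j) ≡ 4 + 2 * j
    twice = solve-∀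
    identity : ∀ i j → (1 + i) * (2 + 2 * j) ≡ 2 + 2 * (i + j) + 2 * (i * j)
    identity = solve-∀

  size : ∀ i j → 1 + (2 + j + (1 + i)) ≡ 4 + (i + j)
  size = solve-∀

  -- The digit in `product≥2`, `product≥1`, `product≥1′` and `product≥0` is the value that `i + j`
  -- has to reach.
  product≥2 : ∀ {s t} → 1 ≤ s → 2 ≤ t → 6 ≤ 1 + (t + s) → s + t + 1 ≤ s * (2 * t ∸ 2)
  product≥2 {suc i} {suc (suc j)} _ _ six = ≤-trans (farkas (2 * (i * j)) (+-cancelˡ-≤ 4 2 _ (subst (6 ≤_) (size i j) six)) (identity i j))
    (≤-reflexive (sym (product i j)))
    where
    identity : ∀ i j → suc i + (2 + j) + 1 + (i + j) + 2 * (i * j) ≡ 2 + 2 * (i + j) + 2 * (i * j) + 2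
    identity = solve-∀
  product≥2 {suc i} {suc zero} _ (s≤s ()) _

  product≥1 : ∀ {s t} → 1 ≤ s → 2 ≤ t → 6 ≤ 2 + (t + s) → s + t ≤ s * (2 * t ∸ 2)
  product≥1 {suc i} {suc (suc j)} _ _ six = ≤-trans (farkas (2 * (i * j)) (+-cancelˡ-≤ 5 1 _ (subst (6 ≤_) (cong suc (size i j)) six)) (identity i j))
    (≤-reflexive (sym (product i j)))
    where
    identity : ∀ i j → suc i + (2 + j) + (i + j) + 2 * (i * j) ≡ 2 + 2 * (i + j) + 2 * (i * j) + 1
    identity = solve-∀
  product≥1 {suc i} {suc zero} _ (s≤s ()) _

  product≥1′ : ∀ {s t} → 1 ≤ s → 3 ≤ t → 6 ≤ 1 + (t + s) → s + t ≤ s * (2 * t ∸ 4) + 1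
  product≥1′ {suc i} {suc (suc (suc j))} _ _ six = ≤-trans (farkas (2 * (i * j)) (+-cancelˡ-≤ 5 1 _ (subst (6 ≤_) (size′ i j) six)) (identity i j))
    (≤-reflexive (sym (cong (λ k → (1 + i) * (k ∸ 4) + 1) (twice j))))
    where
    twice : ∀ j → 2 * (3 + j) ≡ 6 + 2 * j
    twice = solve-∀
    size′ : ∀ i j → 1 + (3 + j + (1 + i)) ≡ 5 + (i + j)
    size′ = solve-∀
    identity : ∀ i j → suc i + (3 + j) + (i + j) + 2 * (i * j) ≡ (1 + i) * (2 + 2 * j) + 1 + 1
    identity = solve-∀
  product≥1′ {suc i} {suc zero} _ (s≤s ()) _
  product≥1′ {suc i} {suc (suc zero)} _ (s≤s (s≤s ())) _

  product≥0 : ∀ {s t} → 1 ≤ s → 2 ≤ t → s + t ≤ s * (2 * t ∸ 3) + 1 + 1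
  product≥0 {suc i} {suc (suc j)} _ _ = m+n≤o⇒m≤o _ (≤-reflexive (trans (identity i j) (cong (λ k → (1 + i) * (k ∸ 3) + 1 + 1) (sym (twice j)))))
    where
    twice : ∀ j → 2 * (2 + j) ≡ 4 + 2 * j
    twice = solve-∀
    identity : ∀ i j → suc i + (2 + j) + (j + 2 * (i * j)) ≡ (1 + i) * (1 + 2 * j) + 1 + 1
    identity = solve-∀
  product≥0 {suc i} {suc zero} _ (s≤s ())

  -- The two sides agree for `s` = 1 or `t` = 2, which are the exceptional graphs with their gap 2 n
  -- - 6.
  product-order : ∀ {s t} → 1 ≤ s → 2 ≤ t → 2 * (1 + (t + s)) ≤ s * (2 * t ∸ 2) + 6
  product-order {suc i} {suc (suc j)} _ _ = m+n≤o⇒m≤o _ (≤-reflexive (trans (identity i j) (cong (_+ 6) (sym (product i j)))))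
    where
    identity : ∀ i j → 2 * (1 + (2 + j + suc i)) + 2 * (i * j) ≡ 2 + 2 * (i + j) + 2 * (i * j) + 6
    identity = solve-∀
  product-order {suc i} {suc zero} _ (s≤s ())

  -- Equality holds at `s` = 2 and `t` = 3, a graph of order six; this fixes the constant 20.
  product-large : ∀ {s t} → 2 ≤ s → 3 ≤ t → 6 * (1 + (t + s)) ≤ s * (2 * t ∸ 2) + s * (2 * t ∸ 2) + 20
  product-large {suc (suc i)} {suc (suc (suc j))} _ _ = m+n≤o⇒m≤o _ (≤-reflexive (trans (identity i j) (cong (λ k → k + k + 20) (sym (product (suc i) (suc j))))))
    where
    identity : ∀ i j → 6 * (1 + (3 + j + (2 + i))) + (2 * (i + j) + 4 * (i * j)) ≡
      2 + 2 * (suc i + suc j) + 2 * (suc i * suc j) + (2 + 2 * (suc i + suc j) + 2 * (suc i * suc j)) + 20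
    identity = solve-∀
  product-large {suc zero} (s≤s ()) _
  product-large {suc (suc i)} {suc zero} _ (s≤s ())
  product-large {suc (suc i)} {suc (suc zero)} _ (s≤s (s≤s ()))

-- Adding a vertex to an exceptional graph

module NearExceptional {m : ℕ} {G : Graph (2+ m)} (D : Distances G) (tc : TwoConnected G) (m≥3 : 3 ≤ m)
                       {a x : Fin (2+ m)} (dominates : Dominates G a x) (far : Farthest tc a x)
                       (unexceptional : ¬ Exceptional′ G) where
  open Metric D
  open Detours D
  open Totals D
  open Neighbourhood D x
  private
    module R = Removal D tc (≤-trans (n≤1+n 2) m≥3) dominates
    tc′ = R.twoConnected far
    module M′ = Metric R.distances
    p : Fin (suc m) → Fin (2+ m)
    p = punchIn x

  t≥2 : 2 ≤ t
  t≥2 = degree≥2 tc x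

  -- `G` is a K_n^t here, and being unexceptional it has at least three neighbours and two
  -- non-neighbours of `x`.
  clique⇒large : AllAdjacentExcept G x → 6 * (2+ m) ≤ total + 20
  clique⇒large clique = begin
    6 * (2+ m)                             ≡⟨ cong (6 *_) order ⟨
    6 * (1 + (t + s))                      ≤⟨ product-large s≥2 t≥3 ⟩
    s * (2 * t ∸ 2) + s * (2 * t ∸ 2) + 20 ≤⟨ +-monoˡ-≤ 20 (+-mono-≤ (star clique) (star clique)) ⟩
    cost x + cost x + 20                   ≤⟨ +-monoˡ-≤ 20 (2cost≤total x) ⟩
    total + 20                             ∎
    where
    open ≤-Reasoning
    t≥3 : 3 ≤ t
    t≥3 = ≰⇒> λ le → unexceptional (x , clique , inj₁ le)
    s≥2 : 2 ≤ s
    s≥2 = +-cancelˡ-≤ (1 + t) 2 s (≤-trans (≤-reflexive (+-comm (1 + t) 2)) (≤-trans (≰⇒> λ le → unexceptional (x , clique , inj₂ le)) (≤-reflexive (sym order))))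

  module _ (m≥4 : 4 ≤ m) {z′ : Fin (suc m)} (clique′ : AllAdjacentExcept (G ∖ x) z′) {q′ : Fin (suc m)} (q′≢z′ : q′ ≢ z′) (z′≁q′ : ¬ Adj (G ∖ x) z′ q′) where
    private
      module N′ = Neighbourhood R.distances z′

    z q : Fin (2+ m)
    z = p z′
    q = p q′

    z≢x : z ≢ x
    z≢x = punchInᵢ≢i x z′

    clique : ∀ {v w} → v ≢ x → w ≢ x → v ≢ z → w ≢ z → v ≢ w → v ~ w
    clique v≢x w≢x v≢z w≢z v≢w with punch-onto (v≢x ∘ sym) | punch-onto (w≢x ∘ sym)
    ... | v′ , refl | w′ , refl = clique′ (λ { refl → v≢z refl }) (λ { refl → w≢z refl }) (λ { refl → v≢w refl })

    -- The graph `G ∖ x` of order m + 1 has gap at least 2 (m + 1) - 6, and a cost of at least m for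
    -- `x` raises this to 3 (m + 2) - 10.
    enough : s + t ≤ cost x + 1 → 6 * (2+ m) ≤ total + 20
    enough le = begin
      6 * (2+ m)                                ≡⟨ expand (suc m) ⟩
      2 * (2 * suc m) + 2 * suc m + 6           ≤⟨ +-monoˡ-≤ 6 (+-mono-≤ (*-monoʳ-≤ 2 old) (*-monoʳ-≤ 2 new)) ⟩
      2 * (M′.cost z′ + 6) + 2 * (cost x + 1) + 6  ≡⟨ regroup (M′.cost z′) (cost x) ⟩
      M′.cost z′ + M′.cost z′ + (cost x + cost x) + 20  ≤⟨ +-monoˡ-≤ 20 (+-monoˡ-≤ (cost x + cost x) (Totals.2cost≤total R.distances z′)) ⟩
      M′.total + (cost x + cost x) + 20         ≤⟨ +-monoˡ-≤ 20 R.gain ⟩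
      total + 20                                ∎
      where
      open ≤-Reasoning
      expand : ∀ k → 6 * suc k ≡ 2 * (2 * k) + 2 * k + 6
      expand = solve-∀
      regroup : ∀ i j → 2 * (i + 6) + 2 * (j + 1) + 6 ≡ i + i + (j + j) + 20
      regroup = solve-∀
      old : 2 * suc m ≤ M′.cost z′ + 6
      old = ≤-trans (≤-reflexive (cong (2 *_) (sym N′.order))) (≤-trans (product-order (N′.s≥1 (q′≢z′ , z′≁q′)) (degree≥2 tc′ z′))
              (+-monoˡ-≤ 6 (N′.star clique′)))
      new : suc m ≤ cost x + 1
      new = ≤-trans (≤-reflexive (trans (sym (suc-injective order)) (+-comm t s))) le

    six : 6 ≤ 1 + (t + s)
    six = ≤-trans (s≤s (s≤s m≥4)) (≤-reflexive (sym order))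

    Non≢ : ∀ {v w} → Non w → x ~ v → v ≢ w
    Non≢ nw e refl = proj₂ nw e

    -- `G ∖ x` lacks only the edge between `z` and `q`, so at most one non-neighbour of `x` misses a
    -- neighbour of `x`, and it misses one only. The loss is two.
    co-edge : suc m ≤ 2 + degree (G ∖ x) z′ → 1 ≤ s → s + t ≤ cost x + 1
    co-edge le pos = +-cancelʳ-≤ 1 _ _ (begin
      s + t + 1                ≤⟨ product≥2 pos t≥2 six ⟩
      s * (2 * t ∸ 2)          ≤⟨ bound ⟩
      cost x + 2               ≡⟨ +-assoc (cost x) 1 1 ⟨
      cost x + 1 + 1           ∎)
      where
      open ≤-Reasoning
      s′≤1 : N′.s ≤ 1
      s′≤1 = +-cancelˡ-≤ (1 + N′.t) _ 1 (≤-trans (≤-reflexive N′.order) (≤-trans le (≤-reflexive (+-comm 1 (1 + N′.t)))))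
      z~ : ∀ {v} → v ≢ x → v ≢ z → v ≢ q → z ~ v
      z~ v≢x v≢z v≢q with punch-onto (v≢x ∘ sym)
      ... | v′ , refl = decidable-stable (adj? G z _) λ z≁v → 1+n≰n (≤-trans
        (≤-trans (≤-reflexive (sym (cong₂ (λ i j → i + (j + 0)) (⟦⟧-yes (N′.non? v′) ((λ { refl → v≢z refl }) , z≁v)) (⟦⟧-yes (N′.non? q′) (q′≢z′ , z′≁q′)))))
          (sumᴸ≤∑ (λ w → ⟦ N′.non? w ⟧) {v′ ∷ q′ ∷ []} (((λ { refl → v≢q refl }) ∷ []) ∷ [] ∷ []))) s′≤1)
      adjacent : ∀ {v w} → v ≢ x → w ≢ x → v ≢ w → ¬ (v ≡ z × w ≡ q) → ¬ (v ≡ q × w ≡ z) → v ~ w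
      adjacent {v} {w} v≢x w≢x v≢w ¬zq ¬qz with v ≟ z | w ≟ z
      ... | yes refl | yes refl = contradiction refl v≢w
      ... | yes refl | no w≢z = z~ w≢x w≢z λ w≡q → ¬zq (refl , w≡q)
      ... | no v≢z | yes refl = ~-sym (z~ v≢x v≢z λ v≡q → ¬qz (v≡q , refl))
      ... | no v≢z | no w≢z = clique v≢x w≢x v≢z w≢z v≢w
      K : ℕ
      K = 2 * t ∸ 2
      at : ∀ e o → (∀ {w} → Non w → w ≢ e → ∀ {v} → x ~ v → v ~ w) → (Non e → ∀ {v} → x ~ v → v ≢ o → v ~ e) → s * K ≤ cost x + 2
      at e o others here′ = ≤-trans (sum-non K (λ w → ⟦ w ≟ e ⟧ * 2) pointwise)
        (≤-reflexive (cong (λ k → cost x + k) (trans (∑-*ʳ (λ w → ⟦ w ≟ e ⟧) 2) (cong (_* 2) (∑-δ e)))))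
        where
        pointwise : ∀ {w} → Non w → K ≤ c x w + ⟦ w ≟ e ⟧ * 2
        pointwise {w} nw with w ≟ e
        ... | yes refl = ≤-trans (m≤n+o⇒m∸n≤o _ 2 (almost o nw (here′ nw))) (≤-reflexive (+-comm 2 (c x w)))
        ... | no w≢e = ≤-trans (m≤n+o⇒m∸n≤o _ 2 (full nw (others nw w≢e))) (m≤m+n _ 0)
      -- The defect is at `q`, which misses `z`, if `x` is adjacent to `z`, and otherwise at `z`,
      -- which misses `q`.
      bound : s * K ≤ cost x + 2
      bound with adj? G x z
      ... | yes x~z = at q z
        (λ nw w≢q e → adjacent (~⇒≢ (~-sym e)) (proj₁ nw) (Non≢ nw e) (λ (_ , w≡q) → w≢q w≡q) (λ { (_ , refl) → proj₂ nw x~z }))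
        (λ nw e v≢z → adjacent (~⇒≢ (~-sym e)) (proj₁ nw) (Non≢ nw e) (λ (v≡z , _) → v≢z v≡z) (λ { (_ , eq) → q′≢z′ (punchIn-injective x _ _ eq) }))
      ... | no x≁z = at z q
        (λ nw w≢z e → adjacent (~⇒≢ (~-sym e)) (proj₁ nw) (Non≢ nw e) (λ { (refl , _) → x≁z e }) (λ (_ , w≡z) → w≢z w≡z))
        (λ nw e v≢q → adjacent (~⇒≢ (~-sym e)) (proj₁ nw) (Non≢ nw e) (λ { (_ , eq) → q′≢z′ (punchIn-injective x _ _ (sym eq)) }) (λ (v≡q , _) → v≢q v≡q))

    -- All non-neighbours of `x` except `z` count in full. If `z` is the only one, then `x` belongs
    -- to the clique, and `G` is exceptional with special vertex `z`.
    apart : degree (G ∖ x) z′ ≤ 2 → ¬ x ~ z → s + t ≤ cost x + 1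
    apart le x≁z = count s refl
      where
      nz : Non z
      nz = z≢x , x≁z
      K : ℕ
      K = 2 * t ∸ 2
      bound : s * K ≤ cost x + K
      bound = ≤-trans (sum-non K (λ w → ⟦ w ≟ z ⟧ * K) pointwise)
        (≤-reflexive (cong (λ k → cost x + k) (trans (∑-*ʳ (λ w → ⟦ w ≟ z ⟧) K) (trans (cong (_* K) (∑-δ z)) (+-identityʳ K)))))
        where
        pointwise : ∀ {w} → Non w → K ≤ c x w + ⟦ w ≟ z ⟧ * K
        pointwise {w} nw with w ≟ z
        ... | yes refl = ≤-trans (≤-reflexive (sym (+-identityʳ K))) (m≤n+m _ (c x w))
        ... | no w≢z = ≤-trans (m≤n+o⇒m∸n≤o _ 2 (full nw λ e → clique (~⇒≢ (~-sym e)) (proj₁ nw) (λ { refl → x≁z e }) w≢z (Non≢ nw e))) (m≤m+n _ 0)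
      count : ∀ k → s ≡ k → s + t ≤ cost x + 1
      count zero eq = contradiction (subst (1 ≤_) eq (s≥1 nz)) λ ()
      count (suc zero) eq = ⊥-elim (unexceptional (z , full-clique , inj₁ small))
        where
        only : ∀ {w} → w ≢ x → w ≢ z → x ~ w
        only {w} w≢x w≢z = decidable-stable (adj? G x w) λ x≁w → 1+n≰n (≤-trans
          (≤-trans (≤-reflexive (sym (cong₂ (λ i j → i + (j + 0)) (⟦⟧-yes (non? w) (w≢x , x≁w)) (⟦⟧-yes (non? z) nz))))
            (sumᴸ≤∑ (λ w → ⟦ non? w ⟧) {w ∷ z ∷ []} ((w≢z ∷ []) ∷ [] ∷ []))) (≤-reflexive eq))
        full-clique : AllAdjacentExcept G z
        full-clique {v} {w} v≢z w≢z v≢w with v ≟ x | w ≟ x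
        ... | yes refl | _ = only (v≢w ∘ sym) w≢z
        ... | no v≢x | yes refl = ~-sym (only v≢x v≢z)
        ... | no v≢x | no w≢x = clique v≢x w≢x v≢z w≢z v≢w
        small : degree G z ≤ 2
        small = ≤-trans (≤-reflexive (trans (∑-punch x _) (cong (_+ degree (G ∖ x) z′) (⟦⟧-no (adj? G z x) (x≁z ∘ ~-sym))))) le
      count (suc (suc i)) eq = begin
        s + t               ≡⟨ cong (_+ t) eq ⟩
        suc (suc i + t)     ≤⟨ s≤s (product≥1 {suc i} {t} (s≤s z≤n) t≥2 (≤-trans six (≤-reflexive (trans (cong (λ k → 1 + (t + k)) eq) (cong suc (+-suc t (suc i))))))) ⟩
        suc (suc i * K)     ≤⟨ s≤s (+-cancelˡ-≤ K _ _ (≤-trans (≤-reflexive (cong (_* K) (sym eq))) (≤-trans bound (≤-reflexive (+-comm (cost x) K))))) ⟩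
        suc (cost x)        ≡⟨ +-comm 1 (cost x) ⟩
        cost x + 1          ∎
        where open ≤-Reasoning

    -- Each non-neighbour may miss `z` and lose two units. If all other neighbours of `z` are
    -- adjacent to `x`, they and `z` give `x` degree at least three, which compensates. If not, the
    -- edge from `z` to such a neighbour `b` is good wherever `z` is missed, and the loss is only
    -- one.
    joined : x ~ z → 1 ≤ s → s + t ≤ cost x + 1
    joined x~z pos with any? (λ b → ¬? (b ≟ x) ×-dec adj? G z b ×-dec ¬? (adj? G x b))
    ... | no none = ≤-trans (product≥1′ pos t≥3 six) (+-monoˡ-≤ 1 (≤-trans (sum-non (2 * t ∸ 4) (λ _ → 0) pointwise)
        (≤-reflexive (trans (cong (λ k → cost x + k) (trans (∑-const (2+ m) 0) (*-zeroʳ (2+ m)))) (+-identityʳ _)))))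
      where
      t≥3 : 3 ≤ t
      t≥3 = begin
        3                                                     ≤⟨ s≤s (degree≥2 tc′ z′) ⟩
        1 + degree (G ∖ x) z′                                  ≡⟨ cong (_+ degree (G ∖ x) z′) (∑-δ z′) ⟨
        ∑ (λ i → ⟦ i ≟ z′ ⟧) + degree (G ∖ x) z′               ≡⟨ ∑-+ _ _ ⟨
        ∑ (λ i → ⟦ i ≟ z′ ⟧ + ⟦ adj? G z (p i) ⟧)              ≤⟨ ∑-mono pointwise′ ⟩
        ∑ (λ i → ⟦ adj? G x (p i) ⟧)                           ≤⟨ m≤n+m _ ⟦ adj? G x x ⟧ ⟩
        ⟦ adj? G x x ⟧ + ∑ (λ i → ⟦ adj? G x (p i) ⟧)          ≡⟨ ∑-punch x (λ v → ⟦ adj? G x v ⟧) ⟨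
        t                                                     ∎
        where
        open ≤-Reasoning
        pointwise′ : ∀ i → ⟦ i ≟ z′ ⟧ + ⟦ adj? G z (p i) ⟧ ≤ ⟦ adj? G x (p i) ⟧
        pointwise′ i with i ≟ z′
        ... | yes refl rewrite ⟦⟧-no (adj? G z z) (λ e → ~⇒≢ e refl) | ⟦⟧-yes (adj? G x z) x~z = ≤-refl
        ... | no _ = ⟦⟧-mono (adj? G z (p i)) (adj? G x (p i)) λ e → decidable-stable (adj? G x (p i)) λ x≁ → none (p i , punchInᵢ≢i x i , e , x≁)
      pointwise : ∀ {w} → Non w → 2 * t ∸ 4 ≤ c x w + 0
      pointwise {w} nw = ≤-trans (m≤n+o⇒m∸n≤o _ 4 (almost z nw λ e v≢z → clique (~⇒≢ (~-sym e)) (proj₁ nw) v≢z (λ { refl → proj₂ nw x~z }) (Non≢ nw e))) (m≤m+n _ 0)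
    ... | yes (b , b≢x , z~b , x≁b) = ≤-trans (product≥0 pos t≥2) (+-monoˡ-≤ 1 bound)
      where
      K : ℕ
      K = 2 * t ∸ 3
      nb : Non b
      nb = b≢x , x≁b
      other : ∃ λ v → x ~ v × v ≢ z
      other with fresh (x ∷ z ∷ []) (s≤s (s≤s (≤-trans (s≤s z≤n) m≥4)))
      ... | y , y≢x ∷ y≢z ∷ [] with exit tc z (_≟ x) (z≢x ∘ sym) y≢z refl y≢x
      ... | _ , v , e , refl , _ , _ , v≢z = v , e , v≢z
      Non≢z : ∀ {w} → Non w → w ≢ z
      Non≢z nw refl = proj₂ nw x~z
      fully : ∀ {w} → Non w → z ~ w → 2 * t ≤ 2 + c x w
      fully {w} nw z~w = full nw adjacent
        where
        adjacent : ∀ {v} → x ~ v → v ~ w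
        adjacent {v} e with v ≟ z
        ... | yes refl = z~w
        ... | no v≢z = clique (~⇒≢ (~-sym e)) (proj₁ nw) v≢z (Non≢z nw) (Non≢ nw e)
      each : ∀ {w} → Non w → 2 * t ≤ 3 + c x w
      each {w} nw with adj? G z w
      ... | yes z~w = ≤-trans (fully nw z~w) (n≤1+n _)
      ... | no z≁w with other
      ...   | v , e , v≢z = almost-extra z {z} {b} nw (λ e′ v≢z → clique (~⇒≢ (~-sym e′)) (proj₁ nw) v≢z (Non≢z nw) (Non≢ nw e′))
              (z~b , subst (_< d x b) (sym (adj⇒1 x~z)) (d≥2 (b≢x ∘ sym) x≁b)
                   , subst (_< d w z) (sym (adj⇒1 w~b)) (d≥2 (Non≢z nw) (z≁w ∘ ~-sym)))
              z≢x (w≢b ∘ sym) e (clique (~⇒≢ (~-sym e)) (proj₁ nw) v≢z (Non≢z nw) (Non≢ nw e))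
        where
        w≢b : w ≢ b
        w≢b refl = z≁w z~b
        w~b : w ~ b
        w~b = clique (proj₁ nw) b≢x (Non≢z nw) (Non≢z nb) w≢b
      bound : s * K + 1 ≤ cost x
      bound = begin
        s * K + 1                                        ≡⟨ cong₂ _+_ (sym (∑-*ʳ _ K)) (sym (∑-δ b)) ⟩
        ∑ (λ w → ⟦ non? w ⟧ * K) + ∑ (λ w → ⟦ w ≟ b ⟧)   ≡⟨ ∑-+ _ _ ⟨
        ∑ (λ w → ⟦ non? w ⟧ * K + ⟦ w ≟ b ⟧)             ≤⟨ ∑-mono (λ w → pointwise w (non? w) (w ≟ b)) ⟩
        cost x                                           ∎
        where
        open ≤-Reasoning
        -- `b` is adjacent to `z` and loses nothing; this is the unit still needed.
        K+1 : K + 1 ≤ c x b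
        K+1 = ≤-trans (≤-reflexive (trans (+-comm K 1) (sym (+-∸-assoc 1 (≤-trans (n≤1+n 3) (*-monoʳ-≤ 2 t≥2)))))) (m≤n+o⇒m∸n≤o _ 2 (fully nb z~b))
        pointwise : ∀ w (δ : Dec (Non w)) (ε : Dec (w ≡ b)) → ⟦ δ ⟧ * K + ⟦ ε ⟧ ≤ c x w
        pointwise w (yes nw) (yes refl) = ≤-trans (≤-reflexive (cong (_+ 1) (+-identityʳ K))) K+1
        pointwise w (yes nw) (no _) = ≤-trans (≤-reflexive (trans (+-identityʳ (K + 0)) (+-identityʳ K))) (m≤n+o⇒m∸n≤o _ 3 (each nw))
        pointwise w (no ¬nw) (yes refl) = contradiction nb ¬nw
        pointwise w (no _) (no _) = z≤n

  complete⇒large : (∀ {i j} → i ≢ j → Adj (G ∖ x) i j) → 6 * (2+ m) ≤ total + 20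
  complete⇒large adjacent = clique⇒large λ {v} {w} v≢x w≢x v≢w → whole v≢x w≢x v≢w
    where
    whole : ∀ {v w} → v ≢ x → w ≢ x → v ≢ w → v ~ w
    whole v≢x w≢x v≢w with punch-onto (v≢x ∘ sym) | punch-onto (w≢x ∘ sym)
    ... | v′ , refl | w′ , refl = adjacent λ { refl → v≢w refl }

  near-exceptional : ∀ {w} → 4 ≤ m → x ≢ w → ¬ x ~ w → Exceptional′ (G ∖ x) → 6 * (2+ m) ≤ total + 20
  near-exceptional {w} m≥4 x≢w x≁w (z′ , clique′ , dg) with any? (λ q → ¬? (q ≟ z′) ×-dec ¬? (adj? (G ∖ x) z′ q))
  ... | yes (q , q≢z , z≁q) = enough m≥4 clique′ q≢z z≁q (main dg)
    where
    pos : 1 ≤ s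
    pos = s≥1 (x≢w ∘ sym , x≁w)
    main : degree (G ∖ x) z′ ≤ 2 ⊎ suc m ≤ 2 + degree (G ∖ x) z′ → s + t ≤ cost x + 1
    main (inj₂ le) = co-edge m≥4 clique′ q≢z z≁q le pos
    main (inj₁ le) with adj? G x (p z′)
    ... | yes e = joined m≥4 clique′ q≢z z≁q e pos
    ... | no ¬e = apart m≥4 clique′ q≢z z≁q le ¬e
  ... | no none = complete⇒large adjacent
    where
    z~ : ∀ {v} → v ≢ z′ → Adj (G ∖ x) z′ v
    z~ {v} v≢z = decidable-stable (adj? (G ∖ x) z′ v) λ z≁v → none (v , v≢z , z≁v)
    adjacent : ∀ {i j} → i ≢ j → Adj (G ∖ x) i j
    adjacent {i} {j} i≢j with i ≟ z′ | j ≟ z′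
    ... | yes refl | _ = z~ (i≢j ∘ sym)
    ... | no i≢z | yes refl = ~-sym (z~ i≢z)
    ... | no i≢z | no j≢z = clique′ i≢z j≢z i≢j

-- The induction

nonadjacent? : (G : Graph n) → Dec (∃₂ λ u v → u ≢ v × ¬ Adj G u v)
nonadjacent? G = any? λ u → any? λ v → ¬? (u ≟ v) ×-dec ¬? (adj? G u v)

all-adjacent : {G : Graph n} → ¬ (∃₂ λ u v → u ≢ v × ¬ Adj G u v) → ∀ {u v} → u ≢ v → Adj G u v
all-adjacent {G = G} none {u} {v} u≢v = decidable-stable (adj? G u v) λ u≁v → none (u , v , u≢v , u≁v)

exceptional′? : (G : Graph n) → Dec (Exceptional′ G)
exceptional′? {n} G = any? λ z → map′ (λ f {v} {w} → f v w) (λ f v w → f)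
    (all? λ v → all? λ w → ¬? (v ≟ z) →-dec ¬? (w ≟ z) →-dec ¬? (v ≟ w) →-dec adj? G v w)
  ×-dec (degree G z ≤? 2 ⊎-dec n ≤? 2 + degree G z)

complete⇒exceptional′ : {G : Graph (suc n)} → Distances G → (∀ {u v} → u ≢ v → Adj G u v) → Exceptional′ G
complete⇒exceptional′ {n} {G} D adjacent = zero , (λ _ _ → adjacent) , inj₂ (≤-trans (≤-reflexive (sym order)) (≤-trans (≤-reflexive (cong (λ k → 1 + (t + k)) none)) (≤-trans (≤-reflexive (cong suc (+-identityʳ t))) (n≤1+n _))))
  where
  open Neighbourhood D zero
  none : s ≡ 0
  none = trans (∑-cong λ w → ⟦⟧-no (non? w) (λ (w≢0 , 0≁w) → 0≁w (adjacent (w≢0 ∘ sym)))) (trans (∑-const (suc n) 0) (*-zeroʳ (suc n)))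

-- total is twice the gap, so this says that the gap is at least 3 n - 10 for n ≤ 10 and at least 2 n for n ≥ 10.

Bound : (n total : ℕ) → Set
Bound n total = (n ≤ 10 → 6 * n ≤ total + 20) × (10 ≤ n → 4 * n ≤ total)

4n⇒bound : ∀ {n total} → 4 * n ≤ total → Bound n total
4n⇒bound {n} {total} le = (λ n≤10 → ≤-trans (≤-reflexive (split n)) (+-mono-≤ le (*-monoʳ-≤ 2 n≤10))) , λ _ → le
  where
  split : ∀ n → 6 * n ≡ 4 * n + 2 * n
  split = solve-∀

6n⇒bound : ∀ {n total} → 6 * n ≤ total + 20 → Bound n total
6n⇒bound {n} {total} le = (λ _ → le) , λ 10≤n → +-cancelʳ-≤ 20 _ _ (≤-trans (+-monoʳ-≤ (4 * n) (*-monoʳ-≤ 2 10≤n)) (≤-trans (≤-reflexive (split n)) le))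
  where
  split : ∀ n → 4 * n + 2 * n ≡ 6 * n
  split = solve-∀

-- Six is the slope of the first bound and exceeds the slope four of the second; on reaching order
-- ten the first turns into the second.
bound-step : ∀ {n total total′} → Bound n total′ → total′ + 6 ≤ total → Bound (suc n) total
bound-step {n} {total} {total′} (small , large) gain = small′ , large′
  where
  six : ∀ n → 6 * suc n ≡ 6 * n + 6
  six = solve-∀
  four : ∀ n → 4 * suc n ≡ 4 * n + 4
  four = solve-∀
  swap : ∀ t → t + 20 + 6 ≡ t + 6 + 20
  swap = solve-∀
  small′ : suc n ≤ 10 → 6 * suc n ≤ total + 20
  small′ le = ≤-trans (≤-reflexive (six n)) (≤-trans (+-monoˡ-≤ 6 (small (≤-trans (n≤1+n n) le)))
    (≤-trans (≤-reflexive (swap total′)) (+-monoˡ-≤ 20 gain)))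
  large′ : 10 ≤ suc n → 4 * suc n ≤ total
  large′ ge with 10 ≤? n
  ... | yes 10≤n = ≤-trans (≤-reflexive (four n)) (≤-trans (+-mono-≤ (large 10≤n) (m≤m+n 4 2)) gain)
  ... | no 10≰n = proj₂ (6n⇒bound {suc n} {total} (small′ (≰⇒> 10≰n))) ge

module _ {m : ℕ} {G : Graph (2+ m)} (D : Distances G) (tc : TwoConnected G) where
  open Metric D
  open Detours D
  open Costs D tc

  private
    non⇒cost : ∀ {u v} → u ≢ v → ¬ u ~ v → 2 ≤ cost u
    non⇒cost u≢v u≁v = 2≤cost (d≥2 u≢v u≁v)

  removable-or-large : 3 ≤ m → ¬ Exceptional′ G → Removable tc ⊎ Bound (2+ m) total
  removable-or-large m≥3 unexc with any? (λ h → all? λ v → ¬? (v ≟ h) →-dec adj? G h v)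
  ... | yes (h , univ) with nonadjacent? G
  ...   | yes (u , v , u≢v , u≁v) = inj₁ (Candidates.universal D tc (λ {v} → univ v) u≢v u≁v)
  ...   | no none = ⊥-elim (unexc (complete⇒exceptional′ D (all-adjacent {G = G} none)))
  removable-or-large m≥3 unexc | no none with any? (λ u → cost u ≤? 3)
  ...   | no rich = inj₂ (4n⇒bound (≤-trans (≤-reflexive (trans (*-comm 4 (2+ m)) (sym (∑-const (2+ m) 4)))) (∑-mono λ u → ≰⇒> λ le → rich (u , le))))
  ...   | yes (u , poor) with 4 ≤? m | missed u
    where
    missed : ∀ u → ∃ λ v → v ≢ u × ¬ u ~ v
    missed u with ¬∀⟶∃¬ (2+ m) _ (λ v → ¬? (v ≟ u) →-dec adj? G u v) (λ f → none (u , f))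
    ... | v , ¬imp = v , (λ eq → ¬imp λ ne → contradiction eq ne) , λ e → ¬imp λ _ → e
  ...     | yes m≥4 | v , v≢u , u≁v = inj₁ (PrivateNeighbours.poor⇒removable D tc m≥4 poor v≢u u≁v)
  -- Order five leaves no room for a private neighbour. As no vertex is adjacent to all others,
  -- every cost is at least two, and 6 * 5 = 10 + 20.
  ...     | no m≱4 | _ = inj₂ (6n⇒bound (≤-trans (≤-reflexive (cong (λ k → 6 * (2 + k)) m≡3)) (+-monoˡ-≤ 20 ten)))
    where
    m≡3 : m ≡ 3
    m≡3 = ≤-antisym (s≤s⁻¹ (≰⇒> m≱4)) m≥3
    each : ∀ u → 2 ≤ cost u
    each u with ¬∀⟶∃¬ (2+ m) _ (λ v → ¬? (v ≟ u) →-dec adj? G u v) (λ f → none (u , f))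
    ... | v , ¬imp = non⇒cost {u} {v} (λ eq → ¬imp λ ne → contradiction (sym eq) ne) λ e → ¬imp λ _ → e
    ten : 10 ≤ total
    ten = ≤-trans (≤-reflexive (trans (cong (λ k → (2 + k) * 2) (sym m≡3)) (sym (∑-const (2+ m) 2)))) (∑-mono each)

  module Gain (m≥3 : 3 ≤ m) (ρ : Removable tc) where
    open Removable ρ
    module R = Removal D tc (≤-trans (n≤1+n 2) m≥3) dominates
    tc′ : TwoConnected (G ∖ x)
    tc′ = R.twoConnected farthest

    gain-or-large : ¬ Exceptional′ G → Metric.total R.distances + 6 ≤ total ⊎ 4 * (2+ m) ≤ total
    gain-or-large unexc with 3 ≤? cost x
    ... | yes three = inj₁ (≤-trans (+-monoʳ-≤ (Metric.total R.distances) (+-mono-≤ three three)) R.gain)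
    ... | no ¬three with any? (λ y → any? λ y′ → adj? G x y ×-dec adj? G x y′ ×-dec ¬? (y ≟ y′) ×-dec ¬? (adj? G y y′))
    ...   | yes (y , y′ , e , e′ , y≢y′ , y≁y′) = inj₁ (≤-trans (+-monoʳ-≤ (Metric.total R.distances) six)
              (≤-trans (≤-reflexive (sym (+-assoc (Metric.total R.distances) (cost x + cost x) 4))) (R.gain-through e e′ y≢y′ y≁y′)))
      where
      two : 2 ≤ cost x
      two = non⇒cost x≢w x≁w
      six : 6 ≤ cost x + cost x + 4
      six = ≤-trans (m≤m+n 6 2) (+-monoˡ-≤ 4 (+-mono-≤ two two))
    ...   | no clique = inj₂ ([ ⊥-elim ∘ unexc , (λ le → le) ]′ (Simplicial.simplicial D tc
              (≤-antisym (s≤s⁻¹ (≰⇒> ¬three)) (non⇒cost x≢w x≁w))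
              (λ {y} {y′} e e′ y≢y′ → decidable-stable (adj? G y y′) λ y≁y′ → clique (y , y′ , e , e′ , y≢y′ , y≁y′))
              (x≢w ∘ sym) x≁w))

bound : ∀ m → 3 ≤ m → {G : Graph (2+ m)} (D : Distances G) → TwoConnected G → ¬ Exceptional′ G → Bound (2+ m) (Metric.total D)

bound-removable : ∀ m → 3 ≤ m → {G : Graph (2+ m)} (D : Distances G) (tc : TwoConnected G) → ¬ Exceptional′ G → Removable tc → Bound (2+ m) (Metric.total D)

bound m m≥3 D tc unexc = [ bound-removable m m≥3 D tc unexc , (λ b → b) ]′ (removable-or-large D tc m≥3 unexc)

bound-removable (suc m) m≥3 {G} D tc unexc ρ = [ gained , 4n⇒bound ]′ (gain-or-large unexc)
  where
  open Gain D tc m≥3 ρ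
  open Removable ρ
  open NearExceptional D tc m≥3 dominates farthest unexc
  gained : Metric.total R.distances + 6 ≤ Metric.total D → Bound (3 + m) (Metric.total D)
  gained six with 4 ≤? suc m
  ... | yes m≥4 with exceptional′? (G ∖ x)
  ...   | yes exc = 6n⇒bound (near-exceptional m≥4 x≢w x≁w exc)
  ...   | no unexc′ = bound-step (bound m (s≤s⁻¹ m≥4) R.distances tc′ unexc′) six
  gained six | no m≱4 with nonadjacent? (G ∖ x)
  ...   | no none = 6n⇒bound (complete⇒large (all-adjacent {G = G ∖ x} none))
  -- The base of the induction, with `G ∖ x` of order four: `u` has cost two there, counted in both
  -- orders, and the step adds six, which makes ten.
  ...   | yes (u , v , u≢v , u≁v) = 6n⇒bound (≤-trans (≤-reflexive (cong (λ k → 6 * (3 + k)) m≡2)) (+-monoˡ-≤ 20 (≤-trans (+-monoˡ-≤ 6 four) six)))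
    where
    m≡2 : m ≡ 2
    m≡2 = suc-injective (≤-antisym (s≤s⁻¹ (≰⇒> m≱4)) m≥3)
    two : 2 ≤ Metric.cost R.distances u
    two = Costs.2≤cost R.distances tc′ (Detours.d≥2 R.distances u≢v u≁v)
    four : 4 ≤ Metric.total R.distances
    four = ≤-trans (+-mono-≤ two two) (Totals.2cost≤total R.distances u)

-- Isomorphisms with the exceptional graphs

-- `completePlus` joins its new vertex to the first `t` old ones, so an isomorphism has to list the
-- neighbours first. The recursion keeps vertex zero in front if it satisfies `P` and sends it to
-- the last place if not.
sort : (P : Fin n → Set) (P? : Decidable P) → ∃ λ (π : Permutation n n) → ∀ i → P i ⇔ toℕ (π Perm.⟨$⟩ʳ i) < ∑ (λ i → ⟦ P? i ⟧)
sort {zero} P P? = Perm.id , λ ()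
sort {suc n} P P? with sort (P ∘ suc) (P? ∘ suc) | P? zero in eq
... | π , ok | yes p = Perm.lift₀ π , λ
  { zero → mk⇔ (λ _ → subst (0 <_) (sym count) (s≤s z≤n)) (λ _ → p)
  ; (suc i) → mk⇔ (λ q → subst (suc (toℕ (π Perm.⟨$⟩ʳ i)) <_) (sym count) (s≤s (Equivalence.to (ok i) q)))
                  (λ lt → Equivalence.from (ok i) (s≤s⁻¹ (subst (suc (toℕ (π Perm.⟨$⟩ʳ i)) <_) count lt))) }
  where
  count : ∑ (λ i → ⟦ P? i ⟧) ≡ suc (∑ (λ i → ⟦ P? (suc i) ⟧))
  count = trans (∑-punch zero _) (cong (λ δ → ⟦ δ ⟧ + ∑ (λ i → ⟦ P? (suc i) ⟧)) eq)
... | π , ok | no ¬p = Perm.insert zero (fromℕ n) π , λ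
  { zero → mk⇔ (λ p → contradiction p ¬p) (λ lt → contradiction (subst₂ _<_ (Fin.toℕ-fromℕ n) count lt) (≤⇒≯ small))
  ; (suc i) → mk⇔ (λ q → subst₂ _<_ (sym (place i)) (sym count) (Equivalence.to (ok i) q))
                  (λ lt → Equivalence.from (ok i) (subst₂ _<_ (place i) count lt)) }
  where
  count : ∑ (λ i → ⟦ P? i ⟧) ≡ ∑ (λ i → ⟦ P? (suc i) ⟧)
  count = trans (∑-punch zero _) (cong (λ δ → ⟦ δ ⟧ + ∑ (λ i → ⟦ P? (suc i) ⟧)) eq)
  small : ∑ (λ i → ⟦ P? (suc i) ⟧) ≤ n
  small = ≤-trans (∑-mono (λ i → ⟦⟧-mono (P? (suc i)) (yes i) (λ _ → i))) (≤-reflexive (trans (∑-const n 1) (*-identityʳ n)))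
  punchIn-last : ∀ {n} (j : Fin n) → toℕ (punchIn (fromℕ n) j) ≡ toℕ j
  punchIn-last zero = refl
  punchIn-last (suc j) = cong suc (punchIn-last j)
  place : ∀ i → toℕ (Perm.insert zero (fromℕ n) π Perm.⟨$⟩ʳ suc i) ≡ toℕ (π Perm.⟨$⟩ʳ i)
  place i = trans (cong toℕ (Perm.insert-punchIn zero (fromℕ n) π i)) (punchIn-last (π Perm.⟨$⟩ʳ i))

insert-at : (i : Fin (suc m)) (j : Fin (suc n)) (π : Permutation m n) → Perm.insert i j π Perm.⟨$⟩ʳ i ≡ j
insert-at i j π with i ≟ i
... | yes _ = refl
... | no i≢i = contradiction refl i≢i

star≅completePlus : (G : Graph (suc n)) {z : Fin (suc n)} → AllAdjacentExcept G z → G ≅ completePlus (suc n) (degree G z)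
star≅completePlus {n} G {z} clique = record { bijection = Perm.insert z zero π ; adjacency = λ u v → adjacency u v (u ≟ z) (v ≟ z) }
  where
  sorted = sort (λ i → Adj G z (punchIn z i)) (λ i → adj? G z (punchIn z i))
  π = proj₁ sorted
  H = completePlus (suc n) (degree G z)
  f : Fin (suc n) → Fin (suc n)
  f = Perm.insert z zero π Perm.⟨$⟩ʳ_
  count : degree G z ≡ ∑ (λ i → ⟦ adj? G z (punchIn z i) ⟧)
  count = trans (∑-punch z _) (cong (_+ ∑ (λ i → ⟦ adj? G z (punchIn z i) ⟧)) (⟦⟧-no (adj? G z z) (Graph.irrefl G refl)))
  fz : f z ≡ zero
  fz = insert-at z zero π
  fp : ∀ i → f (punchIn z i) ≡ suc (π Perm.⟨$⟩ʳ i)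
  fp = Perm.insert-punchIn z zero π
  spoke : ∀ i → Adj G z (punchIn z i) ⇔ (toℕ (π Perm.⟨$⟩ʳ i) < degree G z)
  spoke i = mk⇔ (λ e → subst (toℕ (π Perm.⟨$⟩ʳ i) <_) (sym count) (Equivalence.to (proj₂ sorted i) e))
                (λ lt → Equivalence.from (proj₂ sorted i) (subst (toℕ (π Perm.⟨$⟩ʳ i) <_) count lt))
  injective : ∀ {i j} → π Perm.⟨$⟩ʳ i ≡ π Perm.⟨$⟩ʳ j → i ≡ j
  injective eq = trans (sym (Perm.inverseˡ π)) (trans (cong (π Perm.⟨$⟩ˡ_) eq) (Perm.inverseˡ π))
  adjacency : ∀ u v → Dec (u ≡ z) → Dec (v ≡ z) → Adj G u v ⇔ Adj H (f u) (f v)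
  adjacency u v (yes refl) (yes refl) = mk⇔ (λ e → contradiction e (Graph.irrefl G refl)) (λ e → contradiction (subst₂ (Adj H) fz fz e) λ ())
  adjacency u v (yes refl) (no v≢z) with punch-onto (v≢z ∘ sym)
  ... | j , refl = mk⇔ (λ e → subst₂ (Adj H) (sym fz) (sym (fp j)) (Equivalence.to (spoke j) e))
                       (λ e → Equivalence.from (spoke j) (subst₂ (Adj H) fz (fp j) e))
  adjacency u v (no u≢z) (yes refl) with punch-onto (u≢z ∘ sym)
  ... | i , refl = mk⇔ (λ e → subst₂ (Adj H) (sym (fp i)) (sym fz) (Equivalence.to (spoke i) (Graph.sym G e)))
                       (λ e → Graph.sym G (Equivalence.from (spoke i) (subst₂ (Adj H) (fp i) fz e)))
  adjacency u v (no u≢z) (no v≢z) with punch-onto (u≢z ∘ sym) | punch-onto (v≢z ∘ sym)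
  ... | i , refl | j , refl = mk⇔
    (λ e → subst₂ (Adj H) (sym (fp i)) (sym (fp j)) λ eq → Graph.irrefl G (cong (punchIn z) (injective eq)) e)
    (λ e → clique u≢z v≢z λ eq → subst₂ (Adj H) (fp i) (fp j) e (cong (π Perm.⟨$⟩ʳ_) (punchIn-injective z _ _ eq)))

complete≅ : (G : Graph n) → (∀ {u v} → u ≢ v → Adj G u v) → G ≅ complete n
complete≅ G adjacent = record { bijection = Perm.id ; adjacency = λ u v → mk⇔ (λ e u≡v → Graph.irrefl G u≡v e) adjacent }

exceptional′⇒exceptional : {G : Graph n} → Distances G → TwoConnected G → Exceptional′ G → Exceptional G
exceptional′⇒exceptional {suc n} {G} D tc (z , clique , dg) = main dg
  where
  open Neighbourhood D z
  main : degree G z ≤ 2 ⊎ suc n ≤ 2 + degree G z → Exceptional G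
  main (inj₁ le) = inj₂ (inj₁ (subst (λ k → G ≅ completePlus (suc n) k) (≤-antisym le (degree≥2 tc z)) (star≅completePlus G clique)))
  main (inj₂ le) with any? non?
  ... | yes (w , nw) = inj₂ (inj₂ (subst (λ k → G ≅ completePlus (suc n) k) t≡ (star≅completePlus G clique)))
    where
    t≡ : t ≡ suc n ∸ 2
    t≡ = ≤-antisym (m+n≤o⇒m≤o∸n t (≤-trans (≤-reflexive (+-comm t 2)) (≤-trans (s≤s (≤-trans (≤-reflexive (+-comm 1 t)) (+-monoʳ-≤ t (s≥1 nw)))) (≤-reflexive order))))
                   (m≤n+o⇒m∸n≤o (suc n) 2 le)
  ... | no none = inj₁ (complete≅ G adjacent)
    where
    z~ : ∀ {v} → v ≢ z → Adj G z v
    z~ {v} v≢z = decidable-stable (adj? G z v) λ z≁v → none (v , v≢z , z≁v)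
    adjacent : ∀ {u v} → u ≢ v → Adj G u v
    adjacent {u} {v} u≢v with u ≟ z | v ≟ z
    ... | yes refl | _ = z~ (u≢v ∘ sym)
    ... | no u≢z | yes refl = Graph.sym G (z~ u≢z)
    ... | no u≢z | no v≢z = clique u≢z v≢z u≢v

-- The Szeged and Wiener indices

sum-cartesianProduct : (f : Fin n × Fin n → ℕ) (xs ys : List (Fin n)) →
  sumᴸ (List.map f (List.cartesianProduct xs ys)) ≡ sumᴸ (List.map (λ x → sumᴸ (List.map (λ y → f (x , y)) ys)) xs)
sum-cartesianProduct f [] ys = refl
sum-cartesianProduct f (x ∷ xs) ys = trans (cong sumᴸ (map-++ f (List.map (x ,_) ys) _))
  (trans (sum-++ (List.map f (List.map (x ,_) ys)) _)
    (cong₂ _+_ (cong sumᴸ (sym (map-∘ ys))) (sum-cartesianProduct f xs ys)))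

sum-filter : {X : Set} {P : X → Set} (P? : Decidable P) (f : X → ℕ) (xs : List X) →
  sumᴸ (List.map f (List.filter P? xs)) ≡ sumᴸ (List.map (λ x → ⟦ P? x ⟧ * f x) xs)
sum-filter P? f [] = refl
sum-filter P? f (x ∷ xs) with P? x
... | yes _ = cong₂ _+_ (sym (+-identityʳ (f x))) (sum-filter P? f xs)
... | no _ = sum-filter P? f xs

length-filter : {X : Set} {P : X → Set} (P? : Decidable P) (xs : List X) → length (List.filter P? xs) ≡ sumᴸ (List.map (λ x → ⟦ P? x ⟧) xs)
length-filter P? [] = refl
length-filter P? (x ∷ xs) with P? x
... | yes _ = cong suc (length-filter P? xs)
... | no _ = length-filter P? xs

opaque
  unfolding ∑

  sum-tabulate : (f : Fin n → X) (h : X → ℕ) → sumᴸ (List.map h (List.tabulate f)) ≡ ∑ (h ∘ f)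
  sum-tabulate {zero} f h = refl
  sum-tabulate {suc n} f h = cong (h (f zero) +_) (sum-tabulate (f ∘ suc) h)

sum-allFin : (h : Fin n → ℕ) → sumᴸ (List.map h (List.allFin n)) ≡ ∑ h
sum-allFin h = sum-tabulate (λ i → i) h

sum-pairs : (f : Fin n × Fin n → ℕ) → sumᴸ (List.map f (pairs n)) ≡ ∑∑ (λ e → ⟦ uncurry Fin._<?_ e ⟧ * f e)
sum-pairs {n} f = trans (sum-filter (uncurry Fin._<?_) f (List.cartesianProduct (List.allFin n) (List.allFin n))) (trans (sum-cartesianProduct _ (List.allFin n) (List.allFin n))
  (trans (sum-allFin _) (∑-cong λ i → sum-allFin _)))

∑∑-cong : {f h : Fin n × Fin n → ℕ} → (∀ i j → f (i , j) ≡ h (i , j)) → ∑∑ f ≡ ∑∑ h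
∑∑-cong eq = ∑-cong λ i → ∑-cong λ j → eq i j

unordered : (h : Fin n → Fin n → ℕ) → (∀ i → h i i ≡ 0) → (∀ i j → h i j ≡ h j i) →
            ∑∑ (uncurry h) ≡ ∑∑ (λ e → ⟦ uncurry Fin._<?_ e ⟧ * uncurry h e) + ∑∑ (λ e → ⟦ uncurry Fin._<?_ e ⟧ * uncurry h e)
unordered {n} h h0 h-sym = trans (∑∑-cong split) (trans (∑∑-+ (λ e → ⟦ uncurry Fin._<?_ e ⟧ * uncurry h e) (λ (i , j) → ⟦ j Fin.<? i ⟧ * h i j))
  (cong (λ k → ∑∑ (λ e → ⟦ uncurry Fin._<?_ e ⟧ * uncurry h e) + k)
    (trans (∑-comm (λ i j → ⟦ j Fin.<? i ⟧ * h i j)) (∑-cong λ j → ∑-cong λ i → cong (⟦ j Fin.<? i ⟧ *_) (h-sym i j)))))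
  where
  split : ∀ i j → h i j ≡ ⟦ i Fin.<? j ⟧ * h i j + ⟦ j Fin.<? i ⟧ * h i j
  split i j = case Fin.<-cmp i j of λ where
    (tri< lt _ ¬gt) → trans (sym (trans (+-identityʳ _) (+-identityʳ _)))
       (cong₂ (λ p q → p * h i j + q * h i j) (sym (⟦⟧-yes (i Fin.<? j) lt)) (sym (⟦⟧-no (j Fin.<? i) ¬gt)))
    (tri≈ _ refl _) → trans (h0 i) (sym (trans (cong (λ k → ⟦ i Fin.<? i ⟧ * k + ⟦ i Fin.<? i ⟧ * k) (h0 i)) (cong₂ _+_ (*-zeroʳ ⟦ i Fin.<? i ⟧) (*-zeroʳ ⟦ i Fin.<? i ⟧))))
    (tri> ¬lt _ gt) → trans (sym (+-identityʳ _))
       (cong₂ (λ p q → p * h i j + q * h i j) (sym (⟦⟧-no (i Fin.<? j) ¬lt)) (sym (⟦⟧-yes (j Fin.<? i) gt)))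

module Indices {n : ℕ} (G : Graph n) (conn : Connected G) where
  D : Distances G
  D = FromWalks.distances G conn
  open Metric D
  open Detours D

  nearer : Fin n → Fin n → ℕ
  nearer a b = ∑ λ x → ⟦ d x a <? d x b ⟧

  closer≡ : ∀ a b → closer G conn a b ≡ nearer a b
  closer≡ a b = trans (length-filter (λ x → d x a <? d x b) (List.allFin n)) (sum-allFin _)

  edge-weight : Fin n → Fin n → ℕ
  edge-weight a b = ⟦ adj? G a b ⟧ * (nearer a b * nearer b a)

  szeged≡ : szeged G conn ≡ ∑∑ (λ e → ⟦ uncurry Fin._<?_ e ⟧ * uncurry edge-weight e)
  szeged≡ = trans (sum-filter (uncurry (adj? G)) _ (pairs n)) (trans (sum-pairs _)
    (∑∑-cong λ a b → cong (λ k → ⟦ a Fin.<? b ⟧ * (⟦ adj? G a b ⟧ * k)) (cong₂ _*_ (closer≡ a b) (closer≡ b a))))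

  edge-weight-sym : ∀ a b → edge-weight a b ≡ edge-weight b a
  edge-weight-sym a b = cong₂ _*_ (⟦⟧-cong (adj? G a b) (adj? G b a) ~-sym ~-sym) (*-comm (nearer a b) (nearer b a))

  ∑-swap : (F : Fin n → Fin n → Fin n → Fin n → ℕ) →
           ∑ (λ x → ∑ λ y → ∑ λ a → ∑ λ b → F x y a b) ≡ ∑ (λ a → ∑ λ b → ∑ λ x → ∑ λ y → F x y a b)
  ∑-swap F = begin
    ∑ (λ x → ∑ λ y → ∑ λ a → ∑ λ b → F x y a b)  ≡⟨ ∑-cong (λ x → ∑-comm (λ y a → ∑ λ b → F x y a b)) ⟩
    ∑ (λ x → ∑ λ a → ∑ λ y → ∑ λ b → F x y a b)  ≡⟨ ∑-comm (λ x a → ∑ λ y → ∑ λ b → F x y a b) ⟩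
    ∑ (λ a → ∑ λ x → ∑ λ y → ∑ λ b → F x y a b)  ≡⟨ ∑-cong (λ a → ∑-cong λ x → ∑-comm (λ y b → F x y a b)) ⟩
    ∑ (λ a → ∑ λ x → ∑ λ b → ∑ λ y → F x y a b)  ≡⟨ ∑-cong (λ a → ∑-comm (λ x b → ∑ λ y → F x y a b)) ⟩
    ∑ (λ a → ∑ λ b → ∑ λ x → ∑ λ y → F x y a b)  ∎
    where open ≡-Reasoning

  ∑-*ˡ : (k : ℕ) (f : Fin n → ℕ) → ∑ (λ i → k * f i) ≡ k * ∑ f
  ∑-*ˡ k f = trans (∑-cong λ i → *-comm k (f i)) (trans (∑-*ʳ f k) (*-comm (∑ f) k))

  -- After exchanging the sums, the conditions on `x` and on `y` for a fixed oriented edge are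
  -- independent, so the pairs are counted by a product. Both orientations of an edge occur, hence
  -- twice the Szeged index.
  good-total : ∑ (λ x → ∑ λ y → g x y) ≡ ∑∑ (uncurry edge-weight)
  good-total = trans (∑-swap λ x y a b → ⟦ good? x y (a , b) ⟧) (∑∑-cong factor)
    where
    open ≡-Reasoning
    factor : ∀ a b → ∑ (λ x → ∑ λ y → ⟦ good? x y (a , b) ⟧) ≡ edge-weight a b
    factor a b = begin
      ∑ (λ x → ∑ λ y → ⟦ good? x y (a , b) ⟧)
        ≡⟨ ∑-cong (λ x → ∑-cong λ y → trans (⟦⟧-× (adj? G a b) (d x a <? d x b ×-dec d y b <? d y a)) (cong (⟦ adj? G a b ⟧ *_) (⟦⟧-× (d x a <? d x b) (d y b <? d y a)))) ⟩
      ∑ (λ x → ∑ λ y → ⟦ adj? G a b ⟧ * (⟦ d x a <? d x b ⟧ * ⟦ d y b <? d y a ⟧))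
        ≡⟨ ∑-cong (λ x → trans (∑-*ˡ ⟦ adj? G a b ⟧ (λ y → ⟦ d x a <? d x b ⟧ * ⟦ d y b <? d y a ⟧)) (cong (⟦ adj? G a b ⟧ *_) (∑-*ˡ ⟦ d x a <? d x b ⟧ (λ y → ⟦ d y b <? d y a ⟧)))) ⟩
      ∑ (λ x → ⟦ adj? G a b ⟧ * (⟦ d x a <? d x b ⟧ * nearer b a))
        ≡⟨ trans (∑-*ˡ ⟦ adj? G a b ⟧ (λ x → ⟦ d x a <? d x b ⟧ * nearer b a)) (cong (⟦ adj? G a b ⟧ *_) (∑-*ʳ (λ x → ⟦ d x a <? d x b ⟧) (nearer b a))) ⟩
      edge-weight a b ∎

  twice-szeged : szeged G conn + szeged G conn ≡ ∑ (λ x → ∑ λ y → g x y)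
  twice-szeged = trans (cong₂ _+_ szeged≡ szeged≡) (trans (sym (unordered edge-weight
    (λ a → cong (_* (nearer a a * nearer a a)) (⟦⟧-no (adj? G a a) (λ e → ~⇒≢ e refl))) edge-weight-sym)) (sym good-total))

  twice-wiener : wiener G conn + wiener G conn ≡ ∑∑ (uncurry d)
  twice-wiener = trans (cong₂ _+_ (sum-pairs (uncurry d)) (sum-pairs (uncurry d))) (sym (unordered d d0 d-sym))

  twice-gap : szeged G conn + szeged G conn ≡ wiener G conn + wiener G conn + total
  twice-gap = trans twice-szeged (trans (∑-cong λ x → ∑-cong λ y → sym (d+c≡g x y))
    (trans (∑∑-+ (uncurry d) (uncurry c)) (cong (_+ total) (sym twice-wiener))))

halve : ∀ {i j} → i + i ≤ j + j → i ≤ j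
halve {i} {j} le = ≮⇒≥ λ lt → <⇒≱ (+-mono-<-≤ lt (<⇒≤ lt)) le

open import Data.Integer.Base as ℤ using (+_)
import Data.Integer.Properties as ℤ

theorem6 : ∀ {n : ℕ} (G : Graph n) (c : TwoConnected G) → n ≥ 10 → ¬ Exceptional G →
    η G (TwoConnected.connected c) ℤ.≥ + (2 * n)
theorem6 {suc zero} G c (s≤s ()) _
theorem6 {2+ m} G c n≥10@(s≤s (s≤s m≥8)) unexc = subst (ℤ._≥ + (2 * (2+ m)))
  (sym (trans (ℤ.m-n≡m⊖n (szeged G conn) (wiener G conn)) (ℤ.⊖-≥ (m+n≤o⇒m≤o (wiener G conn) large))))
  (ℤ.+≤+ (m+n≤o⇒m≤o∸n (2 * (2+ m)) (≤-trans (≤-reflexive (+-comm _ (wiener G conn))) large)))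
  where
  conn = TwoConnected.connected c
  open Indices G conn
  gap : 4 * (2+ m) ≤ Metric.total D
  gap = proj₂ (bound m (≤-trans (m≤m+n 3 5) m≥8) D c (unexc ∘ exceptional′⇒exceptional D c)) n≥10
  large : wiener G conn + 2 * (2+ m) ≤ szeged G conn
  large = halve (≤-trans (≤-trans (≤-reflexive (rearrange (wiener G conn) (2+ m))) (+-monoʳ-≤ (wiener G conn + wiener G conn) gap)) (≤-reflexive (sym twice-gap)))
    where
    rearrange : ∀ w n → w + 2 * n + (w + 2 * n) ≡ w + w + 4 * n
    rearrange = solve-∀
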